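{- Let $1\le m\le n$ and $d$ be integers. If $m+1\le n\le 2m-5$ and $\lceil\frac{m+n-4}{3}\rceil\le d\le m-3$, then $\tilde{H}_d(\mathsf{M}_{m,n};\mathbb{Z})$ contains an element of order $3$. Moreover, if $\lceil\frac{2m-4}{3}\rceil\le d\le m-4$, then $\tilde{H}_d(\mathsf{M}_{m,m};\mathbb{Z})$ contains an element of order $3$.
   Context: $\mathsf{M}_{m,n}$ denotes the chessboard complex: the simplicial complex whose faces are the matchings (sets of pairwise vertex-disjoint edges) in the complete bipartite graph $K_{m,n}$. $\tilde H$ denotes reduced simplicial homology. -}

module Defs where

open import Data.Nat using (ℕ; zero; suc; _+_; _*_; _∸_; _/_)
open import Data.Integer using (ℤ; -_) renaming (_+_ to _+ℤ_; _*_ to _*ℤ_; 0ℤ to 0ℤ; 1ℤ to 1ℤ)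
open import Data.Fin using (Fin; zero; suc; _≟_)
open import Data.Maybe using (Maybe; just; nothing)
open import Data.Vec using (Vec; []; _∷_; lookup; _[_]≔_)
open import Data.List using (List; foldr; map; concatMap; allFin)
open import Data.Bool using (Bool; true; false; if_then_else_; _∨_; _∧_; not)
open import Data.Product using (Σ; _×_; ∃)
open import Relation.Nullary using (¬_; does)
open import Relation.Binary.PropositionalEquality using (_≡_)

-- A (possibly invalid) face of the chessboard complex M_{m,n}: a partial map
-- rows → columns, row i ↦ just j meaning the edge (i,j) of K_{m,n} is in the face.
Face : ℕ → ℕ → Set
Face m n = Vec (Maybe (Fin n)) m

size : ∀ {m n} → Face m n → ℕ
size [] = 0
size (nothing ∷ σ) = size σ
size (just _ ∷ σ) = suc (size σ)

-- the edges are pairwise vertex-disjoint (rows are automatically distinct)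
IsMatching : ∀ {m n} → Face m n → Set
IsMatching {m} {n} σ = ∀ (i i' : Fin m) (j : Fin n) →
  lookup σ i ≡ just j → lookup σ i' ≡ just j → i ≡ i'

IsFace : ∀ {m n} → ℕ → Face m n → Set
IsFace d σ = IsMatching σ × size σ ≡ suc d

-- integer-valued function on faces; only its values on faces of the relevant
-- dimension matter (there are finitely many, so this is the chain group C_d)
Chain : ℕ → ℕ → Set
Chain m n = Face m n → ℤ

isNothing : ∀ {n} → Maybe (Fin n) → Bool
isNothing nothing = true
isNothing (just _) = false

colUsed : ∀ {m n} → Fin n → Face m n → Bool
colUsed j [] = false
colUsed j (nothing ∷ σ) = colUsed j σ
colUsed j (just j' ∷ σ) = does (j ≟ j') ∨ colUsed j σ

-- number of edges of σ in rows strictly below i (position of the new vertex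
-- (i,j) in σ ∪ {(i,j)} w.r.t. the lexicographic vertex order)
below : ∀ {m n} → Face m n → Fin m → ℕ
below (x ∷ σ) zero = 0
below (nothing ∷ σ) (suc i) = below σ i
below (just _ ∷ σ) (suc i) = suc (below σ i)

signℤ : ℕ → ℤ
signℤ zero = 1ℤ
signℤ (suc k) = - signℤ k

sumℤ : List ℤ → ℤ
sumℤ = foldr _+ℤ_ 0ℤ

-- simplicial boundary (vertices ordered lexicographically by (row, column)):
-- (∂ c)(σ) = Σ_{τ = σ ∪ {(i,j)}} (-1)^{position of (i,j) in τ} c(τ).
-- On faces of size 0 (the empty face, dimension -1) this is the augmentation,
-- so it computes the reduced chain complex.
∂ : ∀ {m n} → Chain m n → Chain m n
∂ {m} {n} c σ = sumℤ (concatMap (λ i → map (λ j → term i j) (allFin n)) (allFin m))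
  where
  term : Fin m → Fin n → ℤ
  term i j = if isNothing (lookup σ i) ∧ not (colUsed j σ)
             then signℤ (below σ i) *ℤ c (σ [ i ]≔ just j)
             else 0ℤ

IsCycle : ∀ {m n} → ℕ → Chain m n → Set
IsCycle {m} {n} zero z = ∀ (σ : Face m n) → IsMatching σ → size σ ≡ 0 → ∂ z σ ≡ 0ℤ
IsCycle {m} {n} (suc d) z = ∀ (σ : Face m n) → IsFace d σ → ∂ z σ ≡ 0ℤ

IsBoundary : ∀ {m n} → ℕ → Chain m n → Set
IsBoundary {m} {n} d z = ∃ λ (w : Chain m n) → ∀ (τ : Face m n) → IsFace d τ → ∂ w τ ≡ z τ

scale : ∀ {m n} → ℤ → Chain m n → Chain m n
scale k z σ = k *ℤ z σ

-- H̃_d(M_{m,n}; ℤ) contains an element of order 3: a class [z] ≠ 0 with 3[z] = 0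
-- (3 prime, so the order is exactly 3).
HasElementOfOrder3 : ℕ → ℕ → ℕ → Set
HasElementOfOrder3 m n d = ∃ λ (z : Chain m n) →
  IsCycle d z × ¬ IsBoundary d z × IsBoundary d (scale (Data.Integer.+ 3) z)

⌈_/3⌉ : ℕ → ℕ
⌈ a /3⌉ = (a + 2) / 3

{-# OPTIONS --safe #-}
module Submission where

-- Put a = n - m, b = m - 1 - d and k = 3d + 4 - m - n. The class of order three is that of the join of the
-- fundamental cycle γ of the pseudomanifold M_{k+1,k+2}, a cycle T₅₅ in M_{5,5}, and a + b - 3 copies of the
-- 0-sphere M_{1,2} and b - 2 copies of M_{2,1}. Here T₅₅ is itself the join of one M_{1,2} and two M_{2,1},
-- with a column to spare, and an explicit chain with boundary 3 T₅₅ shows that the class is killed by 3.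
--
-- The class is nonzero because a cocycle with values in 𝔽₃, on the matching complex of the complete graph
-- on all rows and columns, does not vanish on it. For faces with K edges and 3K + 1 vertices such a cocycle
-- φ is built by induction on K. Three new vertices b₀, b₁, b₂ are added: a face containing the edges
-- x bᵢ and y bⱼ is contracted by replacing them with xy, a face with one edge at the new vertices loses it,
-- and the coefficients are such that this is compatible with boundaries mod 3, up to the value of φ on
-- (xy + yz + zx) σ for the faces containing x b₀, y b₁, z b₂. This value is the coboundary of some η, and that
-- property is inherited because, by the connectivity of matching complexes, a primitive of the new
-- cocycle needs to be found only on the faces avoiding one more vertex, where it can be written down.

open import Defs
open import Data.Nat using (ℕ; zero; suc; _+_; _*_; _∸_; _≤_; _<_; z≤n; s≤s; _/_; _%_)
import Data.Nat as ℕ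
import Data.Nat.DivMod as DivMod
import Data.Nat.Properties as ℕₚ
import Data.Nat.Tactic.RingSolver as ℕ-Solver
open import Data.Integer using (ℤ; 0ℤ; 1ℤ; -_) renaming (_+_ to _+ℤ_; _*_ to _*ℤ_)
import Data.Integer as ℤ
import Data.Integer.Properties as ℤₚ
import Data.Integer.Tactic.RingSolver as ℤ-Solver
open import Data.Bool using (true; false; if_then_else_; _∨_; _∧_; not)
import Data.Bool.Properties as Boolₚ
open import Data.Empty using (⊥)
open import Data.Fin using (Fin; zero; suc; splitAt; _↑ˡ_; _↑ʳ_)
import Data.Fin as Fin
import Data.Fin.Properties as Finₚ
open import Data.List using (List; []; _∷_; length; downFrom; tabulate; map; concatMap; allFin)
import Data.List as List
import Data.List.Properties as Listₚ
open import Data.List.Membership.Propositional using (_∈_)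
open import Data.List.Relation.Unary.All using (All; []; _∷_)
import Data.List.Relation.Unary.All as All
import Data.List.Relation.Unary.All.Properties as Allₚ
open import Data.List.Relation.Unary.AllPairs using ([]; _∷_)
open import Data.List.Relation.Unary.Any using (here; there)
open import Data.List.Relation.Unary.Unique.Propositional using (Unique)
import Data.List.Relation.Unary.Unique.Propositional.Properties as Uniqueₚ
open import Data.Maybe using (Maybe; just; nothing)
import Data.Maybe as Maybe
open import Data.Product using (Σ; ∃; _×_; _,_; proj₁; proj₂)
open import Data.Sum using (_⊎_; inj₁; inj₂; [_,_]′)
open import Data.Unit using (⊤; tt)
open import Data.Vec using (Vec; []; _∷_; lookup; _[_]≔_; _++_)
import Data.Vec as Vec
import Data.Vec.Properties as Vecₚ
open import Function using (_∘_; id)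
open import Relation.Binary.PropositionalEquality
open import Relation.Nullary using (¬_; Dec; yes; no; contradiction; does)
open import Relation.Nullary.Decidable
  using (True; toWitness; map′; _×-dec_; _⊎-dec_; _→-dec_; ¬?)

-- The field with three elements

-- The lower bound on d says k ≥ 0, and d + 3 ≤ m says b ≥ 2. The number a + b - 3 is then
-- nonnegative if a ≥ 1, whereas a = 0 requires b ≥ 3: hence the stricter bound on the diagonal. The
-- cocycle cannot stay on chessboard complexes, because contracting x bᵢ and y bⱼ to xy may connect
-- two rows or two columns. The modulus enters through sums of three terms: the labels 0, 1, 2 of
-- the new vertices add up to zero, and xy + yz + zx has augmentation 3. Evaluation on this triple
-- turns φ into a cocycle for K - 1 edges on 3(K - 1) + 1 vertices, again one vertex too few for
-- connectivity to give a primitive, so its exactness has to be carried through the induction. A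
-- face of dimension d has d + 1 edges, and m + n = 3(d + 1) + 1 - k. So k counts the vertices that
-- are missing from the situation of the tower. They are made up for by k rows of γ, each
-- contributing an edge on only two new vertices; k = 0 is the tight case.

data 𝔽₃ : Set where
  𝟎 𝟏 𝟐 : 𝔽₃

infixl 6 _⊕_ _⊝_
infixl 7 _⊗_
infix 8 ⊖_
infix 4 _≟₃_

_⊕_ : 𝔽₃ → 𝔽₃ → 𝔽₃
𝟎 ⊕ y = y
𝟏 ⊕ 𝟎 = 𝟏
𝟏 ⊕ 𝟏 = 𝟐
𝟏 ⊕ 𝟐 = 𝟎
𝟐 ⊕ 𝟎 = 𝟐
𝟐 ⊕ 𝟏 = 𝟎
𝟐 ⊕ 𝟐 = 𝟏

⊖_ : 𝔽₃ → 𝔽₃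
⊖ 𝟎 = 𝟎
⊖ 𝟏 = 𝟐
⊖ 𝟐 = 𝟏

_⊝_ : 𝔽₃ → 𝔽₃ → 𝔽₃
x ⊝ y = x ⊕ ⊖ y

_⊗_ : 𝔽₃ → 𝔽₃ → 𝔽₃
𝟎 ⊗ y = 𝟎
𝟏 ⊗ y = y
𝟐 ⊗ y = ⊖ y

_≟₃_ : (x y : 𝔽₃) → Dec (x ≡ y)
𝟎 ≟₃ 𝟎 = yes refl
𝟎 ≟₃ 𝟏 = no λ ()
𝟎 ≟₃ 𝟐 = no λ ()
𝟏 ≟₃ 𝟎 = no λ ()
𝟏 ≟₃ 𝟏 = yes refl
𝟏 ≟₃ 𝟐 = no λ ()
𝟐 ≟₃ 𝟎 = no λ ()
𝟐 ≟₃ 𝟏 = no λ ()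
𝟐 ≟₃ 𝟐 = yes refl

all₃? : ∀ {P : 𝔽₃ → Set} → (∀ x → Dec (P x)) → Dec (∀ x → P x)
all₃? P? = map′ (λ { (p , q , r) 𝟎 → p ; (p , q , r) 𝟏 → q ; (p , q , r) 𝟐 → r })
  (λ f → f 𝟎 , f 𝟏 , f 𝟐) (P? 𝟎 ×-dec P? 𝟏 ×-dec P? 𝟐)

-- Identities over 𝔽₃ are verified by evaluating both sides at all arguments.
by₁ : {f g : 𝔽₃ → 𝔽₃} → True (all₃? λ x → f x ≟₃ g x) → ∀ x → f x ≡ g x
by₁ p = toWitness p

by₂ : {f g : 𝔽₃ → 𝔽₃ → 𝔽₃} → True (all₃? λ x → all₃? λ y → f x y ≟₃ g x y) →
  ∀ x y → f x y ≡ g x y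
by₂ p = toWitness p

by₃ : {f g : 𝔽₃ → 𝔽₃ → 𝔽₃ → 𝔽₃} →
  True (all₃? λ x → all₃? λ y → all₃? λ z → f x y z ≟₃ g x y z) →
  ∀ x y z → f x y z ≡ g x y z
by₃ p = toWitness p

by₄ : {f g : 𝔽₃ → 𝔽₃ → 𝔽₃ → 𝔽₃ → 𝔽₃} →
  True (all₃? λ w → all₃? λ x → all₃? λ y → all₃? λ z → f w x y z ≟₃ g w x y z) →
  ∀ w x y z → f w x y z ≡ g w x y z
by₄ p = toWitness p

⊗-⊖ : ∀ s x → s ⊗ ⊖ x ≡ ⊖ (s ⊗ x)
⊗-⊖ = by₂ tt

⊗-distribˡ : ∀ s x y → s ⊗ (x ⊕ y) ≡ s ⊗ x ⊕ s ⊗ y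
⊗-distribˡ = by₃ tt

⊗-distribˡ-⊝ : ∀ s x y → s ⊗ (x ⊝ y) ≡ s ⊗ x ⊝ s ⊗ y
⊗-distribˡ-⊝ = by₃ tt

⊕-assoc : ∀ x y z → (x ⊕ y) ⊕ z ≡ x ⊕ (y ⊕ z)
⊕-assoc = by₃ tt

⊗-zeroʳ : ∀ s → s ⊗ 𝟎 ≡ 𝟎
⊗-zeroʳ = by₁ tt

⊖-involutive : ∀ x → ⊖ ⊖ x ≡ x
⊖-involutive = by₁ tt

⊕-interchange : ∀ w x y z → (w ⊕ x) ⊕ (y ⊕ z) ≡ (w ⊕ y) ⊕ (x ⊕ z)
⊕-interchange = by₄ tt

-- Cochains on matching complexes of complete graphs

Edge : Set
Edge = ℕ × ℕ

Cochain : Set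
Cochain = List Edge → 𝔽₃

ι : Edge → Cochain → Cochain
ι e f σ = f (e ∷ σ)

-- Unrolled, the alternating sum over the faces with one edge omitted. At an edge moved to the
-- front, this recursion reduces a coboundary to one on a link.
δ : Cochain → Cochain
δ f [] = 𝟎
δ f (e ∷ σ) = f σ ⊝ δ (ι e f) σ

𝟘 : Cochain
𝟘 _ = 𝟎

infixr 7 _·_
_·_ : 𝔽₃ → Cochain → Cochain
(s · f) σ = s ⊗ f σ

infixl 6 _∖_
_∖_ : (ℕ → Set) → ℕ → ℕ → Set
(P ∖ a) x = P x × x ≢ a

-- The vertex set is a predicate that shrinks along the list, so that the link of an edge is again a
-- matching complex of the same kind and inductions can pass to it.
Match : (ℕ → Set) → List Edge → Set
Match P [] = ⊤
Match P ((a , b) ∷ σ) = P a × P b × a ≢ b × Match (P ∖ a ∖ b) σ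

private variable
  P Q : ℕ → Set
  f f' h h' : Cochain
  g : ℕ → Cochain
  σ τ : List Edge
  a b c u v w x y z k m n m₁ n₁ m₂ n₂ d : ℕ
  e : Edge
  s : 𝔽₃

_⊆_ : (ℕ → Set) → (ℕ → Set) → Set
P ⊆ Q = ∀ x → P x → Q x

∖-mono : P ⊆ Q → (P ∖ a) ⊆ (Q ∖ a)
∖-mono i x (p , n) = i x p , n

Match-mono : P ⊆ Q → Match P σ → Match Q σ
Match-mono {σ = []} i m = tt
Match-mono {σ = _ ∷ _} i (p , q , n , m) =
  i _ p , i _ q , n , Match-mono (∖-mono (∖-mono i)) m

Match-tail : Match P (e ∷ σ) → Match P σ
Match-tail (_ , _ , _ , m) = Match-mono (λ { _ ((p , _) , _) → p }) m

Match-swap : ∀ {e e'} → Match P (e ∷ e' ∷ σ) → Match P (e' ∷ e ∷ σ)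
Match-swap (p , q , n , ((p' , x) , x') , ((q' , y) , y') , n' , m) =
  p' , q' , n' , ((p , ≢-sym x) , ≢-sym y) , ((q , ≢-sym x') , ≢-sym y') , n ,
  Match-mono (λ { _ ((((r , a) , b) , c) , d) → (((r , c) , d) , a) , b }) m

Match-flip : Match P ((a , b) ∷ σ) → Match P ((b , a) ∷ σ)
Match-flip (p , q , n , m) = q , p , ≢-sym n , Match-mono (λ { _ ((r , a) , b) → (r , b) , a }) m

-- The sign, as an element of 𝔽₃, of an elementary change of the list representing an oriented face.
data Step : 𝔽₃ → List Edge → List Edge → Set where
  swap : ∀ {e e' σ} → Step 𝟐 (e ∷ e' ∷ σ) (e' ∷ e ∷ σ)
  flip : ∀ {a b σ} → Step 𝟏 ((a , b) ∷ σ) ((b , a) ∷ σ)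
  cons : ∀ {s e σ τ} → Step s σ τ → Step s (e ∷ σ) (e ∷ τ)

Alt : (ℕ → Set) → Cochain → Set
Alt P f = ∀ {s σ τ} → Step s σ τ → Match P σ → f σ ≡ s ⊗ f τ

Match-step : Step s σ τ → Match P σ → Match P τ
Match-step swap m = Match-swap m
Match-step flip m = Match-flip m
Match-step (cons st) (p , q , n , m) = p , q , n , Match-step st m

Alt-mono : P ⊆ Q → Alt Q f → Alt P f
Alt-mono i A st m = A st (Match-mono i m)

Alt-ι : P a → P b → a ≢ b → Alt P f → Alt (P ∖ a ∖ b) (ι (a , b) f)
Alt-ι p q n A st m = A (cons st) (p , q , n , m)

Alt-𝟘 : Alt P 𝟘
Alt-𝟘 {s = s} _ _ = sym (⊗-zeroʳ s)

Alt-⊕ : Alt P f → Alt P h → Alt P (λ σ → f σ ⊕ h σ)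
Alt-⊕ {f = f} {h = g} A B {s} {σ} {τ} st m =
  trans (cong₂ _⊕_ (A st m) (B st m)) (sym (⊗-distribˡ s (f τ) (g τ)))

Alt-· : ∀ t → Alt P f → Alt P (t · f)
Alt-· {f = f} t A {s} {σ} {τ} st m = trans (cong (t ⊗_) (A st m)) (comm t s (f τ))
  where
  comm : ∀ t s x → t ⊗ (s ⊗ x) ≡ s ⊗ (t ⊗ x)
  comm = by₃ tt

Alt-⊖ : Alt P f → Alt P (λ σ → ⊖ f σ)
Alt-⊖ = Alt-· 𝟐

δ-cong : ∀ σ → (∀ τ → Match P τ → suc (length τ) ≡ length σ → f τ ≡ h τ) →
  Match P σ → δ f σ ≡ δ h σ
δ-cong [] h m = refl
δ-cong (e ∷ σ) h m@(p , q , n , m') = cong₂ _⊝_ (h σ (Match-tail m) refl)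
  (δ-cong σ (λ τ mτ l → h (e ∷ τ) (p , q , n , mτ) (cong suc l)) m')

δ-⊕ : ∀ f g σ → δ (λ τ → f τ ⊕ g τ) σ ≡ δ f σ ⊕ δ g σ
δ-⊕ f g [] = refl
δ-⊕ f g (e ∷ σ) = trans (cong (f σ ⊕ g σ ⊝_) (δ-⊕ (ι e f) (ι e g) σ))
  (lemma (f σ) (g σ) (δ (ι e f) σ) (δ (ι e g) σ))
  where
  lemma : ∀ w x y z → w ⊕ x ⊝ (y ⊕ z) ≡ (w ⊝ y) ⊕ (x ⊝ z)
  lemma = by₄ tt

δ-· : ∀ s f σ → δ (s · f) σ ≡ s ⊗ δ f σ
δ-· s f [] = sym (⊗-zeroʳ s)
δ-· s f (e ∷ σ) = trans (cong (s ⊗ f σ ⊝_) (δ-· s (ι e f) σ))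
  (sym (⊗-distribˡ-⊝ s (f σ) (δ (ι e f) σ)))

δ-𝟘 : ∀ σ → δ 𝟘 σ ≡ 𝟎
δ-𝟘 [] = refl
δ-𝟘 (e ∷ σ) = cong ⊖_ (δ-𝟘 σ)

Alt-δ : Alt P f → Alt P (δ f)
Alt-δ {f = f} A {σ = _ ∷ _ ∷ σ} (swap {e} {e'}) m@(p , q , n , (p' , _) , (q' , _) , n' , m') =
  trans (cong (λ t → f (e' ∷ σ) ⊝ (f (e ∷ σ) ⊝ t)) eq)
    (lemma (f (e' ∷ σ)) (f (e ∷ σ)) (δ (ι e (ι e' f)) σ))
  where
  eq : δ (ι e' (ι e f)) σ ≡ 𝟐 ⊗ δ (ι e (ι e' f)) σ
  eq = trans (δ-cong σ (λ τ mτ _ → A swap (p , q , n , proj₁ (proj₂ (proj₂ (proj₂ m))) ,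
              proj₁ (proj₂ (proj₂ (proj₂ (proj₂ m)))) , n' , mτ)) m')
         (δ-· 𝟐 (ι e (ι e' f)) σ)
  lemma : ∀ x y z → x ⊝ (y ⊝ 𝟐 ⊗ z) ≡ 𝟐 ⊗ (y ⊝ (x ⊝ z))
  lemma = by₃ tt
Alt-δ {f = f} A {σ = _ ∷ σ} flip (p , q , n , m) =
  cong (f σ ⊝_) (δ-cong σ (λ τ mτ _ → A flip (p , q , n , mτ)) m)
Alt-δ {f = f} A {s} (cons {e = e} {σ} {τ} st) m@(p , q , n , m') =
  trans (cong₂ _⊝_ (A st (Match-tail m)) (Alt-δ {f = ι e f} (Alt-ι p q n A) st m'))
    (sym (⊗-distribˡ-⊝ s (f τ) (δ (ι e f) τ)))

-- The cochain given by f on the faces avoiding v and by g w on the links of the edges (v , w); the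
-- sign arises from moving the edge at v to the front.
ext : ℕ → Cochain → (ℕ → Cochain) → Cochain
ext v f g [] = f []
ext v f g ((a , b) ∷ σ) with v ℕ.≟ a | v ℕ.≟ b
... | yes _ | _     = g b σ
... | no _  | yes _ = g a σ
... | no _  | no _  = ext v (ι (a , b) f) (λ w τ → ⊖ g w ((a , b) ∷ τ)) σ

module _ (v : ℕ) (f : Cochain) (g : ℕ → Cochain) where

  ext-hit : ∀ w σ → ext v f g ((v , w) ∷ σ) ≡ g w σ
  ext-hit w σ with v ℕ.≟ v
  ... | yes _ = refl
  ... | no ¬p = contradiction refl ¬p

  ext-hit′ : ∀ w σ → v ≢ w → ext v f g ((w , v) ∷ σ) ≡ g w σ
  ext-hit′ w σ v≢w with v ℕ.≟ w | v ℕ.≟ v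
  ... | yes p | _     = contradiction p v≢w
  ... | no _  | yes _ = refl
  ... | no _  | no ¬p = contradiction refl ¬p

  ext-miss : ∀ a b σ → v ≢ a → v ≢ b → ext v f g ((a , b) ∷ σ) ≡
    ext v (ι (a , b) f) (λ w τ → ⊖ g w ((a , b) ∷ τ)) σ
  ext-miss a b σ v≢a v≢b with v ℕ.≟ a | v ℕ.≟ b
  ... | yes p | _     = contradiction p v≢a
  ... | no _  | yes p = contradiction p v≢b
  ... | no _  | no _  = refl

data Meets (v : ℕ) : Edge → Set where
  hit  : ∀ {w} → v ≢ w → Meets v (v , w)
  hit′ : ∀ {w} → v ≢ w → Meets v (w , v)
  miss : ∀ {a b} → v ≢ a → v ≢ b → Meets v (a , b)

meets : ∀ v a b → a ≢ b → Meets v (a , b)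
meets v a b a≢b with v ℕ.≟ a | v ℕ.≟ b
... | yes refl | _        = hit a≢b
... | no v≢a   | yes refl = hit′ v≢a
... | no v≢a   | no v≢b   = miss v≢a v≢b

∖-rotate : (P ∖ v ∖ a ∖ b) ⊆ (P ∖ a ∖ b ∖ v)
∖-rotate _ (((p , v) , a) , b) = ((p , a) , b) , v

∖-rotate⁻ : (P ∖ a ∖ b ∖ v) ⊆ (P ∖ v ∖ a ∖ b)
∖-rotate⁻ _ (((p , a) , b) , v) = ((p , v) , a) , b

Match-∖ : P a → P b → a ≢ b → v ≢ a → v ≢ b → Match (P ∖ a ∖ b ∖ v) σ →
  Match (P ∖ v) ((a , b) ∷ σ)
Match-∖ p q n va vb m = (p , ≢-sym va) , (q , ≢-sym vb) , n , Match-mono ∖-rotate⁻ m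

Match-∖∖ : P a → P b → a ≢ b → v ≢ a → v ≢ b → w ≢ a → w ≢ b →
  Match (P ∖ a ∖ b ∖ v ∖ w) σ → Match (P ∖ v ∖ w) ((a , b) ∷ σ)
Match-∖∖ p q n va vb wa wb m = Match-∖ (p , ≢-sym va) (q , ≢-sym vb) n wa wb
  (Match-mono (∖-mono ∖-rotate⁻) m)

Match-head : P a → P b → a ≢ b → Match (P ∖ a ∖ b) σ → Match P ((a , b) ∷ σ)
Match-head p q n m = p , q , n , m

ext-avoid : ∀ v f g σ → Match (P ∖ v) σ → ext v f g σ ≡ f σ
ext-avoid v f g [] m = refl
ext-avoid v f g ((a , b) ∷ σ) ((p , a≢v) , (q , b≢v) , n , m) =
  trans (ext-miss v f g a b σ (≢-sym a≢v) (≢-sym b≢v))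
    (ext-avoid v _ _ σ (Match-mono ∖-rotate m))

-- The factor covers both uses in `Alt-ext`: `𝟐` for exchanging two edges that miss `v`, `𝟏` for
-- flipping such an edge.
ext-scale : ∀ s v {f f' g g'} σ →
  (∀ τ → Match (P ∖ v) τ → f τ ≡ s ⊗ f' τ) →
  (∀ w τ → P w → v ≢ w → Match (P ∖ v ∖ w) τ → g w τ ≡ s ⊗ g' w τ) →
  Match P σ → ext v f g σ ≡ s ⊗ ext v f' g' σ
ext-scale s v [] hf hg m = hf [] tt
ext-scale {P = P} s v {f} {f'} {g} {g'} ((a , b) ∷ σ) hf hg (p , q , n , m) with meets v a b n
... | hit v≢b = trans (ext-hit v f g b σ)
      (trans (hg b σ q v≢b m) (cong (s ⊗_) (sym (ext-hit v f' g' b σ))))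
... | hit′ v≢a = trans (ext-hit′ v f g a σ v≢a)
      (trans (hg a σ p v≢a (Match-mono (λ { _ ((r , x) , y) → (r , y) , x }) m))
        (cong (s ⊗_) (sym (ext-hit′ v f' g' a σ v≢a))))
... | miss v≢a v≢b = trans (ext-miss v f g a b σ v≢a v≢b)
      (trans (ext-scale s v σ (λ τ mτ → hf _ (Match-∖ p q n v≢a v≢b mτ))
          (λ { w τ ((pw , w≢a) , w≢b) v≢w mτ → trans (cong ⊖_ (hg w _ pw v≢w
            (Match-∖∖ p q n v≢a v≢b w≢a w≢b mτ)))
            (sym (⊗-⊖ s _)) }) m)
        (cong (s ⊗_) (sym (ext-miss v f' g' a b σ v≢a v≢b))))

-- Two disjoint edges cannot both meet `v`. If one does, the sign that `ext` puts on `g` when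
-- passing the other edge is the sign of the exchange; if neither does, the exchange takes place
-- inside `f` and `g`.
Alt-ext : ∀ {v} f g → Alt (P ∖ v) f → (∀ w → P w → v ≢ w → Alt (P ∖ v ∖ w) (g w)) →
  Alt P (ext v f g)
Alt-ext {v = v} f g A B {σ = (a , b) ∷ (c , d) ∷ σ} swap
  m@(p , q , n , ((p' , c≢a) , c≢b) , ((q' , d≢a) , d≢b) , n' , m')
  with meets v a b n | meets v c d n'
... | hit _     | hit _      = contradiction refl c≢a
... | hit _     | hit′ _     = contradiction refl d≢a
... | hit′ _    | hit _      = contradiction refl c≢b
... | hit′ _    | hit′ _     = contradiction refl d≢b
... | hit _     | miss vc vd = begin
  ext v f g ((v , b) ∷ (c , d) ∷ σ)  ≡⟨ ext-hit v f g b _ ⟩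
  g b ((c , d) ∷ σ)                  ≡⟨ ⊖-involutive _ ⟨
  ⊖ ⊖ g b ((c , d) ∷ σ)              ≡⟨ cong ⊖_ (ext-hit v _ _ b σ) ⟨
  ⊖ ext v _ _ ((v , b) ∷ σ)          ≡⟨ cong ⊖_ (ext-miss v f g c d _ vc vd) ⟨
  ⊖ ext v f g ((c , d) ∷ (v , b) ∷ σ) ∎
  where open ≡-Reasoning
... | hit′ v≢a  | miss vc vd = begin
  ext v f g ((a , v) ∷ (c , d) ∷ σ)  ≡⟨ ext-hit′ v f g a _ v≢a ⟩
  g a ((c , d) ∷ σ)                  ≡⟨ ⊖-involutive _ ⟨
  ⊖ ⊖ g a ((c , d) ∷ σ)              ≡⟨ cong ⊖_ (ext-hit′ v _ _ a σ v≢a) ⟨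
  ⊖ ext v _ _ ((a , v) ∷ σ)          ≡⟨ cong ⊖_ (ext-miss v f g c d _ vc vd) ⟨
  ⊖ ext v f g ((c , d) ∷ (a , v) ∷ σ) ∎
  where open ≡-Reasoning
... | miss va vb | hit _     = begin
  ext v f g ((a , b) ∷ (v , d) ∷ σ)  ≡⟨ ext-miss v f g a b _ va vb ⟩
  ext v _ _ ((v , d) ∷ σ)            ≡⟨ ext-hit v _ _ d σ ⟩
  ⊖ g d ((a , b) ∷ σ)                ≡⟨ cong ⊖_ (ext-hit v f g d _) ⟨
  ⊖ ext v f g ((v , d) ∷ (a , b) ∷ σ) ∎
  where open ≡-Reasoning
... | miss va vb | hit′ v≢c  = begin
  ext v f g ((a , b) ∷ (c , v) ∷ σ)  ≡⟨ ext-miss v f g a b _ va vb ⟩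
  ext v _ _ ((c , v) ∷ σ)            ≡⟨ ext-hit′ v _ _ c σ v≢c ⟩
  ⊖ g c ((a , b) ∷ σ)                ≡⟨ cong ⊖_ (ext-hit′ v f g c _ v≢c) ⟨
  ⊖ ext v f g ((c , v) ∷ (a , b) ∷ σ) ∎
  where open ≡-Reasoning
... | miss va vb | miss vc vd = begin
  ext v f g ((a , b) ∷ (c , d) ∷ σ)  ≡⟨ ext-miss v f g a b _ va vb ⟩
  ext v _ _ ((c , d) ∷ σ)            ≡⟨ ext-miss v _ _ c d σ vc vd ⟩
  ext v _ _ σ                        ≡⟨ ext-scale 𝟐 v σ
    (λ τ mτ → A swap (Match-∖ p q n va vb
      (Match-∖ ((p' , c≢a) , c≢b) ((q' , d≢a) , d≢b) n' vc vd mτ)))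
    (λ { w τ ((((pw , wa) , wb) , wc) , wd) v≢w mτ → cong (λ t → ⊖ ⊖ t) (B w pw v≢w swap
      (Match-∖∖ p q n va vb wa wb (Match-∖∖ ((p' , c≢a) , c≢b) ((q' , d≢a) , d≢b) n' vc vd wc wd
        mτ))) }) m' ⟩
  ⊖ ext v _ _ σ                      ≡⟨ cong ⊖_ (ext-miss v _ _ a b σ va vb) ⟨
  ⊖ ext v _ _ ((a , b) ∷ σ)          ≡⟨ cong ⊖_ (ext-miss v f g c d _ vc vd) ⟨
  ⊖ ext v f g ((c , d) ∷ (a , b) ∷ σ) ∎
  where open ≡-Reasoning
Alt-ext {v = v} f g A B {σ = (a , b) ∷ σ} flip (p , q , n , m) with meets v a b n
... | hit v≢b     = trans (ext-hit v f g b σ) (sym (ext-hit′ v f g b σ v≢b))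
... | hit′ v≢a    = trans (ext-hit′ v f g a σ v≢a) (sym (ext-hit v f g a σ))
... | miss va vb = trans (ext-miss v f g a b σ va vb)
      (trans (ext-scale 𝟏 v σ (λ τ mτ → A flip (Match-∖ p q n va vb mτ))
        (λ { w τ ((pw , wa) , wb) v≢w mτ →
             cong ⊖_ (B w pw v≢w flip (Match-∖∖ p q n va vb wa wb mτ)) }) m)
        (sym (ext-miss v f g b a σ vb va)))
Alt-ext {v = v} f g A B {s} {σ = (a , b) ∷ σ} {_ ∷ τ} (cons st) (p , q , n , m) with meets v a b n
... | hit v≢b     = trans (ext-hit v f g b σ)
      (trans (B b q v≢b st m) (cong (s ⊗_) (sym (ext-hit v f g b τ))))
... | hit′ v≢a    = trans (ext-hit′ v f g a σ v≢a)
      (trans (B a p v≢a st (Match-mono (λ { _ ((r , x) , y) → (r , y) , x }) m))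
        (cong (s ⊗_) (sym (ext-hit′ v f g a τ v≢a))))
... | miss va vb = trans (ext-miss v f g a b σ va vb)
      (trans (Alt-ext _ _ (λ st' mτ → A (cons st') (Match-∖ p q n va vb mτ))
        (λ { w ((pw , wa) , wb) v≢w {s'} st' mτ → trans
             (cong ⊖_ (B w pw v≢w (cons st') (Match-∖∖ p q n va vb wa wb mτ))) (sym (⊗-⊖ s' _)) })
        st m)
        (cong (s ⊗_) (sym (ext-miss v f g a b τ va vb))))

-- Alternating cochains are compared by moving the edge at v, if there is one, to the front.
split : ∀ v σ → Alt P f → Alt P h → Match P σ →
  (∀ τ → Match (P ∖ v) τ → length τ ≡ length σ → f τ ≡ h τ) →
  (∀ w τ → Match P ((v , w) ∷ τ) → suc (length τ) ≡ length σ →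
    f ((v , w) ∷ τ) ≡ h ((v , w) ∷ τ)) → f σ ≡ h σ
split v [] A B m H₀ H₁ = H₀ [] tt refl
split v ((a , b) ∷ σ) A B m@(p , q , n , m') H₀ H₁ with meets v a b n
... | hit _      = H₁ b σ m refl
... | hit′ _     = trans (A flip m) (trans (H₁ a σ (Match-flip m) refl) (sym (B flip m)))
... | miss va vb = split v σ (Alt-ι p q n A) (Alt-ι p q n B) m'
      (λ τ mτ l → H₀ _ (Match-∖ p q n va vb mτ) (cong suc l))
      (λ w τ mτ l → let mτ' = Match-head p q n mτ in
        trans (A swap mτ') (trans (cong ⊖_ (H₁ w _ (Match-swap mτ') (cong suc l)))
          (sym (B swap mτ'))))

-- h is a primitive of f in the degree in which c further edges make up k of them.
Primitive : (ℕ → Set) → ℕ → ℕ → Cochain → Cochain → Set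
Primitive P c k h f = Alt P h × (∀ σ → Match P σ → c + length σ ≡ k → f σ ≡ δ h σ)

Cocycle : (ℕ → Set) → ℕ → Cochain → Set
Cocycle P k f = ∀ σ → Match P σ → length σ ≡ suc k → δ f σ ≡ 𝟎

primitive-cong : (∀ σ → Match P σ → c + length σ ≡ k → f σ ≡ f' σ) →
  Primitive P c k h f' → Primitive P c k h f
primitive-cong eq (A , pr) = A , λ σ m l → trans (eq σ m l) (pr σ m l)

primitive-mono : P ⊆ Q → Primitive Q c k h f → Primitive P c k h f
primitive-mono i (A , pr) = Alt-mono i A , λ σ m → pr σ (Match-mono i m)

-- At `(v , w) ∷ τ` the equation `f = δ (ext v h g)` reads `δ (g w) τ = h τ ⊝ f ((v , w) ∷ τ)`. So
-- each link poses the same problem with one more edge split off, whence `suc c`. Repeated use turns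
-- a primitive given by nested `ext` into one check per pattern of edges at the chosen vertices.
primitive-ext : P v → Alt P f → Primitive (P ∖ v) c k h f →
  (∀ w → P w → v ≢ w → Alt (P ∖ v ∖ w) (λ τ → h τ ⊝ f ((v , w) ∷ τ)) →
    Primitive (P ∖ v ∖ w) (suc c) k (g w) (λ τ → h τ ⊝ f ((v , w) ∷ τ))) →
  Primitive P c k (ext v h g) f
primitive-ext {P = P} {v} {f} {c} {k} {h} {g} pv A (H , pr) br = Alt-ext h g H G ,
  λ σ m l → split v σ A (Alt-δ (Alt-ext h g H G)) m
    (λ τ mτ lτ → trans (pr τ mτ (trans (cong (c +_) lτ) l))
      (sym (δ-cong τ (λ ρ mρ _ → ext-avoid v h g ρ mρ) mτ)))
    (λ { w τ mτ@(_ , q , n , m') lτ → trans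
      (lemma _ _ _ (proj₂ (br w q n (A' w q n)) τ m'
        (trans (sym (ℕₚ.+-suc c (length τ))) (trans (cong (c +_) lτ) l))))
      (sym (cong₂ _⊝_ (ext-avoid v h g τ (Match-mono (λ _ → proj₁) m'))
                      (δ-cong τ (λ ρ _ _ → ext-hit v h g w ρ) m'))) })
  where
  A' : ∀ w → P w → v ≢ w → Alt (P ∖ v ∖ w) (λ τ → h τ ⊝ f ((v , w) ∷ τ))
  A' w pw n = Alt-⊕ (Alt-mono (λ _ → proj₁) H) (Alt-⊖ (Alt-ι pv pw n A))
  G : ∀ w → P w → v ≢ w → Alt (P ∖ v ∖ w) (g w)
  G w pw n = proj₁ (br w pw n (A' w pw n))
  lemma : ∀ x y z → x ⊝ y ≡ z → y ≡ x ⊝ z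
  lemma x y _ refl = by₂ {λ x y → y} {λ x y → x ⊝ (x ⊝ y)} tt x y

-- Connectivity

Distinct : (ℕ → Set) → List ℕ → Set
Distinct P []      = ⊤
Distinct P (x ∷ L) = P x × Distinct (P ∖ x) L

Distinct-mono : ∀ L → P ⊆ Q → Distinct P L → Distinct Q L
Distinct-mono []      i d       = tt
Distinct-mono (x ∷ L) i (p , d) = i x p , Distinct-mono L (∖-mono i) d

remove : ℕ → List ℕ → List ℕ
remove w [] = []
remove w (x ∷ L) with w ℕ.≟ x
... | yes _ = L
... | no _  = x ∷ remove w L

remove-Distinct : ∀ w L → Distinct P L → Distinct (P ∖ w) (remove w L)
remove-Distinct w []      d       = tt
remove-Distinct w (x ∷ L) (p , d) with w ℕ.≟ x
... | yes refl = d
... | no w≢x   = (p , ≢-sym w≢x) ,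
      Distinct-mono (remove w L) (λ { _ ((r , a) , b) → (r , b) , a }) (remove-Distinct w L d)

remove-length : ∀ w L → length L ≤ suc (length (remove w L))
remove-length w []      = z≤n
remove-length w (x ∷ L) with w ℕ.≟ x
... | yes _ = ℕₚ.≤-refl
... | no _  = s≤s (remove-length w L)

-- A primitive of the restriction to the faces avoiding v extends to a primitive, since what
-- is missing on the faces through (v , w) is a cocycle of lower degree.
mutual
  prim : ℕ → List ℕ → Cochain → Cochain
  prim (suc k) (v ∷ u ∷ L) f = elim v k (u ∷ L) (elim u k L (ι (v , u) f) f) f
  prim _       _           f = 𝟘

  elim : ℕ → ℕ → List ℕ → Cochain → Cochain → Cochain
  elim v k L h f = ext v h (λ w → prim k (remove w L) (λ τ → h τ ⊝ f ((v , w) ∷ τ)))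

-- Expanding `δ f` at the edge shows that a cocycle is, away from `a` and `b`, the coboundary of its
-- own link. These links are the primitives from which `prim` starts and which recur in the tower.
cocycle-link : ∀ f → P a → P b → a ≢ b → Cocycle P k f →
  ∀ σ → Match (P ∖ a ∖ b) σ → length σ ≡ k → f σ ≡ δ (ι (a , b) f) σ
cocycle-link {a = a} {b} f pa pb n Z σ m l =
  lemma (f σ) (δ (ι (a , b) f) σ) (Z _ (Match-head pa pb n m) (cong suc l))
  where
  lemma : ∀ x y → x ⊝ y ≡ 𝟎 → x ≡ y
  lemma 𝟎 𝟎 _ = refl
  lemma 𝟏 𝟏 _ = refl
  lemma 𝟐 𝟐 _ = refl

δ-⊝ : ∀ f g σ → δ (λ τ → f τ ⊝ g τ) σ ≡ δ f σ ⊝ δ g σ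
δ-⊝ f g σ = trans (δ-⊕ f (𝟐 · g) σ) (cong (δ f σ ⊕_) (δ-· 𝟐 g σ))

⊝-self : ∀ x → x ⊝ x ≡ 𝟎
⊝-self = by₁ tt

-- The matching complex on at least 3k + 2 vertices has no cohomology in the degree of faces with k edges.
mutual
  prim-primitive : ∀ k L f → Distinct P L → 2 + 3 * k ≤ length L → Alt P f → Cocycle P k f →
    Primitive P 0 k (prim k L f) f
  prim-primitive zero    (_ ∷ []) f d (s≤s ())
  prim-primitive (suc k) (_ ∷ []) f d (s≤s ())
  prim-primitive zero (v ∷ u ∷ L) f (pv , (pu , u≢v) , _) l A Z = Alt-𝟘 , λ { [] m eq →
    trans (lemma (f [])) (Z ((v , u) ∷ []) (pv , pu , ≢-sym u≢v , tt) refl) }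
    where
    lemma : ∀ x → x ≡ x ⊝ 𝟎
    lemma = by₁ tt
  prim-primitive (suc k) (v ∷ u ∷ L) f d@(pv , (pu , u≢v) , dL) l A Z =
    elim-primitive v k (u ∷ L) _ f d (ℕₚ.≤-trans (ℕₚ.n≤1+n _) (s≤s l')) A Z
      (elim-primitive u k L _ f ((pu , u≢v) , dL) l' (Alt-mono (λ _ → proj₁) A)
        (λ σ m → Z σ (Match-mono (λ _ → proj₁) m))
        (Alt-ι pv pu (≢-sym u≢v) A , cocycle-link f pv pu (≢-sym u≢v) Z))
    where
    l' : 3 * suc k ≤ length L
    l' = ℕₚ.≤-pred (ℕₚ.≤-pred l)

  elim-primitive : ∀ v k L h f → Distinct P (v ∷ L) → 3 * suc k ≤ length L →
    Alt P f → Cocycle P (suc k) f → Primitive (P ∖ v) 0 (suc k) h f →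
    Primitive P 0 (suc k) (elim v k L h f) f
  elim-primitive v k L h f d@(pv , dL) l A Z Pr = primitive-ext pv A Pr λ w pw v≢w A' →
    -- At least `3 (suc k) - 1 = 3k + 2` vertices remain, the bound one degree lower. The
    -- coboundaries of `h` and of the link of `f` both equal `f`, so their difference is a cocycle.
    let pr = prim-primitive k (remove w L) _ (remove-Distinct w L dL)
          (ℕₚ.≤-pred (ℕₚ.≤-trans (subst (_≤ length L) (ℕₚ.*-suc 3 k) l) (remove-length w L)))
          A' (λ τ mτ lτ → trans (δ-⊝ h (ι (v , w) f) τ)
            (trans (cong₂ _⊝_ (sym (proj₂ Pr τ (Match-mono (λ _ → proj₁) mτ) lτ))
                     (sym (cocycle-link f pv pw v≢w Z τ mτ lτ)))
              (⊝-self (f τ))))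
    in proj₁ pr , λ τ mτ lτ → proj₂ pr τ mτ (ℕₚ.suc-injective lτ)

-- A nontrivial cocycle

pick : ℕ → ℕ → Cochain → Cochain → Cochain
pick w b f h with w ℕ.≟ b
... | yes _ = f
... | no _  = h

pick-≡ : ∀ b f h → pick b b f h ≡ f
pick-≡ b f h with b ℕ.≟ b
... | yes _ = refl
... | no ¬p = contradiction refl ¬p

pick-≢ : ∀ w b f h → w ≢ b → pick w b f h ≡ h
pick-≢ w b f h w≢b with w ℕ.≟ b
... | yes p = contradiction p w≢b
... | no _  = refl

Alt-pick : ∀ w b → (w ≡ b → Alt P f) → (w ≢ b → Alt P h) → Alt P (pick w b f h)
Alt-pick w b F H with w ℕ.≟ b
... | yes p = F p
... | no ¬p = H ¬p

primitive-pick : ∀ w b → (w ≡ b → Primitive P c k f h') → (w ≢ b → Primitive P c k h h') →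
  Primitive P c k (pick w b f h) h'
primitive-pick w b F H with w ℕ.≟ b
... | yes p = F p
... | no ¬p = H ¬p

ext-𝟘 : ∀ v {f g} → (∀ τ → f τ ≡ 𝟎) → (∀ w τ → g w τ ≡ 𝟎) → ∀ σ → ext v f g σ ≡ 𝟎
ext-𝟘 v hf hg [] = hf []
ext-𝟘 v hf hg ((a , b) ∷ σ) with v ℕ.≟ a | v ℕ.≟ b
... | yes _ | _     = hg b σ
... | no _  | yes _ = hg a σ
... | no _  | no _  = ext-𝟘 v (λ τ → hf _) (λ w τ → cong ⊖_ (hg w _)) σ

primitive-𝟘 : (∀ σ → Match P σ → c + length σ ≡ k → f σ ≡ 𝟎) → Primitive P c k 𝟘 f
primitive-𝟘 z = Alt-𝟘 , λ σ m l → trans (z σ m l) (sym (δ-𝟘 σ))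

primitive-· : ∀ s → Primitive P c k h f → Primitive P c k (s · h) (s · f)
primitive-· {h = h} s (A , pr) = Alt-· s A ,
  λ σ m l → trans (cong (s ⊗_) (pr σ m l)) (sym (δ-· s h σ))

-- Φ is the part of the cocycle φ⁺ below that lives on the faces avoiding b₀.
module Two (b₁ b₂ : ℕ) (b₁≢b₂ : b₁ ≢ b₂) where

  Φ : Cochain → Cochain
  Φ f = ext b₁ (ext b₂ 𝟘 (λ _ → 𝟐 · f))
               (λ w → pick w b₂ 𝟘 (ext b₂ f (λ u → 𝟐 · ι (w , u) f)))

  Φ-𝟘 : ∀ σ → Φ 𝟘 σ ≡ 𝟎
  Φ-𝟘 = ext-𝟘 b₁ (ext-𝟘 b₂ (λ _ → refl) (λ _ _ → refl)) zero'
    where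
    zero' : ∀ w τ → pick w b₂ 𝟘 (ext b₂ 𝟘 (λ u → 𝟐 · ι (w , u) 𝟘)) τ ≡ 𝟎
    zero' w τ with w ℕ.≟ b₂
    ... | yes _ = refl
    ... | no _  = ext-𝟘 b₂ (λ _ → refl) (λ _ _ → refl) τ

  Φ-∅ : ∀ f σ → Match (P ∖ b₁ ∖ b₂) σ → Φ f σ ≡ 𝟎
  Φ-∅ f σ m = trans (ext-avoid b₁ _ _ σ (Match-mono (λ _ → proj₁) m)) (ext-avoid b₂ _ _ σ m)

  Φ-₂ : ∀ f w σ → Match (P ∖ b₁) ((b₂ , w) ∷ σ) → Φ f ((b₂ , w) ∷ σ) ≡ 𝟐 ⊗ f σ
  Φ-₂ f w σ m = trans (ext-avoid b₁ _ _ _ m) (ext-hit b₂ _ _ w σ)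

  Φ-₁₂ : ∀ f σ → Φ f ((b₁ , b₂) ∷ σ) ≡ 𝟎
  Φ-₁₂ f σ = trans (ext-hit b₁ _ _ b₂ σ) (cong-app (pick-≡ b₂ _ _) σ)

  Φ-₁ : ∀ f w σ → w ≢ b₂ → Match (P ∖ b₂) σ → Φ f ((b₁ , w) ∷ σ) ≡ f σ
  Φ-₁ f w σ n m = trans (ext-hit b₁ _ _ w σ)
    (trans (cong-app (pick-≢ w b₂ _ _ n) σ) (ext-avoid b₂ _ _ σ m))

  Φ-₁₁ : ∀ f w u σ → w ≢ b₂ → Φ f ((b₁ , w) ∷ (b₂ , u) ∷ σ) ≡ 𝟐 ⊗ f ((w , u) ∷ σ)
  Φ-₁₁ f w u σ n = trans (ext-hit b₁ _ _ w _)
    (trans (cong-app (pick-≢ w b₂ _ _ n) _) (ext-hit b₂ _ _ u σ))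

  module _ {P R : ℕ → Set} (p₁ : P b₁) (p₂ : P b₂) (P⊆R : (P ∖ b₁ ∖ b₂) ⊆ R) where

    Alt-Φ : Alt R f → Alt P (Φ f)
    Alt-Φ A = Alt-ext _ _
      (Alt-ext _ _ Alt-𝟘 (λ w p n → Alt-· 𝟐 (Alt-mono (λ _ → P⊆R _ ∘ proj₁) A)))
      (λ w p n → Alt-pick w b₂ (λ _ → Alt-𝟘) (λ w≢b₂ → Alt-ext _ _
        (Alt-mono (λ { _ (((p , a) , b) , c) → P⊆R _ ((p , a) , c) }) A)
        (λ { u ((pu , u≢b₁) , u≢w) n' → Alt-· 𝟐 (Alt-mono
          (λ { _ ((((p , a) , b) , c) , d) → (P⊆R _ ((p , a) , c) , b) , d })
          (Alt-ι (P⊆R _ ((p , ≢-sym n) , w≢b₂)) (P⊆R _ ((pu , u≢b₁) , ≢-sym n'))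
            (≢-sym u≢w) A)) })))

    -- `Φ` adds one edge and accordingly anticommutes with `δ`. With `h = 𝟘` this makes `Φ φ` a
    -- cocycle; with `h = t x y z φ` it lifts `η` to the next level of the tower.
    Φ-primitive : Alt R h → Primitive R (suc c) k f h → Primitive P c k (Φ f) (λ σ → ⊖ Φ h σ)
    Φ-primitive {h} {c} {k} {f} A Pr = primitive-ext p₁ AΦ
      (primitive-ext (p₂ , ≢-sym b₁≢b₂) (Alt-mono (λ _ → proj₁) AΦ)
        (primitive-𝟘 λ σ m _ → cong ⊖_ (Φ-∅ h σ m))
        λ w pw n A' → primitive-cong
          (λ σ m _ → trans (⊖-involutive (Φ h ((b₂ , w) ∷ σ))) (Φ-₂ h w σ ((p₂ , ≢-sym b₁≢b₂) , pw ,
            n , m)))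
          (primitive-· 𝟐 (primitive-mono (λ _ → P⊆R _ ∘ proj₁) Pr)))
      λ w pw n A' → primitive-pick w b₂
        (λ { refl → primitive-𝟘 λ σ m _ → cong₂ _⊝_
          (ext-avoid b₂ _ _ σ m)
          (cong ⊖_ (Φ-₁₂ h σ)) })
        λ w≢b₂ → primitive-ext ((p₂ , ≢-sym b₁≢b₂) , ≢-sym w≢b₂) A'
          (primitive-cong (λ σ m _ → cong₂ _⊝_ (ext-avoid b₂ _ _ σ m) (cong ⊖_ (Φ-₁ h w σ w≢b₂ m)))
            (primitive-cong (λ σ _ _ → ⊖-involutive (h σ))
              (primitive-mono (λ { _ (((p , a) , b) , c) → P⊆R _ ((p , a) , c) }) Pr)))
          λ { u ((pu , u≢b₁) , u≢w) n' A'' →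
            let rw = P⊆R _ ((pw , ≢-sym n) , w≢b₂) ; ru = P⊆R _ ((pu , u≢b₁) , ≢-sym n') in
            Alt-· 𝟐 (Alt-mono (λ { _ ((((p , a) , b) , c) , d) → (P⊆R _ ((p , a) , c) , b) , d })
              (Alt-ι rw ru (≢-sym u≢w) (proj₁ Pr))) ,
            λ σ m l → begin
              f σ ⊝ (ext b₂ 𝟘 _ ((b₂ , u) ∷ σ) ⊝ ⊖ Φ h ((b₁ , w) ∷ (b₂ , u) ∷ σ))
                ≡⟨ cong₂ (λ x y → f σ ⊝ (x ⊝ ⊖ y)) (ext-hit b₂ _ _ u σ) (Φ-₁₁ h w u σ w≢b₂) ⟩
              f σ ⊝ (𝟐 ⊗ f σ ⊝ ⊖ (𝟐 ⊗ h ((w , u) ∷ σ)))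
                ≡⟨ cong (λ x → f σ ⊝ (𝟐 ⊗ f σ ⊝ ⊖ (𝟐 ⊗ x))) (proj₂ Pr ((w , u) ∷ σ)
                     (Match-head rw ru (≢-sym u≢w) (Match-mono
                       (λ { _ ((((p , a) , b) , c) , d) → (P⊆R _ ((p , a) , c) , b) , d }) m))
                     (trans (cong suc (ℕₚ.+-suc c (length σ))) l)) ⟩
              f σ ⊝ (𝟐 ⊗ f σ ⊝ ⊖ (𝟐 ⊗ (f σ ⊝ δ (ι (w , u) f) σ)))
                ≡⟨ lemma (f σ) (δ (ι (w , u) f) σ) ⟩
              𝟐 ⊗ δ (ι (w , u) f) σ
                ≡⟨ δ-· 𝟐 (ι (w , u) f) σ ⟨
              δ (𝟐 · ι (w , u) f) σ ∎ }
      where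
      open ≡-Reasoning
      AΦ = Alt-⊖ (Alt-Φ A)
      -- As `𝟐 = -1`, the left side is `3x - y`: the two omitted edges and the contracted path
      -- contribute one `x` each, and the three cancel.
      lemma : ∀ x y → x ⊝ (𝟐 ⊗ x ⊝ ⊖ (𝟐 ⊗ (x ⊝ y))) ≡ 𝟐 ⊗ y
      lemma = by₂ tt

t : ℕ → ℕ → ℕ → Cochain → Cochain
t x y z f σ = f ((x , y) ∷ σ) ⊕ f ((y , z) ∷ σ) ⊕ f ((z , x) ∷ σ)

-- Written recursively so that `S (suc K)` unfolds to `S K` with the three vertices `top K`,
-- `1 + top K` and `2 + top K` added.
top : ℕ → ℕ
top zero    = 1
top (suc K) = 3 + top K

S : ℕ → ℕ → Set
S K x = x < top K

Match-t : P x → P y → P z → x ≢ y → y ≢ z → z ≢ x → Match (P ∖ x ∖ y ∖ z) σ →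
  Match P ((x , y) ∷ σ) × Match P ((y , z) ∷ σ) × Match P ((z , x) ∷ σ)
Match-t px py pz xy yz zx m =
  Match-head px py xy (Match-mono (λ _ → proj₁) m) ,
  Match-head py pz yz (Match-mono (λ { _ (((p , a) , b) , c) → (p , b) , c }) m) ,
  Match-head pz px zx (Match-mono (λ { _ (((p , a) , b) , c) → (p , c) , a }) m)

Alt-t : P x → P y → P z → x ≢ y → y ≢ z → z ≢ x → Alt P f → Alt (P ∖ x ∖ y ∖ z) (t x y z f)
Alt-t px py pz xy yz zx A = Alt-⊕ (Alt-⊕
  (Alt-mono (λ _ → proj₁) (Alt-ι px py xy A))
  (Alt-mono (λ { _ (((p , a) , b) , c) → (p , b) , c }) (Alt-ι py pz yz A)))
  (Alt-mono (λ { _ (((p , a) , b) , c) → (p , c) , a }) (Alt-ι pz px zx A))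

-- By `cocycle-link`, the links of `f` at the three edges all have coboundary `f`, and three times
-- `f σ` is zero.
cocycle-t : P x → P y → P z → x ≢ y → y ≢ z → z ≢ x → Cocycle P (suc k) f →
  Cocycle (P ∖ x ∖ y ∖ z) k (t x y z f)
cocycle-t {f = f} px py pz xy yz zx Z σ m l =
  trans (δ-⊕ _ _ σ) (trans (cong₂ _⊕_ (trans (δ-⊕ _ _ σ) (cong₂ _⊕_
  (sym (cocycle-link f px py xy Z σ (Match-mono (λ _ → proj₁) m) l))
  (sym (cocycle-link f py pz yz Z σ (Match-mono (λ { _ (((p , a) , b) , c) → (p , b) , c }) m) l))))
  (sym (cocycle-link f pz px zx Z σ (Match-mono (λ { _ (((p , a) , b) , c) → (p , c) , a }) m) l)))
  (by₁ {λ x → x ⊕ x ⊕ x} {λ _ → 𝟎} tt (f σ)))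

-- `prim-primitive` asks for `3K + 2` vertices. One fewer suffices once the faces avoiding `v` are
-- settled: for `K ≥ 1` the links at `v` still have `3 (K - 1) + 2` vertices, enough for extending
-- the primitive over `v`.
drop-vertex : ∀ K {L} → Distinct P (v ∷ L) → 3 * K ≤ length L → Alt P f → Cocycle P K f →
  Primitive (P ∖ v) 1 (suc K) h f → Σ Cochain λ h' → Primitive P 1 (suc K) h' f
drop-vertex zero d l A Z (_ , pr) = 𝟘 , Alt-𝟘 , λ { [] _ _ → pr [] tt refl }
drop-vertex {v = v} (suc k) {L} d l A Z (H , pr) =
  let (H' , pr') = elim-primitive v k L _ _ d l A Z (H , λ σ m l → pr σ m (cong suc l)) in
  _ , H' , λ σ m l → pr' σ m (ℕₚ.suc-injective l)

downFrom-Distinct : ∀ n → Distinct (_< n) (downFrom n)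
downFrom-Distinct zero    = tt
downFrom-Distinct (suc n) = ℕₚ.n<1+n n , Distinct-mono _
  (λ x p → ℕₚ.m<n⇒m<1+n p , ℕₚ.<⇒≢ p) (downFrom-Distinct n)

top≡ : ∀ K → top K ≡ 1 + 3 * K
top≡ zero    = refl
top≡ (suc K) = trans (cong (3 +_) (top≡ K)) (cong suc (sym (ℕₚ.*-suc 3 K)))

-- The cocycle φ lives on faces with K edges and 3K + 1 vertices, which is just outside the range where
-- primitives exist; η says that its product with the cycle xy + yz + zx mod 3 is nevertheless exact.
record Tower (K : ℕ) : Set where
  field
    φ     : Cochain
    φ-alt : Alt (S K) φ
    φ-coc : Cocycle (S K) K φ
    η     : ℕ → ℕ → ℕ → Cochain
    η-pr  : ∀ {x y z} → S K x → S K y → S K z → x ≢ y → y ≢ z → z ≢ x →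
      Primitive (S K ∖ x ∖ y ∖ z) 1 K (η x y z) (t x y z φ)

module Block {K : ℕ} (T : Tower K) where
  open Tower T

  b₀ b₁ b₂ : ℕ
  b₀ = top K
  b₁ = 1 + top K
  b₂ = 2 + top K

  b₀≢b₁ : b₀ ≢ b₁
  b₀≢b₁ = ℕₚ.<⇒≢ (ℕₚ.n<1+n _)
  b₁≢b₂ : b₁ ≢ b₂
  b₁≢b₂ = ℕₚ.<⇒≢ (ℕₚ.n<1+n _)
  b₀≢b₂ : b₀ ≢ b₂
  b₀≢b₂ = ℕₚ.<⇒≢ (ℕₚ.m<n⇒m<1+n (ℕₚ.n<1+n _))

  open Two b₁ b₂ b₁≢b₂

  S⁺ : ℕ → Set
  S⁺ = S (suc K)

  S⁺b₀ : S⁺ b₀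
  S⁺b₀ = ℕₚ.m<n⇒m<1+n (ℕₚ.m<n⇒m<1+n (ℕₚ.n<1+n _))
  S⁺b₁ : S⁺ b₁
  S⁺b₁ = ℕₚ.m<n⇒m<1+n (ℕₚ.n<1+n _)
  S⁺b₂ : S⁺ b₂
  S⁺b₂ = ℕₚ.n<1+n _

  S⊆S⁺ : S K ⊆ S⁺
  S⊆S⁺ x p = ℕₚ.m<n⇒m<1+n (ℕₚ.m<n⇒m<1+n (ℕₚ.m<n⇒m<1+n p))

  old : ∀ {x} → S⁺ x → x ≢ b₀ → x ≢ b₁ → x ≢ b₂ → S K x
  old p n₀ n₁ n₂ = ℕₚ.≤∧≢⇒< (ℕₚ.≤-pred (ℕₚ.≤∧≢⇒< (ℕₚ.≤-pred (ℕₚ.≤∧≢⇒< (ℕₚ.≤-pred p) n₂)) n₁)) n₀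

  -- The new vertices bᵢ carry the labels i ∈ 𝔽₃. A face meeting them in a single edge is sent to φ of the
  -- rest times the label of the vertex that is covered from outside or left uncovered; a path
  -- x – bᵢ, bⱼ – y is contracted to the edge xy with coefficient i - j. The three edges b₀w, b₁v, b₂u
  -- would contract to the cycle wv + vu + uw, which η corrects.
  φ⁺ : Cochain
  φ⁺ = ext b₀ (Φ φ) λ w →
    pick w b₁ (ext b₂ (𝟐 · φ) (λ _ → 𝟘)) (
    pick w b₂ (ext b₁ φ (λ _ → 𝟘))
      (ext b₁ (ext b₂ 𝟘 (λ u → ι (w , u) φ))
              (λ v → pick v b₂ 𝟘 (ext b₂ (𝟐 · ι (w , v) φ) (λ u → 𝟐 · η w v u)))))

  primitive-φ : ∀ {P} → P ⊆ S K → (∀ σ → c + length σ ≡ k → length σ ≡ suc K) → Primitive P c k φ 𝟘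
  primitive-φ i len = Alt-mono i φ-alt , λ σ m l → sym (φ-coc σ (Match-mono i m) (len σ l))

  -- The cocycle condition is phrased as `φ⁺` being a primitive of `𝟘`, so that `primitive-ext` can
  -- follow the nesting of `ext` in the definition. Each case comes down to `φ` being a cocycle, to
  -- `cocycle-link`, to a cancellation or, with all three new vertices joined to old ones, to the
  -- exactness provided by `η`.
  φ⁺-primitive : Primitive S⁺ 0 (2 + K) φ⁺ 𝟘
  φ⁺-primitive = primitive-ext S⁺b₀ Alt-𝟘
    (primitive-cong (λ σ _ _ → cong ⊖_ (sym (Φ-𝟘 σ)))
      (Φ-primitive {R = S K} (S⁺b₁ , ≢-sym b₀≢b₁) (S⁺b₂ , ≢-sym b₀≢b₂)
        (λ { x (((p , a) , b) , c) → old p a b c }) Alt-𝟘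
        (primitive-φ (λ _ p → p) λ _ → ℕₚ.suc-injective)))
    λ w pw b₀≢w A → primitive-pick w b₁
      (λ { refl → primitive-ext ((S⁺b₂ , ≢-sym b₀≢b₂) , ≢-sym b₁≢b₂) A
        (primitive-cong (λ σ m _ → cong (_⊕ 𝟎) (Φ-∅ φ σ m))
          (primitive-· 𝟐 (primitive-φ (λ { x (((p , a) , b) , c) → old p a b c }) λ _ →
            ℕₚ.suc-injective)))
        λ u (pu , u≢b₁) n A' → primitive-𝟘 λ σ m l →
          trans (cong (λ x → 𝟐 ⊗ φ σ ⊝ (x ⊝ 𝟎)) (Φ-₂ φ u σ ((S⁺b₂ , ≢-sym b₁≢b₂) ,
            (proj₁ pu , u≢b₁) , n ,
              Match-mono (λ { _ ((((p , _) , a) , b) , c) → ((p , a) , b) , c }) m)))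
            (by₁ {λ x → 𝟐 ⊗ x ⊝ (𝟐 ⊗ x ⊝ 𝟎)} {λ _ → 𝟎} tt (φ σ)) })
      λ w≢b₁ → primitive-pick w b₂
        (λ { refl → primitive-ext ((S⁺b₁ , ≢-sym b₀≢b₁) , b₁≢b₂) A
          (primitive-cong (λ σ m _ → cong (_⊕ 𝟎)
            (Φ-∅ φ σ (Match-mono (λ { _ ((p , a) , b) → (p , b) , a }) m)))
            (primitive-φ (λ { x (((p , a) , b) , c) → old p a c b }) λ _ → ℕₚ.suc-injective))
          λ u ((pu , u≢b₀) , u≢b₂) n A' → primitive-𝟘 λ σ m l →
            trans (cong (λ x → φ σ ⊝ (x ⊝ 𝟎)) (Φ-₁ φ u σ u≢b₂
              (Match-mono (λ { _ ((((p , _) , a) , b) , c) → p , a }) m)))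
            (by₁ {λ x → x ⊝ (x ⊝ 𝟎)} {λ _ → 𝟎} tt (φ σ)) })
        λ w≢b₂ → let Sw = old pw (≢-sym b₀≢w) w≢b₁ w≢b₂ in
          primitive-ext ((S⁺b₁ , ≢-sym b₀≢b₁) , ≢-sym w≢b₁) A
          (primitive-ext (((S⁺b₂ , ≢-sym b₀≢b₂) , ≢-sym w≢b₂) , ≢-sym b₁≢b₂) (Alt-mono (λ _ → proj₁)
            A)
            (primitive-𝟘 λ σ m _ → cong (_⊕ 𝟎) (Φ-∅ φ σ
              (Match-mono (λ { _ ((((p , _) , a) , b) , c) → (p , b) , c }) m)))
            λ u (((pu , u≢b₀) , u≢w) , u≢b₁) n A' →
              let Su = old pu u≢b₀ u≢b₁ (≢-sym n)
                  i = λ { x (((((p , a) , b) , c) , d) , e) → (old p a c d , b) , e } in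
              Alt-mono i (Alt-ι Sw Su (≢-sym u≢w) φ-alt) , λ σ m l →
              trans (cong (λ x → 𝟎 ⊝ (x ⊝ 𝟎)) (Φ-₂ φ u σ ((S⁺b₂ , ≢-sym b₁≢b₂) , (pu , u≢b₁) , n ,
                Match-mono (λ { _ (((((p , _) , _) , a) , b) , c) → ((p , a) , b) , c }) m)))
              (trans (by₁ {λ x → 𝟎 ⊝ (𝟐 ⊗ x ⊝ 𝟎)} {λ x → x} tt (φ σ))
                (cocycle-link φ Sw Su (≢-sym u≢w) φ-coc σ (Match-mono i m)
                  (ℕₚ.suc-injective (ℕₚ.suc-injective l)))))
          λ v ((pv , v≢b₀) , v≢w) n A' → primitive-pick v b₂
            (λ { refl → primitive-𝟘 λ σ m _ → cong₂ (λ x y → x ⊝ (y ⊝ 𝟎)) (ext-avoid b₂ _ _ σ m)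
              (Φ-₁₂ φ σ) })
            λ v≢b₂ → primitive-ext ((((S⁺b₂ , ≢-sym b₀≢b₂) , ≢-sym w≢b₂) , ≢-sym b₁≢b₂) ,
              ≢-sym v≢b₂) A'
              (let Sv = old pv v≢b₀ (≢-sym n) v≢b₂
                   i = λ { x (((((p , a) , b) , c) , d) , e) → (old p a c e , b) , d } in
               primitive-cong (λ σ m _ → trans (cong₂ (λ x y → x ⊝ (y ⊝ 𝟎)) (ext-avoid b₂ _ _ σ m)
                   (Φ-₁ φ v σ v≢b₂ (Match-mono (λ { _ (((((p , _) , _) , _) , _) , e) → p , e })
                     m)))
                   (by₁ {λ x → 𝟎 ⊝ (x ⊝ 𝟎)} {λ x → 𝟐 ⊗ x} tt (φ σ)))
               (primitive-· 𝟐 (Alt-mono i (Alt-ι Sw Sv (≢-sym v≢w) φ-alt) , λ σ m l →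
                 cocycle-link φ Sw Sv (≢-sym v≢w) φ-coc σ (Match-mono i m)
                   (ℕₚ.suc-injective (ℕₚ.suc-injective l)))))
              λ u ((((pu , u≢b₀) , u≢w) , u≢b₁) , u≢v) n' A'' →
                  let Sv = old pv v≢b₀ (≢-sym n) v≢b₂
                      Su = old pu u≢b₀ u≢b₁ (≢-sym n')
                      i = λ { x ((((((p , a) , b) , c) , d) , e) , f) → ((old p a c e , b) , d) ,
                        f }
                      pr = η-pr Sw Sv Su (≢-sym v≢w) (≢-sym u≢v) u≢w in
                  -- The three contracted paths add up to `𝟐 · t w v u φ`, which is what the
                  -- correction term `𝟐 · η w v u` is made for.
                  primitive-cong (λ σ m _ → trans
                    (cong₂ (λ x y → 𝟐 ⊗ φ ((w , v) ∷ σ) ⊝ (x ⊝ (y ⊝ 𝟎)))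
                      (trans (ext-hit b₂ _ _ u σ) (φ-alt flip (Match-head Sw Su (≢-sym u≢w)
                        (Match-mono (λ x p → proj₁ (proj₁ (i x p)) , proj₂ (i x p)) m))))
                      (Φ-₁₁ φ v u σ v≢b₂))
                    (by₃ {λ x y z → 𝟐 ⊗ x ⊝ (z ⊝ (𝟐 ⊗ y ⊝ 𝟎))} {λ x y z → 𝟐 ⊗ (x ⊕ y ⊕ z)} tt
                      (φ ((w , v) ∷ σ)) (φ ((v , u) ∷ σ)) (φ ((u , w) ∷ σ))))
                  (primitive-· 𝟐 (Alt-mono i (proj₁ pr) , λ σ m l →
                    proj₂ pr σ (Match-mono i m) (ℕₚ.suc-injective (ℕₚ.suc-injective l))))

  φ⁺-alt : Alt S⁺ φ⁺
  φ⁺-alt = proj₁ φ⁺-primitive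

  φ⁺-coc : Cocycle S⁺ (suc K) φ⁺
  φ⁺-coc σ m l = sym (proj₂ φ⁺-primitive σ m l)

  φ⁺-∅ : ∀ {P} → P ⊆ S K → ∀ σ → Match P σ → φ⁺ σ ≡ 𝟎
  φ⁺-∅ {P} i σ m = trans (ext-avoid {P = S⁺} b₀ _ _ σ (Match-mono (λ x p → S⊆S⁺ x (i x p) ,
    ℕₚ.<⇒≢ (i x p)) m))
    (Φ-∅ {P = S⁺} φ σ (Match-mono (λ x p → (S⊆S⁺ x (i x p) , ℕₚ.<⇒≢ (ℕₚ.m<n⇒m<1+n (i x p))) ,
      ℕₚ.<⇒≢ (ℕₚ.m<n⇒m<1+n (ℕₚ.m<n⇒m<1+n (i x p)))) m))

  β : 𝔽₃ → ℕ
  β 𝟎 = b₀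
  β 𝟏 = b₁
  β 𝟐 = b₂

  S⁺β : ∀ i → S⁺ (β i)
  S⁺β 𝟎 = S⁺b₀
  S⁺β 𝟏 = S⁺b₁
  S⁺β 𝟐 = S⁺b₂

  β-injective : ∀ i j → i ≢ j → β i ≢ β j
  β-injective 𝟎 𝟎 n = contradiction refl n
  β-injective 𝟎 𝟏 n = b₀≢b₁
  β-injective 𝟎 𝟐 n = b₀≢b₂
  β-injective 𝟏 𝟎 n = ≢-sym b₀≢b₁
  β-injective 𝟏 𝟏 n = contradiction refl n
  β-injective 𝟏 𝟐 n = b₁≢b₂
  β-injective 𝟐 𝟎 n = ≢-sym b₀≢b₂
  β-injective 𝟐 𝟏 n = ≢-sym b₁≢b₂
  β-injective 𝟐 𝟐 n = contradiction refl n

  S-≢β : ∀ {x} → S K x → ∀ i → x ≢ β i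
  S-≢β p 𝟎 = ℕₚ.<⇒≢ p
  S-≢β p 𝟏 = ℕₚ.<⇒≢ (ℕₚ.m<n⇒m<1+n p)
  S-≢β p 𝟐 = ℕₚ.<⇒≢ (ℕₚ.m<n⇒m<1+n (ℕₚ.m<n⇒m<1+n p))

  S-∖β : ∀ {P} i → P ⊆ S K → P ⊆ (S⁺ ∖ β i)
  S-∖β i s x p = S⊆S⁺ x (s x p) , S-≢β (s x p) i

  S-∖β∖β : ∀ {P} i j → P ⊆ S K → P ⊆ (S⁺ ∖ β i ∖ β j)
  S-∖β∖β i j s x p = S-∖β i s x p , S-≢β (s x p) j

  φ⁺-inner< : ∀ σ → Match (S K) σ →
    (φ⁺ ((b₀ , b₁) ∷ σ) ≡ 𝟐 ⊗ φ σ) × (φ⁺ ((b₀ , b₂) ∷ σ) ≡ φ σ) × (φ⁺ ((b₁ , b₂) ∷ σ) ≡ 𝟎)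
  φ⁺-inner< σ m =
    trans (ext-hit b₀ _ _ b₁ σ) (trans (cong-app (pick-≡ b₁ _ _) σ)
      (ext-avoid b₂ _ _ σ (Match-mono (S-∖β 𝟐 (λ _ p → p)) m))) ,
    trans (ext-hit b₀ _ _ b₂ σ) (trans (cong-app (pick-≢ b₂ b₁ _ _ (≢-sym b₁≢b₂)) σ)
      (trans (cong-app (pick-≡ b₂ _ _) σ) (ext-avoid b₁ _ _ σ (Match-mono (S-∖β 𝟏 (λ _ p → p)) m))))
        ,
    trans (ext-avoid {P = S⁺} b₀ _ _ _ ((S⁺b₁ , ≢-sym b₀≢b₁) , (S⁺b₂ , ≢-sym b₀≢b₂) , b₁≢b₂ ,
        Match-mono (λ x p → (S-∖β 𝟎 (λ _ q → q) x p , S-≢β p 𝟏) , S-≢β p 𝟐) m))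
      (Φ-₁₂ φ σ)

  -- As the labels sum to zero, `⊖ (i ⊕ j)` is the label of the third new vertex, the one left
  -- uncovered.
  φ⁺-inner : ∀ i j σ → i ≢ j → Match (S K) σ → φ⁺ ((β i , β j) ∷ σ) ≡ ⊖ (i ⊕ j) ⊗ φ σ
  φ⁺-inner i j σ n m = go i j n
    where
    flipped : ∀ i j → i ≢ j → φ⁺ ((β j , β i) ∷ σ) ≡ φ⁺ ((β i , β j) ∷ σ)
    flipped i j n = φ⁺-alt flip (S⁺β j , S⁺β i , β-injective j i (≢-sym n) ,
      Match-mono (S-∖β∖β j i (λ _ p → p)) m)
    go : ∀ i j → i ≢ j → φ⁺ ((β i , β j) ∷ σ) ≡ ⊖ (i ⊕ j) ⊗ φ σ
    go 𝟎 𝟎 n = contradiction refl n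
    go 𝟎 𝟏 n = proj₁ (φ⁺-inner< σ m)
    go 𝟎 𝟐 n = proj₁ (proj₂ (φ⁺-inner< σ m))
    go 𝟏 𝟎 n = trans (flipped 𝟎 𝟏 λ ()) (proj₁ (φ⁺-inner< σ m))
    go 𝟏 𝟏 n = contradiction refl n
    go 𝟏 𝟐 n = proj₂ (proj₂ (φ⁺-inner< σ m))
    go 𝟐 𝟎 n = trans (flipped 𝟎 𝟐 λ ()) (proj₁ (proj₂ (φ⁺-inner< σ m)))
    go 𝟐 𝟏 n = trans (flipped 𝟏 𝟐 λ ()) (proj₂ (proj₂ (φ⁺-inner< σ m)))
    go 𝟐 𝟐 n = contradiction refl n

  φ⁺-outer : ∀ i x σ → S K x → Match (S K ∖ x) σ → φ⁺ ((β i , x) ∷ σ) ≡ i ⊗ φ σ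
  φ⁺-outer 𝟎 x σ p m = begin
    φ⁺ ((b₀ , x) ∷ σ)                    ≡⟨ ext-hit b₀ _ _ x σ ⟩
    pick x b₁ _ _ σ                      ≡⟨ cong-app (pick-≢ x b₁ _ _ (S-≢β p 𝟏)) σ ⟩
    pick x b₂ _ _ σ                      ≡⟨ cong-app (pick-≢ x b₂ _ _ (S-≢β p 𝟐)) σ ⟩
    ext b₁ (ext b₂ 𝟘 _) _ σ              ≡⟨ ext-avoid b₁ _ _ σ (Match-mono (S-∖β 𝟏 (λ _ → proj₁))
      m) ⟩
    ext b₂ 𝟘 _ σ                         ≡⟨ ext-avoid b₂ _ _ σ (Match-mono (S-∖β 𝟐 (λ _ → proj₁))
      m) ⟩
    𝟎                                    ∎
    where open ≡-Reasoning
  φ⁺-outer 𝟏 x σ p m = trans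
    (ext-avoid {P = S⁺} b₀ _ _ _ ((S⁺b₁ , ≢-sym b₀≢b₁) , S-∖β 𝟎 (λ _ q → q) x p , ≢-sym (S-≢β p 𝟏) ,
      Match-mono (λ { y (q , n) → (S-∖β 𝟎 (λ _ q → q) y q , S-≢β q 𝟏) , n }) m))
    (Φ-₁ φ x σ (S-≢β p 𝟐) (Match-mono (S-∖β 𝟐 (λ _ → proj₁)) m))
  φ⁺-outer 𝟐 x σ p m = trans
    (ext-avoid {P = S⁺} b₀ _ _ _ ((S⁺b₂ , ≢-sym b₀≢b₂) , S-∖β 𝟎 (λ _ q → q) x p , ≢-sym (S-≢β p 𝟐) ,
      Match-mono (λ { y (q , n) → (S-∖β 𝟎 (λ _ q → q) y q , S-≢β q 𝟐) , n }) m))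
    (Φ-₂ {P = S⁺} φ x σ ((S⁺b₂ , ≢-sym b₁≢b₂) , S-∖β 𝟏 (λ _ q → q) x p , ≢-sym (S-≢β p 𝟐) ,
      Match-mono (λ { y (q , n) → (S-∖β 𝟏 (λ _ q → q) y q , S-≢β q 𝟐) , n }) m))

  Match-outer : ∀ i x σ → S K x → Match (S K ∖ x) σ → Match S⁺ ((β i , x) ∷ σ)
  Match-outer i x σ p m = S⁺β i , S⊆S⁺ x p , ≢-sym (S-≢β p i) ,
    Match-mono (λ { y (q , n) → S-∖β i (λ _ q → q) y q , n }) m

  -- In the cyclic order of the new vertices the coefficient of the contraction is `i - (i + 1) = 𝟐`
  -- for every consecutive pair, which lets `QP-one` treat the three positions of `β i` uniformly.
  φ⁺-path : ∀ i x y σ → S K x → S K y → x ≢ y → Match (S K ∖ x ∖ y) σ →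
    φ⁺ ((β i , x) ∷ (β (i ⊕ 𝟏) , y) ∷ σ) ≡ 𝟐 ⊗ φ ((x , y) ∷ σ)
  φ⁺-path 𝟎 x y σ p q n m = begin
    φ⁺ ((b₀ , x) ∷ (b₁ , y) ∷ σ)         ≡⟨ ext-hit b₀ _ _ x _ ⟩
    pick x b₁ _ _ ((b₁ , y) ∷ σ)         ≡⟨ cong-app (pick-≢ x b₁ _ _ (S-≢β p 𝟏)) _ ⟩
    pick x b₂ _ _ ((b₁ , y) ∷ σ)         ≡⟨ cong-app (pick-≢ x b₂ _ _ (S-≢β p 𝟐)) _ ⟩
    ext b₁ (ext b₂ 𝟘 _) _ ((b₁ , y) ∷ σ) ≡⟨ ext-hit b₁ _ _ y σ ⟩
    pick y b₂ 𝟘 _ σ                      ≡⟨ cong-app (pick-≢ y b₂ _ _ (S-≢β q 𝟐)) σ ⟩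
    ext b₂ (𝟐 · ι (x , y) φ) _ σ         ≡⟨ ext-avoid b₂ _ _ σ
      (Match-mono (S-∖β 𝟐 (λ _ → proj₁ ∘ proj₁)) m) ⟩
    𝟐 ⊗ φ ((x , y) ∷ σ)                  ∎
    where open ≡-Reasoning
  φ⁺-path 𝟏 x y σ p q n m = trans
    (ext-avoid {P = S⁺} b₀ _ _ _ ((S⁺b₁ , ≢-sym b₀≢b₁) , S-∖β 𝟎 (λ _ q → q) x p , ≢-sym (S-≢β p 𝟏) ,
      (((S⁺b₂ , ≢-sym b₀≢b₂) , ≢-sym b₁≢b₂) , ≢-sym (S-≢β p 𝟐)) ,
      ((S-∖β 𝟎 (λ _ q → q) y q , S-≢β q 𝟏) , ≢-sym n) , ≢-sym (S-≢β q 𝟐) ,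
      Match-mono (λ { z ((r , a) , b) → (((S-∖β 𝟎 (λ _ q → q) z r , S-≢β r 𝟏) , a) , S-≢β r 𝟐) ,
        b }) m))
    (Φ-₁₁ φ x y σ (S-≢β p 𝟐))
  φ⁺-path 𝟐 x y σ p q n m = begin
    φ⁺ ((b₂ , x) ∷ (b₀ , y) ∷ σ)   ≡⟨ φ⁺-alt swap (S⁺b₂ , S⊆S⁺ x p , ≢-sym (S-≢β p 𝟐) ,
      ((S⁺b₀ , b₀≢b₂) , ≢-sym (S-≢β p 𝟎)) , ((S⊆S⁺ y q , S-≢β q 𝟐) , ≢-sym n) , ≢-sym (S-≢β q 𝟎) ,
      Match-mono (λ { z ((r , a) , b) → (((S⊆S⁺ z r , S-≢β r 𝟐) , a) , S-≢β r 𝟎) , b }) m) ⟩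
    ⊖ φ⁺ ((b₀ , y) ∷ (b₂ , x) ∷ σ) ≡⟨ cong ⊖_ (begin
      φ⁺ ((b₀ , y) ∷ (b₂ , x) ∷ σ)         ≡⟨ ext-hit b₀ _ _ y _ ⟩
      pick y b₁ _ _ ((b₂ , x) ∷ σ)         ≡⟨ cong-app (pick-≢ y b₁ _ _ (S-≢β q 𝟏)) _ ⟩
      pick y b₂ _ _ ((b₂ , x) ∷ σ)         ≡⟨ cong-app (pick-≢ y b₂ _ _ (S-≢β q 𝟐)) _ ⟩
      ext b₁ (ext b₂ 𝟘 _) _ ((b₂ , x) ∷ σ) ≡⟨ ext-avoid {P = S⁺} b₁ _ _ _ ((S⁺b₂ , ≢-sym b₁≢b₂) ,
        S-∖β 𝟏 (λ _ q → q) x p ,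
        ≢-sym (S-≢β p 𝟐) , Match-mono (λ { z ((r , a) , b) → (S-∖β 𝟏 (λ _ q → q) z r , S-≢β r 𝟐) ,
          a }) m) ⟩
      ext b₂ 𝟘 _ ((b₂ , x) ∷ σ)            ≡⟨ ext-hit b₂ _ _ x σ ⟩
      φ ((y , x) ∷ σ)                      ∎) ⟩
    ⊖ φ ((y , x) ∷ σ)              ≡⟨ cong ⊖_ (φ-alt flip (q , p , ≢-sym n ,
      Match-mono (λ { z ((r , a) , b) → (r , b) , a }) m)) ⟩
    𝟐 ⊗ φ ((x , y) ∷ σ)            ∎
    where open ≡-Reasoning

  Match-path : ∀ i j x y σ → i ≢ j → S K x → S K y → x ≢ y → Match (S K ∖ x ∖ y) σ →
    Match S⁺ ((β i , x) ∷ (β j , y) ∷ σ)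
  Match-path i j x y σ ij p q n m = S⁺β i , S⊆S⁺ x p , ≢-sym (S-≢β p i) ,
    ((S⁺β j , β-injective j i (≢-sym ij)) , ≢-sym (S-≢β p j)) ,
    ((S⊆S⁺ y q , S-≢β q i) , ≢-sym n) , ≢-sym (S-≢β q j) ,
    Match-mono (λ { z ((r , a) , b) → (((S⊆S⁺ z r , S-≢β r i) , a) , S-≢β r j) , b }) m

  Match-inner : ∀ i j σ → i ≢ j → Match (S K) σ → Match S⁺ ((β i , β j) ∷ σ)
  Match-inner i j σ n m = S⁺β i , S⁺β j , β-injective i j n , Match-mono (S-∖β∖β i j (λ _ p → p)) m

  edge-outer : ∀ i w τ → S K w → Match (S K ∖ w) (e ∷ τ) →
    φ⁺ (e ∷ (β i , w) ∷ τ) ≡ ⊖ (i ⊗ φ (e ∷ τ))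
  edge-outer i w τ p m = trans (φ⁺-alt swap (Match-swap (Match-outer i w _ p m)))
    (cong ⊖_ (φ⁺-outer i w _ p m))

  edge-inner : ∀ i j τ → i ≢ j → Match (S K) (e ∷ τ) →
    φ⁺ (e ∷ (β i , β j) ∷ τ) ≡ ⊖ (⊖ (i ⊕ j) ⊗ φ (e ∷ τ))
  edge-inner i j τ n m = trans (φ⁺-alt swap (Match-swap (Match-inner i j _ n m)))
    (cong ⊖_ (φ⁺-inner i j _ n m))

  edge-path : ∀ i w u τ → S K w → S K u → w ≢ u → Match (S K ∖ w ∖ u) (e ∷ τ) →
    φ⁺ (e ∷ (β i , w) ∷ (β (i ⊕ 𝟏) , u) ∷ τ) ≡ φ (e ∷ (w , u) ∷ τ)
  edge-path {e} i w u τ p q n m = begin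
    φ⁺ (e ∷ (β i , w) ∷ (β (i ⊕ 𝟏) , u) ∷ τ)     ≡⟨ φ⁺-alt swap (Match-swap matched) ⟩
    ⊖ φ⁺ ((β i , w) ∷ e ∷ (β (i ⊕ 𝟏) , u) ∷ τ)   ≡⟨ cong ⊖_ (φ⁺-alt (cons swap) matched) ⟩
    ⊖ ⊖ φ⁺ ((β i , w) ∷ (β (i ⊕ 𝟏) , u) ∷ e ∷ τ) ≡⟨ cong (λ x → ⊖ ⊖ x) (φ⁺-path i w u _ p q n m) ⟩
    ⊖ ⊖ (𝟐 ⊗ φ ((w , u) ∷ e ∷ τ))                ≡⟨ cong (λ x → ⊖ ⊖ (𝟐 ⊗ x))
      (φ-alt swap (Match-head p q n m)) ⟩
    ⊖ ⊖ (𝟐 ⊗ ⊖ φ (e ∷ (w , u) ∷ τ))              ≡⟨ by₁ {λ x → ⊖ ⊖ (𝟐 ⊗ ⊖ x)} {λ x → x} tt _ ⟩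
    φ (e ∷ (w , u) ∷ τ)                          ∎
    where
    open ≡-Reasoning
    i≢i+1 : ∀ i → i ≢ i ⊕ 𝟏
    i≢i+1 𝟎 ()
    i≢i+1 𝟏 ()
    i≢i+1 𝟐 ()
    matched : Match S⁺ ((β i , w) ∷ e ∷ (β (i ⊕ 𝟏) , u) ∷ τ)
    matched = Match-step (cons swap) (Match-path i (i ⊕ 𝟏) w u (e ∷ τ) (i≢i+1 i) p q n m)

  -- Exactness of the new cocycle on triples of vertices

  QP : ℕ → ℕ → ℕ → Set
  QP x y z = Σ Cochain λ η → Primitive (S⁺ ∖ x ∖ y ∖ z) 1 (suc K) η (t x y z φ⁺)

  -- `t` is invariant under rotation, so the case distinction depends only on how many of the three
  -- vertices are new.
  rotate : ∀ {x y z} → QP x y z → QP y z x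
  rotate {x} {y} {z} (h , pr) = h , primitive-mono (λ { _ (((p , a) , b) , c) → ((p , c) , a) , b })
    (primitive-cong (λ σ _ _ → by₃ {λ x y z → y ⊕ z ⊕ x} {λ x y z → x ⊕ y ⊕ z} tt
      (φ⁺ ((x , y) ∷ σ)) (φ⁺ ((y , z) ∷ σ)) (φ⁺ ((z , x) ∷ σ))) pr)

  -- A primitive is only needed on the faces avoiding one further vertex, by connectivity.
  drop : ∀ v {x y z h} → S⁺ v → v ≢ x → v ≢ y → v ≢ z → S⁺ x → S⁺ y → S⁺ z →
    x ≢ y → y ≢ z → z ≢ x →
    Primitive (S⁺ ∖ x ∖ y ∖ z ∖ v) 1 (suc K) h (t x y z φ⁺) → QP x y z
  drop v {x} {y} {z} pv vx vy vz px py pz xy yz zx pr = drop-vertex K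
    ((((pv , vx) , vy) , vz) , remove-Distinct v _ (remove-Distinct z _ (remove-Distinct y _
      (remove-Distinct x _ (downFrom-Distinct (top (suc K)))))))
    (ℕₚ.+-cancelˡ-≤ 4 _ _ (begin
      4 + 3 * K                       ≡⟨ cong (3 +_) (sym (top≡ K)) ⟩
      top (suc K)                         ≡⟨ Listₚ.length-downFrom (top (suc K)) ⟨
      length (downFrom (top (suc K)))     ≤⟨ remove-length x L₀ ⟩
      _                                   ≤⟨ s≤s (remove-length y L₁) ⟩
      _                                   ≤⟨ s≤s (s≤s (remove-length z L₂)) ⟩
      _                                   ≤⟨ s≤s (s≤s (s≤s (remove-length v L₃))) ⟩
      _                                   ∎))
    (Alt-t px py pz xy yz zx φ⁺-alt) (cocycle-t px py pz xy yz zx φ⁺-coc) pr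
    where
    open ℕₚ.≤-Reasoning
    L₀ L₁ L₂ L₃ : List ℕ
    L₀ = downFrom (top (suc K))
    L₁ = remove x L₀
    L₂ = remove y L₁
    L₃ = remove z L₂

  outer′ : ∀ i x σ → S K x → Match (S K ∖ x) σ → φ⁺ ((x , β i) ∷ σ) ≡ i ⊗ φ σ
  outer′ i x σ p m = trans (φ⁺-alt flip (Match-flip (Match-outer i x σ p m))) (φ⁺-outer i x σ p m)

  S-old : ∀ {x} → S⁺ x → (∀ i → x ≢ β i) → S K x
  S-old p n = old p (n 𝟎) (n 𝟏) (n 𝟐)

  S-rest : ∀ i j k {x} → i ≢ j → j ≢ k → k ≢ i → S⁺ x → x ≢ β i → x ≢ β j → x ≢ β k → S K x
  S-rest i j k ij jk ki p ni nj nk = S-old p λ l e → case l (cover i j k ij jk ki l) e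
    where
    cover : ∀ i j k → i ≢ j → j ≢ k → k ≢ i → ∀ l → l ≡ i ⊎ l ≡ j ⊎ l ≡ k
    cover = toWitness {a? = all₃? λ i → all₃? λ j → all₃? λ k → ¬? (i ≟₃ j) →-dec (¬? (j ≟₃ k) →-dec
      (¬? (k ≟₃ i) →-dec all₃? λ l → (l ≟₃ i) ⊎-dec ((l ≟₃ j) ⊎-dec (l ≟₃ k))))} tt
    case : ∀ l → l ≡ i ⊎ l ≡ j ⊎ l ≡ k → _ ≢ β l
    case l (inj₁ refl)        = ni
    case l (inj₂ (inj₁ refl)) = nj
    case l (inj₂ (inj₂ refl)) = nk

  -- The coefficients of the three inner edges are the three labels, whose sum is zero; so `t`
  -- vanishes.
  QP-three : ∀ i j k → i ≢ j → j ≢ k → k ≢ i → QP (β i) (β j) (β k)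
  QP-three i j k ij jk ki = 𝟘 , primitive-𝟘 λ σ m _ →
    let m' = Match-mono (λ { x (((p , a) , b) , c) → S-rest i j k ij jk ki p a b c }) m in
    trans (cong₂ _⊕_ (cong₂ _⊕_ (φ⁺-inner i j σ ij m') (φ⁺-inner j k σ jk m'))
      (φ⁺-inner k i σ ki m'))
      (toWitness {a? = all₃? λ i → all₃? λ j → all₃? λ k → ¬? (i ≟₃ j) →-dec (¬? (j ≟₃ k) →-dec
        (¬? (k ≟₃ i) →-dec all₃? λ x → (⊖ (i ⊕ j) ⊗ x ⊕ ⊖ (j ⊕ k) ⊗ x ⊕ ⊖ (k ⊕ i) ⊗ x) ≟₃ 𝟎))}
        tt i j k ij jk ki (φ σ))

  -- On the faces avoiding the third new vertex, the inner edge contributes its label `⊖ (i ⊕ j)`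
  -- and the edges to `z` contribute `j` and `i`, so `t` vanishes again.
  QP-two : ∀ i j z → i ≢ j → S K z → QP (β i) (β j) z
  QP-two i j z ij Sz = drop (β κ) (S⁺β κ) (β-injective κ i ki) (β-injective κ j (≢-sym jk))
    (≢-sym (S-≢β Sz κ))
    (S⁺β i) (S⁺β j) (S⊆S⁺ z Sz) (β-injective i j ij) (≢-sym (S-≢β Sz j)) (S-≢β Sz i)
    (primitive-𝟘 λ σ m _ →
      let m' = Match-mono (λ { x ((((p , a) , b) , c) , d) → S-rest i j κ ij jk ki p a b d , c }) m in
      trans (cong₂ _⊕_ (cong₂ _⊕_ (φ⁺-inner i j σ ij (Match-mono (λ _ → proj₁) m'))
          (φ⁺-outer j z σ Sz m')) (outer′ i z σ Sz m'))
        (by₃ {λ i j x → ⊖ (i ⊕ j) ⊗ x ⊕ j ⊗ x ⊕ i ⊗ x} {λ _ _ _ → 𝟎} tt i j (φ σ)))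
    where
    κ = ⊖ (i ⊕ j)
    jk : j ≢ κ
    jk = toWitness {a? = all₃? λ i → all₃? λ j → ¬? (i ≟₃ j) →-dec ¬? (j ≟₃ ⊖ (i ⊕ j))} tt i j ij
    ki : κ ≢ i
    ki = toWitness {a? = all₃? λ i → all₃? λ j → ¬? (i ≟₃ j) →-dec ¬? (⊖ (i ⊕ j) ≟₃ i)} tt i j ij

  -- With `β (i ⊕ 𝟐)` dropped, the faces that also avoid `β (i ⊕ 𝟏)` see `2i φ = -i φ`, whose
  -- primitive is `-i` times the link of `φ` at `yz`. On a face through `β (i ⊕ 𝟏)` and `w`, the
  -- rest to be made exact is then `t y z w φ`, and this is the induction hypothesis.
  QP-one : ∀ i y z → S K y → S K z → y ≢ z → QP (β i) y z
  QP-one i y z Sy Sz yz = drop (β κ) (S⁺β κ) (β-injective κ i ki) (≢-sym (S-≢β Sy κ))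
    (≢-sym (S-≢β Sz κ))
    (S⁺β i) (S⊆S⁺ y Sy) (S⊆S⁺ z Sz) (≢-sym (S-≢β Sy i)) yz (S-≢β Sz i)
    (primitive-ext ((((S⁺β j , β-injective j i (≢-sym ij)) , ≢-sym (S-≢β Sy j)) ,
      ≢-sym (S-≢β Sz j)) , β-injective j κ jk)
      (Alt-mono (λ _ → proj₁) (Alt-t (S⁺β i) (S⊆S⁺ y Sy) (S⊆S⁺ z Sz) (≢-sym (S-≢β Sy i)) yz
        (S-≢β Sz i) φ⁺-alt))
      (primitive-cong (λ σ m _ →
          let m' = Match-mono inc m in trans
          (cong₂ _⊕_ (cong₂ _⊕_ (φ⁺-outer i y σ Sy (Match-mono (λ _ → proj₁) m'))
                       (φ⁺-∅ (λ _ p → p) _ (Match-head Sy Sz yz m')))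
            (outer′ i z σ Sz (Match-mono (λ { x ((p , a) , b) → p , b }) m')))
          (by₂ {λ i x → i ⊗ x ⊕ 𝟎 ⊕ i ⊗ x} {λ i x → ⊖ i ⊗ x} tt i (φ σ)))
        (primitive-· (⊖ i) (Alt-mono inc (Alt-ι Sy Sz yz φ-alt) , λ σ m l →
          cocycle-link φ Sy Sz yz φ-coc σ (Match-mono inc m) (ℕₚ.suc-injective l))))
      λ { w ((((pw , wi) , wy) , wz) , wk) jw A →
        let Sw = S-rest i j κ ij jk ki pw wi (≢-sym jw) wk
            incw = λ { x ((((((p , a) , b) , c) , d) , e) , f) →
              ((S-rest i j κ ij jk ki p a e d , b) , c) , f } in
        primitive-cong (λ τ m l →
            let m' = Match-mono incw m
                (myz , mzw , mwy) = Match-t Sy Sz Sw yz (≢-sym wz) wy m' in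
            trans (cong (λ x → ⊖ i ⊗ φ ((y , z) ∷ τ) ⊝ x) (cong₂ _⊕_ (cong₂ _⊕_
              (φ⁺-path i y w τ Sy Sw (≢-sym wy) (Match-mono (λ { _ (((p , a) , b) , c) → (p , a) ,
                c }) m'))
              (edge-outer j w τ Sw (Match-head (Sy , ≢-sym wy) (Sz , ≢-sym wz) yz
                (Match-mono (λ { _ (((p , a) , b) , c) → ((p , c) , a) , b }) m'))))
              (trans (φ⁺-alt flip (Match-flip (Match-path i j z w τ ij Sz Sw (≢-sym wz)
                  (Match-mono (λ { _ (((p , a) , b) , c) → (p , b) , c }) m'))))
                (φ⁺-path i z w τ Sz Sw (≢-sym wz) (Match-mono (λ { _ (((p , a) , b) , c) → (p , b) ,
                  c }) m')))))
            (trans (by₄ {λ i yz yw zw → ⊖ i ⊗ yz ⊝ (𝟐 ⊗ yw ⊕ ⊖ ((i ⊕ 𝟏) ⊗ yz) ⊕ 𝟐 ⊗ zw)}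
                 {λ i yz yw zw → yz ⊕ zw ⊕ yw} tt i (φ ((y , z) ∷ τ)) (φ ((y , w) ∷ τ))
                   (φ ((z , w) ∷ τ)))
              (cong (φ ((y , z) ∷ τ) ⊕ φ ((z , w) ∷ τ) ⊕_) (φ-alt flip (Match-flip mwy)))))
          (primitive-mono incw
            (let (A' , pr) = η-pr Sy Sz Sw yz (≢-sym wz) wy in A' , λ σ m l →
                   pr σ m (ℕₚ.suc-injective l))) })
    where
    j = i ⊕ 𝟏
    κ = i ⊕ 𝟐
    ij : i ≢ j
    ij = toWitness {a? = all₃? λ i → ¬? (i ≟₃ (i ⊕ 𝟏))} tt i
    jk : j ≢ κ
    jk = toWitness {a? = all₃? λ i → ¬? ((i ⊕ 𝟏) ≟₃ (i ⊕ 𝟐))} tt i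
    ki : κ ≢ i
    ki = toWitness {a? = all₃? λ i → ¬? ((i ⊕ 𝟐) ≟₃ i)} tt i
    inc : (S⁺ ∖ β i ∖ y ∖ z ∖ β κ ∖ β j) ⊆ (S K ∖ y ∖ z)
    inc x (((((p , a) , b) , c) , d) , e) = (S-rest i j κ ij jk ki p a e d , b) , c

  -- Contraction at `b₁` and `b₂` commutes up to sign with fixing an old edge. So on the faces
  -- avoiding `b₀` the cochain `t x y z φ⁺` is `⊖ Φ (t x y z φ)`, and `Φ-primitive` transports the
  -- old `η`.
  QP-zero : ∀ x y z → S K x → S K y → S K z → x ≢ y → y ≢ z → z ≢ x → QP x y z
  QP-zero x y z Sx Sy Sz xy yz zx = drop b₀ S⁺b₀ (≢-sym (S-≢β Sx 𝟎)) (≢-sym (S-≢β Sy 𝟎))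
    (≢-sym (S-≢β Sz 𝟎))
    (S⊆S⁺ x Sx) (S⊆S⁺ y Sy) (S⊆S⁺ z Sz) xy yz zx
    (primitive-cong (λ σ m _ → agree σ m)
      (let (A , pr) = Φ-primitive {P = D} {R = E} p₁ p₂ inc (Alt-t Sx Sy Sz xy yz zx φ-alt) (η-pr Sx Sy Sz xy yz zx)
       in A , λ σ m l → pr σ m (ℕₚ.suc-injective l)))
    where
    D E : ℕ → Set
    D = S⁺ ∖ x ∖ y ∖ z ∖ b₀
    E = S K ∖ x ∖ y ∖ z
    p₁ : D b₁
    p₁ = (((S⁺b₁ , ≢-sym (S-≢β Sx 𝟏)) , ≢-sym (S-≢β Sy 𝟏)) , ≢-sym (S-≢β Sz 𝟏)) , ≢-sym b₀≢b₁
    p₂ : D b₂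
    p₂ = (((S⁺b₂ , ≢-sym (S-≢β Sx 𝟐)) , ≢-sym (S-≢β Sy 𝟐)) , ≢-sym (S-≢β Sz 𝟐)) , ≢-sym b₀≢b₂
    inc : (D ∖ b₁ ∖ b₂) ⊆ E
    inc _ ((((((p , a) , b) , c) , d) , e) , f) = ((old p d e f , a) , b) , c
    A₁ : Alt D (t x y z φ⁺)
    A₁ = Alt-mono (λ _ → proj₁) (Alt-t (S⊆S⁺ x Sx) (S⊆S⁺ y Sy) (S⊆S⁺ z Sz) xy yz zx φ⁺-alt)
    A₂ : Alt D (λ σ → ⊖ Φ (t x y z φ) σ)
    A₂ = Alt-⊖ (Alt-Φ {P = D} {R = E} p₁ p₂ inc (Alt-t Sx Sy Sz xy yz zx φ-alt))
    sum : ∀ {p q r p' q' r'} s → p ≡ s ⊗ p' → q ≡ s ⊗ q' → r ≡ s ⊗ r' → p ⊕ q ⊕ r ≡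
      s ⊗ (p' ⊕ q' ⊕ r')
    sum {p' = p'} {q'} {r'} s refl refl refl =
      by₄ {λ s p q r → s ⊗ p ⊕ s ⊗ q ⊕ s ⊗ r} {λ s p q r → s ⊗ (p ⊕ q ⊕ r)} tt s p' q' r'
    agree-∅ : ∀ σ → Match (D ∖ b₁ ∖ b₂) σ → t x y z φ⁺ σ ≡ ⊖ Φ (t x y z φ) σ
    agree-∅ σ m = let (m₁ , m₂ , m₃) = Match-t Sx Sy Sz xy yz zx (Match-mono inc m) in
      trans (cong₂ _⊕_ (cong₂ _⊕_ (φ⁺-∅ (λ _ p → p) _ m₁) (φ⁺-∅ (λ _ p → p) _ m₂))
        (φ⁺-∅ (λ _ p → p) _ m₃))
        (sym (cong ⊖_ (Φ-∅ (t x y z φ) σ m)))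
    agree-₂ : ∀ w σ → Match (D ∖ b₁) ((b₂ , w) ∷ σ) → t x y z φ⁺ ((b₂ , w) ∷ σ) ≡ ⊖ Φ (t x y z φ)
      ((b₂ , w) ∷ σ)
    agree-₂ w σ m@(_ , ((((((pw , wx) , wy) , wz) , w0) , w1)) , w2 , m') =
      let Sw = old pw w0 w1 (≢-sym w2)
          (m₁ , m₂ , m₃) = Match-t (Sx , ≢-sym wx) (Sy , ≢-sym wy) (Sz , ≢-sym wz) xy yz zx
            (Match-mono (λ { _ (((((((p , a) , b) , c) , d) , e) , f) , g) →
              (((old p d e f , g) , a) , b) , c }) m')
      in trans (sum 𝟏 (edge-outer 𝟐 w σ Sw m₁) (edge-outer 𝟐 w σ Sw m₂) (edge-outer 𝟐 w σ Sw m₃))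
        (trans (by₃ {λ p q r → ⊖ (𝟐 ⊗ p) ⊕ ⊖ (𝟐 ⊗ q) ⊕ ⊖ (𝟐 ⊗ r)} {λ p q r → ⊖ (𝟐 ⊗ (p ⊕ q ⊕ r))} tt
            (φ ((x , y) ∷ σ)) (φ ((y , z) ∷ σ)) (φ ((z , x) ∷ σ)))
          (sym (cong ⊖_ (Φ-₂ (t x y z φ) w σ m))))
    agree-₁ : ∀ w σ → w ≢ b₂ → Match (D ∖ b₂) ((b₁ , w) ∷ σ) → t x y z φ⁺ ((b₁ , w) ∷ σ) ≡
      ⊖ Φ (t x y z φ) ((b₁ , w) ∷ σ)
    agree-₁ w σ w2 m@(_ , ((((((pw , wx) , wy) , wz) , w0) , _)) , w1 , m') =
      let Sw = old pw w0 (≢-sym w1) w2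
          (m₁ , m₂ , m₃) = Match-t (Sx , ≢-sym wx) (Sy , ≢-sym wy) (Sz , ≢-sym wz) xy yz zx
            (Match-mono (λ { _ (((((((p , a) , b) , c) , d) , e) , f) , g) →
              (((old p d f e , g) , a) , b) , c }) m')
      in trans (sum 𝟐 (edge-outer 𝟏 w σ Sw m₁) (edge-outer 𝟏 w σ Sw m₂) (edge-outer 𝟏 w σ Sw m₃))
          (sym (cong ⊖_ (Φ-₁ (t x y z φ) w σ w2 (Match-mono (λ { _ (((p , a) , b) , c) → p , a })
            m'))))
    agree-₁₁ : ∀ w u σ → w ≢ b₂ → Match D ((b₁ , w) ∷ (b₂ , u) ∷ σ) →
      t x y z φ⁺ ((b₁ , w) ∷ (b₂ , u) ∷ σ) ≡ ⊖ Φ (t x y z φ) ((b₁ , w) ∷ (b₂ , u) ∷ σ)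
    agree-₁₁ w u σ w2 (_ , ((((pw , wx) , wy) , wz) , w0) , w1 , _ ,
      ((((((pu , ux) , uy) , uz) , u0) , u1) , uw) , u2 , m') =
      let Sw = old pw w0 (≢-sym w1) w2
          Su = old pu u0 u1 (≢-sym u2)
          (m₁ , m₂ , m₃) = Match-t ((Sx , ≢-sym wx) , ≢-sym ux) ((Sy , ≢-sym wy) , ≢-sym uy)
            ((Sz , ≢-sym wz) , ≢-sym uz) xy yz zx
            (Match-mono (λ { _ ((((((((p , a) , b) , c) , d) , e) , f) , g) , h) →
              ((((old p d e g , f) , h) , a) , b) , c }) m')
      in trans (sum 𝟏 (edge-path 𝟏 w u σ Sw Su (≢-sym uw) m₁) (edge-path 𝟏 w u σ Sw Su (≢-sym uw)
        m₂)
                 (edge-path 𝟏 w u σ Sw Su (≢-sym uw) m₃))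
          (trans (by₁ {λ x → x} {λ x → ⊖ (𝟐 ⊗ x)} tt (t x y z φ ((w , u) ∷ σ)))
            (sym (cong ⊖_ (Φ-₁₁ (t x y z φ) w u σ w2))))
    agree-₁₂ : ∀ σ → Match D ((b₁ , b₂) ∷ σ) → t x y z φ⁺ ((b₁ , b₂) ∷ σ) ≡ ⊖ Φ (t x y z φ)
      ((b₁ , b₂) ∷ σ)
    agree-₁₂ σ (_ , _ , _ , m') =
      let (m₁ , m₂ , m₃) = Match-t Sx Sy Sz xy yz zx (Match-mono inc m') in
      trans (cong₂ _⊕_ (cong₂ _⊕_ (edge-inner 𝟏 𝟐 σ (λ ()) m₁) (edge-inner 𝟏 𝟐 σ (λ ()) m₂))
          (edge-inner 𝟏 𝟐 σ (λ ()) m₃))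
        (sym (cong ⊖_ (Φ-₁₂ (t x y z φ) σ)))
    agree : ∀ σ → Match D σ → t x y z φ⁺ σ ≡ ⊖ Φ (t x y z φ) σ
    agree σ m = split b₁ σ A₁ A₂ m
      (λ τ mτ _ → split b₂ τ (Alt-mono (λ _ → proj₁) A₁) (Alt-mono (λ _ → proj₁) A₂) mτ
        (λ ρ mρ _ → agree-∅ ρ mρ) (λ w ρ mρ _ → agree-₂ w ρ mρ))
      (λ w τ mτ _ → touch w τ mτ)
      where
      touch : ∀ w τ → Match D ((b₁ , w) ∷ τ) → t x y z φ⁺ ((b₁ , w) ∷ τ) ≡ ⊖ Φ (t x y z φ)
        ((b₁ , w) ∷ τ)
      touch w τ m@(p , q , n , m') with w ℕ.≟ b₂
      ... | yes refl = agree-₁₂ τ m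
      ... | no w≢b₂  = split b₂ τ (Alt-ι p q n A₁) (Alt-ι p q n A₂) m'
        (λ ρ mρ _ → agree-₁ w ρ w≢b₂ ((p , b₁≢b₂) , (q , w≢b₂) , n ,
          Match-mono (λ { _ (((p , a) , b) , c) → ((p , c) , a) , b }) mρ))
        (λ u ρ mρ _ → agree-₁₁ w u ρ w≢b₂ (Match-head p q n mρ))

  classify : ∀ x → S⁺ x → (∃ λ i → x ≡ β i) ⊎ S K x
  classify x p with x ℕ.≟ b₀ | x ℕ.≟ b₁ | x ℕ.≟ b₂
  ... | yes e | _     | _     = inj₁ (𝟎 , e)
  ... | no _  | yes e | _     = inj₁ (𝟏 , e)
  ... | no _  | no _  | yes e = inj₁ (𝟐 , e)
  ... | no n₀ | no n₁ | no n₂ = inj₂ (old p n₀ n₁ n₂)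

  QP-all : ∀ x y z → S⁺ x → S⁺ y → S⁺ z → x ≢ y → y ≢ z → z ≢ x → QP x y z
  QP-all x y z px py pz xy yz zx with classify x px | classify y py | classify z pz
  ... | inj₂ Sx         | inj₂ Sy         | inj₂ Sz         = QP-zero x y z Sx Sy Sz xy yz zx
  ... | inj₁ (i , refl) | inj₂ Sy         | inj₂ Sz         = QP-one i y z Sy Sz yz
  ... | inj₂ Sx         | inj₁ (i , refl) | inj₂ Sz         =
    rotate (rotate (QP-one i z x Sz Sx zx))
  ... | inj₂ Sx         | inj₂ Sy         | inj₁ (i , refl) = rotate (QP-one i x y Sx Sy xy)
  ... | inj₁ (i , refl) | inj₁ (j , refl) | inj₂ Sz         = QP-two i j z (xy ∘ cong β) Sz
  ... | inj₂ Sx         | inj₁ (i , refl) | inj₁ (j , refl) =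
    rotate (rotate (QP-two i j x (yz ∘ cong β) Sx))
  ... | inj₁ (i , refl) | inj₂ Sy         | inj₁ (j , refl) = rotate (QP-two j i y (zx ∘ cong β) Sy)
  ... | inj₁ (i , refl) | inj₁ (j , refl) | inj₁ (k , refl) =
    QP-three i j k (xy ∘ cong β) (yz ∘ cong β) (zx ∘ cong β)

  Admissible : ℕ → ℕ → ℕ → Set
  Admissible x y z = S⁺ x × S⁺ y × S⁺ z × x ≢ y × y ≢ z × z ≢ x

  admissible? : ∀ x y z → Dec (Admissible x y z)
  admissible? x y z = (x ℕ.<? _) ×-dec (y ℕ.<? _) ×-dec (z ℕ.<? _) ×-dec
    ¬? (x ℕ.≟ y) ×-dec ¬? (y ℕ.≟ z) ×-dec ¬? (z ℕ.≟ x)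

  -- `η` is a function of all triples, while a primitive is at hand for the admissible ones; the
  -- others receive the default `𝟘`.
  η⁺′ : ∀ x y z → Dec (Admissible x y z) → Cochain
  η⁺′ x y z (yes (px , py , pz , xy , yz , zx)) = proj₁ (QP-all x y z px py pz xy yz zx)
  η⁺′ x y z (no _) = 𝟘

  η⁺-primitive : ∀ x y z (d : Dec (Admissible x y z)) → Admissible x y z →
    Primitive (S⁺ ∖ x ∖ y ∖ z) 1 (suc K) (η⁺′ x y z d) (t x y z φ⁺)
  η⁺-primitive x y z (yes (px , py , pz , xy , yz , zx)) _ = proj₂ (QP-all x y z px py pz xy yz zx)
  η⁺-primitive x y z (no ¬a) a = contradiction a ¬a

  next : Tower (suc K)
  next = record
    { φ = φ⁺ ; φ-alt = φ⁺-alt ; φ-coc = φ⁺-coc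
    ; η = λ x y z → η⁺′ x y z (admissible? x y z)
    ; η-pr = λ {x} {y} {z} px py pz xy yz zx →
        η⁺-primitive x y z (admissible? x y z) (px , py , pz , xy , yz , zx) }

tower : ∀ K → Tower K
-- `S 0` consists of the vertex `0`, so the empty face is the only one and `φ` is its dual; `φ-coc`
-- and `η-pr` are vacuous for want of two distinct vertices.
tower zero = record
  { φ = λ { [] → 𝟏 ; (_ ∷ _) → 𝟎 }
  ; φ-alt = λ { swap m → refl ; flip m → refl ; (cons {s = s} st) m → sym (⊗-zeroʳ s) }
  ; φ-coc = λ { ((a , b) ∷ []) (p , q , n , _) l → contradiction (trans (ℕₚ.n<1⇒n≡0 p)
    (sym (ℕₚ.n<1⇒n≡0 q))) n }
  ; η = λ _ _ _ → 𝟘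
  ; η-pr = λ px py pz xy yz zx → contradiction (trans (ℕₚ.n<1⇒n≡0 px) (sym (ℕₚ.n<1⇒n≡0 py))) xy }
tower (suc K) = Block.next (tower K)

-- Chains on chessboard complexes

module FinSum {A : Set} (_∙_ : A → A → A) (ε : A)
  (identityˡ : ∀ x → ε ∙ x ≡ x)
  (assoc : ∀ x y z → (x ∙ y) ∙ z ≡ x ∙ (y ∙ z))
  (interchange : ∀ w x y z → (w ∙ x) ∙ (y ∙ z) ≡ (w ∙ y) ∙ (x ∙ z)) where

  ∑ : ∀ n → (Fin n → A) → A
  ∑ zero    f = ε
  ∑ (suc n) f = f zero ∙ ∑ n (f ∘ suc)

  ∑-cong : ∀ n {f g : Fin n → A} → (∀ j → f j ≡ g j) → ∑ n f ≡ ∑ n g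
  ∑-cong zero    h = refl
  ∑-cong (suc n) h = cong₂ _∙_ (h zero) (∑-cong n (h ∘ suc))

  ∑-ε : ∀ n {f : Fin n → A} → (∀ j → f j ≡ ε) → ∑ n f ≡ ε
  ∑-ε zero    h = refl
  ∑-ε (suc n) h = trans (cong₂ _∙_ (h zero) (∑-ε n (h ∘ suc))) (identityˡ ε)

  ∑-∙ : ∀ n (f g : Fin n → A) → ∑ n (λ j → f j ∙ g j) ≡ ∑ n f ∙ ∑ n g
  ∑-∙ zero    f g = sym (identityˡ ε)
  ∑-∙ (suc n) f g = trans (cong ((f zero ∙ g zero) ∙_) (∑-∙ n (f ∘ suc) (g ∘ suc)))
    (interchange _ _ _ _)

  ∑-split : ∀ n n' (f : Fin (n + n') → A) →
    ∑ (n + n') f ≡ ∑ n (f ∘ (_↑ˡ n')) ∙ ∑ n' (f ∘ (n ↑ʳ_))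
  ∑-split zero    n' f = sym (identityˡ _)
  ∑-split (suc n) n' f = trans (cong (f zero ∙_) (∑-split n n' (f ∘ suc))) (sym (assoc _ _ _))

  ∑-hom : ∀ n (h : A → A) → h ε ≡ ε → (∀ x y → h (x ∙ y) ≡ h x ∙ h y) →
    ∀ (f : Fin n → A) → h (∑ n f) ≡ ∑ n (h ∘ f)
  ∑-hom zero    h hε h∙ f = hε
  ∑-hom (suc n) h hε h∙ f = trans (h∙ _ _) (cong (h (f zero) ∙_) (∑-hom n h hε h∙ (f ∘ suc)))

+-interchange : ∀ w x y z → (w +ℤ x) +ℤ (y +ℤ z) ≡ (w +ℤ y) +ℤ (x +ℤ z)
+-interchange w x y z = begin
  (w +ℤ x) +ℤ (y +ℤ z) ≡⟨ ℤₚ.+-assoc w x (y +ℤ z) ⟩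
  w +ℤ (x +ℤ (y +ℤ z)) ≡⟨ cong (w +ℤ_) (ℤₚ.+-assoc x y z) ⟨
  w +ℤ ((x +ℤ y) +ℤ z) ≡⟨ cong (λ t → w +ℤ (t +ℤ z)) (ℤₚ.+-comm x y) ⟩
  w +ℤ ((y +ℤ x) +ℤ z) ≡⟨ cong (w +ℤ_) (ℤₚ.+-assoc y x z) ⟩
  w +ℤ (y +ℤ (x +ℤ z)) ≡⟨ ℤₚ.+-assoc w y (x +ℤ z) ⟨
  (w +ℤ y) +ℤ (x +ℤ z) ∎
  where open ≡-Reasoning

open FinSum _+ℤ_ 0ℤ ℤₚ.+-identityˡ ℤₚ.+-assoc +-interchange public
open FinSum _⊕_ 𝟎 (λ _ → refl) ⊕-assoc ⊕-interchange public
  renaming (∑ to ∑₃; ∑-cong to ∑₃-cong; ∑-ε to ∑₃-ε; ∑-∙ to ∑₃-⊕; ∑-split to ∑₃-split; ∑-hom to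
    ∑₃-hom)

-- The boundary in the complex of all partial maps from rows to columns. It agrees with ∂ on the chains
-- that vanish off the matchings, and is compatible with joins without any conditions.
D : Chain m n → Chain m n
D c []            = 0ℤ
D {n = n} c (nothing ∷ σ) = ∑ n (λ j → c (just j ∷ σ)) +ℤ D (c ∘ (nothing ∷_)) σ
D c (just j ∷ σ)  = - D (c ∘ (just j ∷_)) σ

-- `IsMatching` in a decidable form, row by row, expressed through the same `colUsed` as the terms
-- of `∂`.
NoRep : Face m n → Set
NoRep []            = ⊤
NoRep (nothing ∷ σ) = NoRep σ
NoRep (just j ∷ σ)  = colUsed j σ ≡ false × NoRep σ

noRep? : (σ : Face m n) → Dec (NoRep σ)
noRep? []            = yes tt
noRep? (nothing ∷ σ) = noRep? σ
noRep? (just j ∷ σ)  = (colUsed j σ Boolₚ.≟ false) ×-dec noRep? σ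

term : Chain m n → Face m n → Fin m → Fin n → ℤ
term c σ i j = if isNothing (lookup σ i) ∧ not (colUsed j σ)
               then signℤ (below σ i) *ℤ c (σ [ i ]≔ just j)
               else 0ℤ

sumℤ-++ : ∀ xs ys → sumℤ (xs List.++ ys) ≡ sumℤ xs +ℤ sumℤ ys
sumℤ-++ []       ys = sym (ℤₚ.+-identityˡ _)
sumℤ-++ (x ∷ xs) ys = trans (cong (x +ℤ_) (sumℤ-++ xs ys)) (sym (ℤₚ.+-assoc x _ _))

sumℤ-tabulate : ∀ n (f : Fin n → ℤ) → sumℤ (tabulate f) ≡ ∑ n f
sumℤ-tabulate zero    f = refl
sumℤ-tabulate (suc n) f = cong (f zero +ℤ_) (sumℤ-tabulate n (f ∘ suc))

sumℤ-concatMap : ∀ {A : Set} m (F : A → List ℤ) (g : Fin m → A) →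
  sumℤ (concatMap F (tabulate g)) ≡ ∑ m (λ i → sumℤ (F (g i)))
sumℤ-concatMap zero    F g = refl
sumℤ-concatMap (suc m) F g = trans (sumℤ-++ (F (g zero)) _) (cong (sumℤ (F (g zero)) +ℤ_)
  (sumℤ-concatMap m F (g ∘ suc)))

∂-∑ : ∀ (c : Chain m n) σ → ∂ c σ ≡ ∑ m (λ i → ∑ n (term c σ i))
∂-∑ {m} {n} c σ = trans (sumℤ-concatMap m (λ i → map (term c σ i) (allFin n)) id)
  (∑-cong m λ i → trans (cong sumℤ (Listₚ.map-tabulate id (term c σ i)))
    (sumℤ-tabulate n (term c σ i)))

term′ : Chain m n → Face m n → Fin m → Fin n → ℤ
term′ c σ i j = if isNothing (lookup σ i) then signℤ (below σ i) *ℤ c (σ [ i ]≔ just j) else 0ℤ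

D-∑ : ∀ (c : Chain m n) σ → D c σ ≡ ∑ m (λ i → ∑ n (term′ c σ i))
D-∑ c [] = refl
D-∑ {suc m} {n} c (nothing ∷ σ) = cong₂ _+ℤ_
  (∑-cong n (λ j → sym (ℤₚ.*-identityˡ _))) (D-∑ (c ∘ (nothing ∷_)) σ)
D-∑ {suc m} {n} c (just j ∷ σ) = begin
  - D (c ∘ (just j ∷_)) σ                                    ≡⟨ cong -_ (D-∑ (c ∘ (just j ∷_)) σ) ⟩
  - ∑ m (λ i → ∑ n (term′ (c ∘ (just j ∷_)) σ i))            ≡⟨ ∑-hom m -_ refl ℤₚ.neg-distrib-+ _ ⟩
  ∑ m (λ i → - ∑ n (term′ (c ∘ (just j ∷_)) σ i))            ≡⟨ ∑-cong m (λ i → ∑-hom n -_ refl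
    ℤₚ.neg-distrib-+ _) ⟩
  ∑ m (λ i → ∑ n (λ j' → - term′ (c ∘ (just j ∷_)) σ i j'))  ≡⟨ ∑-cong m (λ i → ∑-cong n (neg i)) ⟩
  ∑ m (λ i → ∑ n (term′ c (just j ∷ σ) (suc i)))             ≡⟨ ℤₚ.+-identityˡ _ ⟨
  0ℤ +ℤ ∑ m (λ i → ∑ n (term′ c (just j ∷ σ) (suc i)))        ≡⟨ cong
    (_+ℤ ∑ m (λ i → ∑ n (term′ c (just j ∷ σ) (suc i)))) (∑-ε n {term′ c (just j ∷ σ) zero} λ _ →
    refl) ⟨
  ∑ (suc m) (λ i → ∑ n (term′ c (just j ∷ σ) i))             ∎
  where
  open ≡-Reasoning
  neg : ∀ i j' → - term′ (c ∘ (just j ∷_)) σ i j' ≡ term′ c (just j ∷ σ) (suc i) j'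
  neg i j' with isNothing (lookup σ i)
  ... | true  = ℤₚ.neg-distribˡ-* (signℤ (below σ i)) _
  ... | false = refl

colUsed-update : ∀ (σ : Face m n) i j j' → lookup σ i ≡ nothing →
  colUsed j' (σ [ i ]≔ just j) ≡ does (j' Fin.≟ j) ∨ colUsed j' σ
colUsed-update (nothing ∷ σ) zero    j j' e = refl
colUsed-update (nothing ∷ σ) (suc i) j j' e = colUsed-update σ i j j' e
colUsed-update (just k ∷ σ)  (suc i) j j' e =
  trans (cong (does (j' Fin.≟ k) ∨_) (colUsed-update σ i j j' e)) (swap-∨ (does (j' Fin.≟ k))
    (does (j' Fin.≟ j)) (colUsed j' σ))
  where
  swap-∨ : ∀ a b c → a ∨ (b ∨ c) ≡ b ∨ (a ∨ c)
  swap-∨ false b c = refl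
  swap-∨ true false c = refl
  swap-∨ true true  c = refl

size-update : ∀ (σ : Face m n) i j → lookup σ i ≡ nothing → size (σ [ i ]≔ just j) ≡ suc (size σ)
size-update (nothing ∷ σ) zero    j e = refl
size-update (nothing ∷ σ) (suc i) j e = size-update σ i j e
size-update (just k ∷ σ)  (suc i) j e = cong suc (size-update σ i j e)

NoRep-update : ∀ (σ : Face m n) i j → lookup σ i ≡ nothing → NoRep σ → colUsed j σ ≡ false →
  NoRep (σ [ i ]≔ just j)
NoRep-update (nothing ∷ σ) zero    j e r u = u , r
NoRep-update (nothing ∷ σ) (suc i) j e r u = NoRep-update σ i j e r u
NoRep-update (just k ∷ σ)  (suc i) j e (v , r) u with j Fin.≟ k | u
... | no j≢k | u = trans (colUsed-update σ i j k e)
  (trans (cong (_∨ colUsed k σ) (≢-does (≢-sym j≢k))) v) ,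
      NoRep-update σ i j e r u
  where
  ≢-does : ∀ {a b : Fin _} → a ≢ b → does (a Fin.≟ b) ≡ false
  ≢-does {a} {b} a≢b with a Fin.≟ b
  ... | yes p = contradiction p a≢b
  ... | no _  = refl

NoRep-update⁻ : ∀ (σ : Face m n) i j → lookup σ i ≡ nothing → NoRep (σ [ i ]≔ just j) →
  NoRep σ × colUsed j σ ≡ false
NoRep-update⁻ (nothing ∷ σ) zero    j e (u , r) = r , u
NoRep-update⁻ (nothing ∷ σ) (suc i) j e r = NoRep-update⁻ σ i j e r
NoRep-update⁻ (just k ∷ σ)  (suc i) j e (v , r)
  with NoRep-update⁻ σ i j e r | j Fin.≟ k | trans (sym (colUsed-update σ i j k e)) v
... | r' , u | yes refl | q = contradiction (trans (sym q) (cong (_∨ colUsed j σ) (does-refl j)))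
  λ ()
  where
  does-refl : ∀ (a : Fin _) → does (a Fin.≟ a) ≡ true
  does-refl a with a Fin.≟ a
  ... | yes _ = refl
  ... | no ¬p = contradiction refl ¬p
... | r' , u | no _ | q = (∨-false q , r') , u
  where
  ∨-false : ∀ {a b} → a ∨ b ≡ false → b ≡ false
  ∨-false {false} e = e

lookup⇒colUsed : ∀ (σ : Face m n) i k → lookup σ i ≡ just k → colUsed k σ ≡ true
lookup⇒colUsed (just k ∷ σ)  zero    k refl with k Fin.≟ k
... | yes _ = refl
... | no ¬p = contradiction refl ¬p
lookup⇒colUsed (nothing ∷ σ) (suc i) k q = lookup⇒colUsed σ i k q
lookup⇒colUsed (just k' ∷ σ) (suc i) k q =
  trans (cong (does (k Fin.≟ k') ∨_) (lookup⇒colUsed σ i k q)) (Boolₚ.∨-zeroʳ _)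

NoRep⇒IsMatching : ∀ (σ : Face m n) → NoRep σ → IsMatching σ
NoRep⇒IsMatching (x ∷ σ)       r       zero    zero     j p    q = refl
NoRep⇒IsMatching (just k ∷ σ)  (u , r) zero    (suc i') k refl q =
  contradiction (trans (sym u) (lookup⇒colUsed σ i' k q)) λ ()
NoRep⇒IsMatching (just k ∷ σ)  (u , r) (suc i) zero     k p refl =
  contradiction (trans (sym u) (lookup⇒colUsed σ i k p)) λ ()
NoRep⇒IsMatching (nothing ∷ σ) r       (suc i) (suc i') j p    q =
  cong suc (NoRep⇒IsMatching σ r i i' j p q)
NoRep⇒IsMatching (just _ ∷ σ)  (_ , r) (suc i) (suc i') j p    q =
  cong suc (NoRep⇒IsMatching σ r i i' j p q)

-- Here `d` counts edges, one more than the dimension.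
Pure : ℕ → Chain m n → Set
Pure d c = ∀ σ → c σ ≢ 0ℤ → NoRep σ × size σ ≡ d

-- The two sums differ in the terms that reuse a column; adding such an edge never gives a matching,
-- so a pure chain is zero there.
∂≡D : ∀ {d} (c : Chain m n) → Pure d c → ∀ σ → ∂ c σ ≡ D c σ
∂≡D {m} {n} c pc σ = trans (∂-∑ c σ) (trans (∑-cong m λ i → ∑-cong n λ j → eq i j) (sym (D-∑ c σ)))
  where
  eq : ∀ i j → term c σ i j ≡ term′ c σ i j
  eq i j with lookup σ i in e
  ... | just _  = refl
  ... | nothing with colUsed j σ in u | c (σ [ i ]≔ just j) ℤ.≟ 0ℤ
  ...   | false | _     = refl
  ...   | true  | yes z = sym (trans (cong (signℤ (below σ i) *ℤ_) z)
    (ℤₚ.*-zeroʳ (signℤ (below σ i))))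
  ...   | true  | no ¬z = contradiction
    (trans (sym u) (proj₂ (NoRep-update⁻ σ i j e (proj₁ (pc (σ [ i ]≔ just j) ¬z))))) λ ()

-- A `Chain` may take any values off the relevant faces, and these would enter `D`.
cut : ℕ → Chain m n → Chain m n
cut d c σ with noRep? σ ×-dec (size σ ℕ.≟ d)
... | yes _ = c σ
... | no _  = 0ℤ

cut-in : ∀ d (c : Chain m n) σ → NoRep σ → size σ ≡ d → cut d c σ ≡ c σ
cut-in d c σ r s with noRep? σ ×-dec (size σ ℕ.≟ d)
... | yes _ = refl
... | no ¬p = contradiction (r , s) ¬p

cut-pure : ∀ d (c : Chain m n) → Pure d (cut d c)
cut-pure d c σ nz with noRep? σ ×-dec (size σ ℕ.≟ d)
... | yes p = p
... | no _  = contradiction refl nz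

-- Upgrades a boundary relation on the faces with `d` edges to an identity on all partial maps, the
-- form in which it can be paired with a cochain. Elsewhere both sides vanish: if adding an edge
-- gives a matching with `suc d` edges, the face itself was a matching with `d` edges.
D-cut : ∀ d (w z : Chain m n) → Pure d z → (∀ σ → NoRep σ → size σ ≡ d → ∂ w σ ≡ z σ) →
  ∀ σ → D (cut (suc d) w) σ ≡ z σ
D-cut {m} {n} d w z pz h σ = trans (sym (∂≡D (cut (suc d) w) (cut-pure (suc d) w) σ))
  (go (noRep? σ ×-dec (size σ ℕ.≟ d)))
  where
  w' = cut (suc d) w
  go : Dec (NoRep σ × size σ ≡ d) → ∂ w' σ ≡ z σ
  go (yes (r , s)) = trans (∂-∑ w' σ) (trans (∑-cong m λ i → ∑-cong n λ j → eq i j)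
    (trans (sym (∂-∑ w σ)) (h σ r s)))
    where
    eq : ∀ i j → term w' σ i j ≡ term w σ i j
    eq i j with lookup σ i in e
    ... | just _  = refl
    ... | nothing with colUsed j σ in u
    ...   | true  = refl
    ...   | false = cong (signℤ (below σ i) *ℤ_) (cut-in (suc d) w (σ [ i ]≔ just j)
      (NoRep-update σ i j e r u)
        (trans (size-update σ i j e) (cong suc s)))
  go (no ¬p) = trans (∂-∑ w' σ) (trans (∑-ε m λ i → ∑-ε n λ j → eq i j) (sym z≡0))
    where
    z≡0 : z σ ≡ 0ℤ
    z≡0 with z σ ℤ.≟ 0ℤ
    ... | yes p = p
    ... | no nz = contradiction (pz σ nz) ¬p
    eq : ∀ i j → term w' σ i j ≡ 0ℤ
    eq i j with lookup σ i in e
    ... | just _  = refl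
    ... | nothing with colUsed j σ | w' (σ [ i ]≔ just j) ℤ.≟ 0ℤ
    ...   | true  | _     = refl
    ...   | false | yes q = trans (cong (signℤ (below σ i) *ℤ_) q) (ℤₚ.*-zeroʳ (signℤ (below σ i)))
    ...   | false | no nz = contradiction (proj₁ (NoRep-update⁻ σ i j e r) ,
        ℕₚ.suc-injective (trans (sym (size-update σ i j e)) sz)) ¬p
      where
      r = proj₁ (cut-pure (suc d) w (σ [ i ]≔ just j) nz)
      sz = proj₂ (cut-pure (suc d) w (σ [ i ]≔ just j) nz)

-- Chains are functions compared pointwise, so respect for pointwise equality is a field of its own.
record Linear {X : Set} (L : (X → ℤ) → ℤ) : Set where
  field
    congruent : ∀ {f g} → (∀ x → f x ≡ g x) → L f ≡ L g
    plus      : ∀ f g → L (λ x → f x +ℤ g x) ≡ L f +ℤ L g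
    scaled    : ∀ a f → L (λ x → a *ℤ f x) ≡ a *ℤ L f

  vanish : ∀ {f} → (∀ x → f x ≡ 0ℤ) → L f ≡ 0ℤ
  vanish {f} h = trans (congruent {g = λ x → 0ℤ *ℤ f x} h) (scaled 0ℤ f)

  negate : ∀ f → L (λ x → - f x) ≡ - L f
  negate f = trans (congruent (λ x → sym (ℤₚ.-1*i≡-i (f x)))) (trans (scaled (- 1ℤ) f)
    (ℤₚ.-1*i≡-i (L f)))

  total : ∀ n (f : Fin n → X → ℤ) → L (λ x → ∑ n (λ j → f j x)) ≡ ∑ n (λ j → L (f j))
  total zero    f = vanish (λ _ → refl)
  total (suc n) f = trans (plus (f zero) _) (cong (L (f zero) +ℤ_) (total n (f ∘ suc)))

open Linear

module _ {X : Set} where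

  linear-eval : ∀ x → Linear {X} (λ f → f x)
  linear-eval x = record { congruent = λ h → h x ; plus = λ _ _ → refl ; scaled = λ _ _ → refl }

  linear-0 : Linear {X} (λ _ → 0ℤ)
  linear-0 = record { congruent = λ _ → refl ; plus = λ _ _ → refl ; scaled =
    λ a _ → sym (ℤₚ.*-zeroʳ a) }

  linear-∘ : ∀ {Y : Set} {L} (h : Y → X) → Linear {Y} L → Linear {X} (λ f → L (f ∘ h))
  linear-∘ h l = record
    { congruent = λ e → congruent l (e ∘ h)
    ; plus = λ f g → plus l (f ∘ h) (g ∘ h) ; scaled = λ a f → scaled l a (f ∘ h) }

  linear-+ : ∀ {L L'} → Linear {X} L → Linear {X} L' → Linear {X} (λ f → L f +ℤ L' f)
  linear-+ {L} {L'} l l' = record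
    { congruent = λ e → cong₂ _+ℤ_ (congruent l e) (congruent l' e)
    ; plus = λ f g → trans (cong₂ _+ℤ_ (plus l f g) (plus l' f g)) (+-interchange (L f) (L g) (L' f)
      (L' g))
    ; scaled = λ a f → trans (cong₂ _+ℤ_ (scaled l a f) (scaled l' a f))
      (sym (ℤₚ.*-distribˡ-+ a _ _)) }

  linear-* : ∀ {L} b → Linear {X} L → Linear {X} (λ f → b *ℤ L f)
  linear-* {L} b l = record
    { congruent = λ e → cong (b *ℤ_) (congruent l e)
    ; plus = λ f g → trans (cong (b *ℤ_) (plus l f g)) (ℤₚ.*-distribˡ-+ b _ _)
    ; scaled = λ a f → trans (cong (b *ℤ_) (scaled l a f)) (trans (sym (ℤₚ.*-assoc b a _))
        (trans (cong (_*ℤ L f) (ℤₚ.*-comm b a)) (ℤₚ.*-assoc a b _))) }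

  linear-∑ : ∀ n {L : Fin n → (X → ℤ) → ℤ} → (∀ j → Linear (L j)) → Linear (λ f → ∑ n (λ j → L j f))
  linear-∑ zero    l = linear-0
  linear-∑ (suc n) l = linear-+ (l zero) (linear-∑ n (l ∘ suc))

  linear-≡ : ∀ {L L'} → (∀ f → L f ≡ L' f) → Linear {X} L → Linear {X} L'
  linear-≡ e l = record
    { congruent = λ h → trans (sym (e _)) (trans (congruent l h) (e _))
    ; plus = λ f g → trans (sym (e _)) (trans (plus l f g) (cong₂ _+ℤ_ (e f) (e g)))
    ; scaled = λ a f → trans (sym (e _)) (trans (scaled l a f) (cong (a *ℤ_) (e f))) }

  linear-neg : ∀ {L} → Linear {X} L → Linear {X} (λ f → - L f)
  linear-neg l = linear-≡ (λ f → ℤₚ.-1*i≡-i _) (linear-* (- 1ℤ) l)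

linear-D : (σ : Face m n) → Linear (λ c → D c σ)
linear-D []            = linear-0
linear-D {n = n} (nothing ∷ σ) = linear-+ (linear-∑ n (λ j → linear-eval (just j ∷ σ)))
  (linear-∘ (nothing ∷_) (linear-D σ))
linear-D (just j ∷ σ)  = linear-neg (linear-∘ (just j ∷_) (linear-D σ))

-- Joins of chains

right : ∀ n₁ → Chain m n₂ → Chain m (n₁ + n₂)
right n₁ B []            = B []
right n₁ B (nothing ∷ σ) = right n₁ (B ∘ (nothing ∷_)) σ
right n₁ B (just j ∷ σ)  = [ (λ _ → 0ℤ) , (λ k → right n₁ (B ∘ (just k ∷_)) σ) ]′ (splitAt n₁ j)

join : Chain m₁ n₁ → Chain m₂ n₂ → Chain (m₁ + m₂) (n₁ + n₂)
join {zero}  {n₁} A B σ             = A [] *ℤ right n₁ B σ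
join {suc m}      A B (nothing ∷ σ) = join (A ∘ (nothing ∷_)) B σ
join {suc m} {n₁} A B (just j ∷ σ)  = [ (λ k → join (A ∘ (just k ∷_)) B σ) , (λ _ → 0ℤ) ]′
  (splitAt n₁ j)

linear-right : ∀ n₁ (σ : Face m (n₁ + n₂)) → Linear (λ B → right n₁ B σ)
linear-right n₁ []            = linear-eval []
linear-right n₁ (nothing ∷ σ) = linear-∘ (nothing ∷_) (linear-right n₁ σ)
linear-right n₁ (just j ∷ σ) with splitAt n₁ j
... | inj₁ _ = linear-0
... | inj₂ k = linear-∘ (just k ∷_) (linear-right n₁ σ)

linear-joinˡ : (B : Chain m₂ n₂) (σ : Face (m₁ + m₂) (n₁ + n₂)) →
  Linear (λ A → join {m₁} {n₁} A B σ)
linear-joinˡ {m₁ = zero} {n₁} B σ = linear-≡ (λ A → ℤₚ.*-comm (right n₁ B σ) (A []))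
  (linear-* (right n₁ B σ) (linear-eval []))
linear-joinˡ {m₁ = suc m} B (nothing ∷ σ) = linear-∘ (nothing ∷_) (linear-joinˡ B σ)
linear-joinˡ {m₁ = suc m} {n₁} B (just j ∷ σ) with splitAt n₁ j
... | inj₁ k = linear-∘ (just k ∷_) (linear-joinˡ B σ)
... | inj₂ _ = linear-0

linear-joinʳ : (A : Chain m₁ n₁) (σ : Face (m₁ + m₂) (n₁ + n₂)) → Linear (λ B → join {m₁} {n₁} {m₂}
  {n₂} A B σ)
linear-joinʳ {m₁ = zero}  {n₁} A σ             = linear-* (A []) (linear-right n₁ σ)
linear-joinʳ {m₁ = suc m}      A (nothing ∷ σ) = linear-joinʳ (A ∘ (nothing ∷_)) σ
linear-joinʳ {m₁ = suc m} {n₁} A (just j ∷ σ) with splitAt n₁ j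
... | inj₁ k = linear-joinʳ (A ∘ (just k ∷_)) σ
... | inj₂ _ = linear-0

D-right : ∀ n₁ (B : Chain m n₂) σ → D (right n₁ B) σ ≡ right n₁ (D B) σ
D-right n₁ B [] = refl
D-right {n₂ = n₂} n₁ B (nothing ∷ σ) = begin
  ∑ (n₁ + n₂) (λ j → right n₁ B (just j ∷ σ)) +ℤ D (right n₁ B₀) σ
    ≡⟨ cong₂ _+ℤ_ (∑-split n₁ n₂ _) (D-right n₁ B₀ σ) ⟩
  (∑ n₁ (λ j → right n₁ B (just (j ↑ˡ n₂) ∷ σ)) +ℤ ∑ n₂ (λ k → right n₁ B (just (n₁ ↑ʳ k) ∷ σ))) +ℤ
    right n₁ (D B₀) σ
    ≡⟨ cong (_+ℤ right n₁ (D B₀) σ) (cong₂ _+ℤ_ (∑-ε n₁ left0) (∑-cong n₂ right1)) ⟩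
  (0ℤ +ℤ ∑ n₂ (λ k → right n₁ (B ∘ (just k ∷_)) σ)) +ℤ right n₁ (D B₀) σ
    ≡⟨ cong (_+ℤ right n₁ (D B₀) σ) (trans (ℤₚ.+-identityˡ _)
      (sym (total (linear-right n₁ σ) n₂ _))) ⟩
  right n₁ (λ τ → ∑ n₂ (λ k → B (just k ∷ τ))) σ +ℤ right n₁ (D B₀) σ
    ≡⟨ plus (linear-right n₁ σ) _ _ ⟨
  right n₁ (D B ∘ (nothing ∷_)) σ ∎
  where
  open ≡-Reasoning
  B₀ = B ∘ (nothing ∷_)
  left0 : ∀ j → right n₁ B (just (j ↑ˡ n₂) ∷ σ) ≡ 0ℤ
  left0 j rewrite Finₚ.splitAt-↑ˡ n₁ j n₂ = refl
  right1 : ∀ k → right n₁ B (just (n₁ ↑ʳ k) ∷ σ) ≡ right n₁ (B ∘ (just k ∷_)) σ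
  right1 k rewrite Finₚ.splitAt-↑ʳ n₁ n₂ k = refl
D-right n₁ B (just j ∷ σ) with splitAt n₁ j
... | inj₁ _ = cong -_ (vanish (linear-D σ) (λ _ → refl))
... | inj₂ k = trans (cong -_ (D-right n₁ (B ∘ (just k ∷_)) σ)) (sym (negate (linear-right n₁ σ) _))

alt : Chain m n → Chain m n
alt A σ = signℤ (size σ) *ℤ A σ

-- The graded Leibniz rule, with `alt` supplying the sign. An edge between a row of one factor and a
-- column of the other contributes zero, so the sum over all columns reduces to those of the factor
-- that owns the row.
D-join : ∀ (A : Chain m₁ n₁) (B : Chain m₂ n₂) σ →
  D (join A B) σ ≡ join (D A) B σ +ℤ join (alt A) (D B) σ
D-join {zero} {n₁} A B σ = begin
  D (λ τ → A [] *ℤ right n₁ B τ) σ    ≡⟨ scaled (linear-D σ) (A []) _ ⟩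
  A [] *ℤ D (right n₁ B) σ            ≡⟨ cong₂ _*ℤ_ (sym (ℤₚ.*-identityˡ (A []))) (D-right n₁ B σ) ⟩
  1ℤ *ℤ A [] *ℤ right n₁ (D B) σ       ≡⟨ ℤₚ.+-identityˡ _ ⟨
  0ℤ +ℤ 1ℤ *ℤ A [] *ℤ right n₁ (D B) σ  ∎
  where open ≡-Reasoning
D-join {suc m₁} {n₁} {m₂} {n₂} A B (nothing ∷ σ) = begin
  ∑ (n₁ + n₂) (λ j → join A B (just j ∷ σ)) +ℤ D (join A₀ B) σ
    ≡⟨ cong₂ _+ℤ_ (∑-split n₁ n₂ _) (D-join A₀ B σ) ⟩
  (∑ n₁ (λ k → join A B (just (k ↑ˡ n₂) ∷ σ)) +ℤ ∑ n₂ (λ k → join A B (just (n₁ ↑ʳ k) ∷ σ))) +ℤ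
    (X +ℤ Y)
    ≡⟨ cong (_+ℤ (X +ℤ Y)) (cong₂ _+ℤ_ (∑-cong n₁ left1) (∑-ε n₂ right0)) ⟩
  (∑ n₁ (λ k → join (A ∘ (just k ∷_)) B σ) +ℤ 0ℤ) +ℤ (X +ℤ Y)
    ≡⟨ cong (_+ℤ (X +ℤ Y)) (trans (ℤₚ.+-identityʳ _) (sym (total (linear-joinˡ B σ) n₁ _))) ⟩
  join (λ τ → ∑ n₁ (λ k → A (just k ∷ τ))) B σ +ℤ (X +ℤ Y)
    ≡⟨ ℤₚ.+-assoc (join (λ τ → ∑ n₁ (λ k → A (just k ∷ τ))) B σ) X Y ⟨
  (join (λ τ → ∑ n₁ (λ k → A (just k ∷ τ))) B σ +ℤ X) +ℤ Y
    ≡⟨ cong (_+ℤ Y) (plus (linear-joinˡ B σ) _ _) ⟨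
  join (D A ∘ (nothing ∷_)) B σ +ℤ Y ∎
  where
  open ≡-Reasoning
  A₀ = A ∘ (nothing ∷_)
  X = join (D A₀) B σ
  Y = join (alt A₀) (D B) σ
  left1 : ∀ k → join A B (just (k ↑ˡ n₂) ∷ σ) ≡ join (A ∘ (just k ∷_)) B σ
  left1 k rewrite Finₚ.splitAt-↑ˡ n₁ k n₂ = refl
  right0 : ∀ k → join A B (just (n₁ ↑ʳ k) ∷ σ) ≡ 0ℤ
  right0 k rewrite Finₚ.splitAt-↑ʳ n₁ n₂ k = refl
D-join {suc m₁} {n₁} A B (just j ∷ σ) with splitAt n₁ j
... | inj₂ _ = cong -_ (vanish (linear-D σ) (λ _ → refl))
... | inj₁ k = begin
  - D (join Aₖ B) σ                                     ≡⟨ cong -_ (D-join Aₖ B σ) ⟩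
  - (join (D Aₖ) B σ +ℤ join (alt Aₖ) (D B) σ)           ≡⟨ ℤₚ.neg-distrib-+ (join (D Aₖ) B σ) _ ⟩
  - join (D Aₖ) B σ +ℤ - join (alt Aₖ) (D B) σ           ≡⟨ cong₂ _+ℤ_ (negate (linear-joinˡ B σ)
    (D Aₖ)) (negate (linear-joinˡ (D B) σ) (alt Aₖ)) ⟨
  join (λ τ → - D Aₖ τ) B σ +ℤ join (λ τ → - alt Aₖ τ) (D B) σ
    ≡⟨ cong (join (λ τ → - D Aₖ τ) B σ +ℤ_) (congruent (linear-joinˡ (D B) σ) (λ τ →
      ℤₚ.neg-distribˡ-* (signℤ (size τ)) _)) ⟩
  join (λ τ → - D Aₖ τ) B σ +ℤ join (alt A ∘ (just k ∷_)) (D B) σ ∎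
  where
  open ≡-Reasoning
  Aₖ = A ∘ (just k ∷_)

open Linear

place : Face m₁ n₁ → Face m₂ n₂ → Face (m₁ + m₂) (n₁ + n₂)
place {n₁ = n₁} {n₂ = n₂} σ₁ σ₂ = Vec.map (Maybe.map (_↑ˡ n₂)) σ₁ ++ Vec.map (Maybe.map (n₁ ↑ʳ_)) σ₂

right-nonzero : ∀ n₁ (B : Chain m n₂) σ → right n₁ B σ ≢ 0ℤ →
  ∃ λ τ → σ ≡ Vec.map (Maybe.map (n₁ ↑ʳ_)) τ × B τ ≢ 0ℤ
right-nonzero n₁ B []            nz = [] , refl , nz
right-nonzero n₁ B (nothing ∷ σ) nz =
  let (τ , e , nz') = right-nonzero n₁ (B ∘ (nothing ∷_)) σ nz in nothing ∷ τ , cong (nothing ∷_)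
        e , nz'
right-nonzero {n₂ = n₂} n₁ B (just j ∷ σ) nz with splitAt n₁ j in eq
... | inj₁ _ = contradiction refl nz
... | inj₂ k =
  let (τ , e , nz') = right-nonzero n₁ (B ∘ (just k ∷_)) σ nz in
  just k ∷ τ , cong₂ (λ j σ → just j ∷ σ) (sym (Finₚ.splitAt⁻¹-↑ʳ eq)) e , nz'

join-nonzero : ∀ (A : Chain m₁ n₁) (B : Chain m₂ n₂) σ → join A B σ ≢ 0ℤ →
  ∃ λ σ₁ → ∃ λ σ₂ → σ ≡ place σ₁ σ₂ × A σ₁ ≢ 0ℤ × B σ₂ ≢ 0ℤ
join-nonzero {zero} {n₁} A B σ nz =
  let (τ , e , nz') = right-nonzero n₁ B σ (λ z → nz (trans (cong (A [] *ℤ_) z) (ℤₚ.*-zeroʳ (A [])))) in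
  [] , τ , e , (λ z → nz (cong (_*ℤ right n₁ B σ) z)) , nz'
join-nonzero {suc m₁} A B (nothing ∷ σ) nz =
  let (σ₁ , σ₂ , e , p , q) = join-nonzero (A ∘ (nothing ∷_)) B σ nz in
  nothing ∷ σ₁ , σ₂ , cong (nothing ∷_) e , p , q
join-nonzero {suc m₁} {n₁} A B (just j ∷ σ) nz with splitAt n₁ j in eq
... | inj₂ _ = contradiction refl nz
... | inj₁ k =
  let (σ₁ , σ₂ , e , p , q) = join-nonzero (A ∘ (just k ∷_)) B σ nz in
  just k ∷ σ₁ , σ₂ , cong₂ (λ j σ → just j ∷ σ) (sym (Finₚ.splitAt⁻¹-↑ˡ eq)) e , p , q

≟-cong : ∀ {n n'} {h : Fin n → Fin n'} → (∀ {i j} → h i ≡ h j → i ≡ j) → ∀ i j →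
  does (h i Fin.≟ h j) ≡ does (i Fin.≟ j)
≟-cong {h = h} inj i j with h i Fin.≟ h j | i Fin.≟ j
... | yes _ | yes _ = refl
... | no _  | no _  = refl
... | yes p | no ¬p = contradiction (inj p) ¬p
... | no ¬p | yes p = contradiction (cong h p) ¬p

colUsed-map : ∀ {n n'} {h : Fin n → Fin n'} → (∀ {i j} → h i ≡ h j → i ≡ j) → ∀ j (σ : Face m n) →
  colUsed (h j) (Vec.map (Maybe.map h) σ) ≡ colUsed j σ
colUsed-map inj j []            = refl
colUsed-map inj j (nothing ∷ σ) = colUsed-map inj j σ
colUsed-map inj j (just k ∷ σ)  = cong₂ _∨_ (≟-cong inj j k) (colUsed-map inj j σ)

colUsed-++ : ∀ j (σ : Face m₁ n) (τ : Face m₂ n) → colUsed j (σ ++ τ) ≡ colUsed j σ ∨ colUsed j τ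
colUsed-++ j []            τ = refl
colUsed-++ j (nothing ∷ σ) τ = colUsed-++ j σ τ
colUsed-++ j (just k ∷ σ)  τ = trans (cong (does (j Fin.≟ k) ∨_) (colUsed-++ j σ τ))
  (sym (Boolₚ.∨-assoc (does (j Fin.≟ k)) _ _))

colUsed-other : ∀ {n'} {h : Fin n → Fin n'} {j} → (∀ k → j ≢ h k) → (σ : Face m n) →
  colUsed j (Vec.map (Maybe.map h) σ) ≡ false
colUsed-other a []            = refl
colUsed-other a (nothing ∷ σ) = colUsed-other a σ
colUsed-other {h = h} {j} a (just k ∷ σ) with j Fin.≟ h k
... | yes p = contradiction p (a k)
... | no _  = colUsed-other a σ

NoRep-map : ∀ {n n'} {h : Fin n → Fin n'} → (∀ {i j} → h i ≡ h j → i ≡ j) → (σ : Face m n) →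
  NoRep σ → NoRep (Vec.map (Maybe.map h) σ)
NoRep-map inj []            r       = tt
NoRep-map inj (nothing ∷ σ) r       = NoRep-map inj σ r
NoRep-map inj (just j ∷ σ)  (u , r) = trans (colUsed-map inj j σ) u , NoRep-map inj σ r

↑ˡ≢↑ʳ : ∀ {n₁ n₂} (j : Fin n₁) (k : Fin n₂) → j ↑ˡ n₂ ≢ n₁ ↑ʳ k
↑ˡ≢↑ʳ {n₁} {n₂} j k e with trans (sym (Finₚ.splitAt-↑ˡ n₁ j n₂)) (trans (cong (splitAt n₁) e)
  (Finₚ.splitAt-↑ʳ n₁ n₂ k))
... | ()

NoRep-place : (σ₁ : Face m₁ n₁) (σ₂ : Face m₂ n₂) → NoRep σ₁ → NoRep σ₂ → NoRep (place σ₁ σ₂)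
NoRep-place {n₁ = n₁} [] σ₂ r₁ r₂ = NoRep-map (Finₚ.↑ʳ-injective n₁ _ _) σ₂ r₂
NoRep-place (nothing ∷ σ₁) σ₂ r₁ r₂ = NoRep-place σ₁ σ₂ r₁ r₂
NoRep-place {n₂ = n₂} (just j ∷ σ₁) σ₂ (u , r₁) r₂ =
  trans (colUsed-++ (j ↑ˡ n₂) (Vec.map (Maybe.map (_↑ˡ n₂)) σ₁) _)
    (cong₂ _∨_ (trans (colUsed-map (Finₚ.↑ˡ-injective n₂ _ _) j σ₁) u) (colUsed-other (↑ˡ≢↑ʳ j) σ₂))
      ,
  NoRep-place σ₁ σ₂ r₁ r₂

size-map : ∀ {n n'} (h : Fin n → Fin n') (σ : Face m n) → size (Vec.map (Maybe.map h) σ) ≡ size σ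
size-map h []            = refl
size-map h (nothing ∷ σ) = size-map h σ
size-map h (just _ ∷ σ)  = cong suc (size-map h σ)

size-place : (σ₁ : Face m₁ n₁) (σ₂ : Face m₂ n₂) → size (place σ₁ σ₂) ≡ size σ₁ + size σ₂
size-place []             σ₂ = size-map _ σ₂
size-place (nothing ∷ σ₁) σ₂ = size-place σ₁ σ₂
size-place (just _ ∷ σ₁)  σ₂ = cong suc (size-place σ₁ σ₂)

join-pure : ∀ {d₁ d₂} (A : Chain m₁ n₁) (B : Chain m₂ n₂) → Pure d₁ A → Pure d₂ B → Pure (d₁ + d₂)
  (join A B)
join-pure A B pA pB σ nz with join-nonzero A B σ nz
... | σ₁ , σ₂ , refl , nz₁ , nz₂ =
  NoRep-place σ₁ σ₂ (proj₁ (pA σ₁ nz₁)) (proj₁ (pB σ₂ nz₂)) ,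
  trans (size-place σ₁ σ₂) (cong₂ _+_ (proj₂ (pA σ₁ nz₁)) (proj₂ (pB σ₂ nz₂)))

-- The fundamental cycle of the chessboard pseudomanifold

module _ {A : Set} where

  data Pick : List A → A → List A → Set where
    here  : ∀ {c C} → Pick (c ∷ C) c C
    there : ∀ {c d C C'} → Pick C d C' → Pick (c ∷ C) d (c ∷ C')

  Pick-length : ∀ {C c C'} → Pick C c C' → length C ≡ suc (length C')
  Pick-length here      = refl
  Pick-length (there p) = cong suc (Pick-length p)

  Pick-∈ : ∀ {C c C' x} → Pick C c C' → x ∈ C' → x ∈ C
  Pick-∈ here      i         = there i
  Pick-∈ (there p) (here e)  = here e
  Pick-∈ (there p) (there i) = there (Pick-∈ p i)

  Pick-head : ∀ {C c C'} → Pick C c C' → c ∈ C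
  Pick-head here      = here refl
  Pick-head (there p) = there (Pick-head p)

  Pick-All : ∀ {Q : A → Set} {C c C'} → Pick C c C' → All Q C → Q c × All Q C'
  Pick-All here      (q ∷ qs) = q , qs
  Pick-All (there p) (q ∷ qs) = let (r , rs) = Pick-All p qs in r , q ∷ rs

  Pick-Unique : ∀ {C c C'} → Pick C c C' → Unique C → All (_≢ c) C' × Unique C'
  Pick-Unique here      (q ∷ u) = All.map ≢-sym q , u
  Pick-Unique (there p) (q ∷ u) =
    let (r , rs) = Pick-All p q ; (a , u') = Pick-Unique p u in r ∷ a , rs ∷ u'

  -- Laplace expansion, with alternating signs, along the entries of C.
  ∑± : List A → (A × List A → ℤ) → ℤ
  ∑± []      F = 0ℤ
  ∑± (c ∷ C) F = F (c , C) +ℤ - ∑± C (λ { (d , C') → F (d , c ∷ C') })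

  linear-∑± : ∀ C → Linear (∑± C)
  linear-∑± []      = linear-0
  linear-∑± (c ∷ C) = linear-+ (linear-eval (c , C))
    (linear-neg (linear-∘ (λ { (d , C') → d , c ∷ C' }) (linear-∑± C)))

  ∑±-cong : ∀ C {F G : A × List A → ℤ} → (∀ {c C'} → Pick C c C' → F (c , C') ≡ G (c , C')) →
    ∑± C F ≡ ∑± C G
  ∑±-cong []      h = refl
  ∑±-cong (c ∷ C) h = cong₂ (λ x y → x +ℤ - y) (h here) (∑±-cong C (λ p → h (there p)))

  ∑±-0 : ∀ C {F : A × List A → ℤ} → (∀ {c C'} → Pick C c C' → F (c , C') ≡ 0ℤ) → ∑± C F ≡ 0ℤ
  ∑±-0 C h = trans (∑±-cong C h) (vanish (linear-∑± C) (λ _ → refl))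

  ∑±-nonzero : ∀ C {F : A × List A → ℤ} → ∑± C F ≢ 0ℤ → ∃ λ c → ∃ λ C' → Pick C c C' ×
    F (c , C') ≢ 0ℤ
  ∑±-nonzero []      nz = contradiction refl nz
  ∑±-nonzero (c ∷ C) {F} nz with F (c , C) ℤ.≟ 0ℤ
  ... | no p  = c , C , here , p
  ... | yes p = let (d , C' , q , r) = ∑±-nonzero C (λ z → nz (cong₂ (λ x y → x +ℤ - y) p z)) in d ,
    c ∷ C' , there q , r

  -- Taking out two entries in the opposite order costs a sign, as when a determinant is expanded
  -- along two rows.
  ∑±-swap : ∀ C (F : A → A → List A → ℤ) →
    ∑± C (λ { (c , C') → ∑± C' (λ { (d , C'') → F c d C'' }) }) ≡
    - ∑± C (λ { (c , C') → ∑± C' (λ { (d , C'') → F d c C'' }) })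
  ∑±-swap []      F = refl
  ∑±-swap (c ∷ C) F = begin
    X +ℤ - ∑± C (λ { (d , C') → F d c C' +ℤ - ∑± C' (λ { (d' , C'') → F d d' (c ∷ C'') }) })
      ≡⟨ cong (λ t → X +ℤ - t) (expand F) ⟩
    X +ℤ - (Y +ℤ - Z)
      ≡⟨ cong (λ t → X +ℤ - (Y +ℤ - t)) (∑±-swap C (λ d d' C'' → F d d' (c ∷ C''))) ⟩
    X +ℤ - (Y +ℤ - - Z')
      ≡⟨ rearrange X Y Z' ⟩
    - (Y +ℤ - (X +ℤ - Z'))
      ≡⟨ cong (λ t → - (Y +ℤ - t)) (expand (λ a b → F b a)) ⟨
    - (Y +ℤ - ∑± C (λ { (d , C') → F c d C' +ℤ - ∑± C' (λ { (d' , C'') → F d' d (c ∷ C'') }) })) ∎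
    where
    open ≡-Reasoning
    X = ∑± C (λ { (d , C') → F c d C' })
    Y = ∑± C (λ { (d , C') → F d c C' })
    Z = ∑± C (λ { (d , C') → ∑± C' (λ { (d' , C'') → F d d' (c ∷ C'') }) })
    Z' = ∑± C (λ { (d , C') → ∑± C' (λ { (d' , C'') → F d' d (c ∷ C'') }) })
    expand : ∀ G → ∑± C (λ { (d , C') → G d c C' +ℤ - ∑± C' (λ { (d' , C'') → G d d' (c ∷ C'') }) })
      ≡
      ∑± C (λ { (d , C') → G d c C' }) +ℤ - ∑± C
        (λ { (d , C') → ∑± C' (λ { (d' , C'') → G d d' (c ∷ C'') }) })
    expand G = trans (plus (linear-∑± C) (λ { (d , C') → G d c C' })
      (λ { (d , C') → - ∑± C' (λ { (d' , C'') → G d d' (c ∷ C'') }) }))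
      (cong (∑± C (λ { (d , C') → G d c C' }) +ℤ_) (negate (linear-∑± C)
        (λ { (d , C') → ∑± C' (λ { (d' , C'') → G d d' (c ∷ C'') }) })))
    rearrange : ∀ x y z → x +ℤ - (y +ℤ - - z) ≡ - (y +ℤ - (x +ℤ - z))
    rearrange = ℤ-Solver.solve-∀

module _ {n : ℕ} where

  -- The fundamental cycle of the pseudomanifold M_{r,r+1} on the columns in C.
  γ : ∀ r → List (Fin n) → Chain r n
  γ zero    C []            = 1ℤ
  γ (suc r) C (nothing ∷ σ) = 0ℤ
  γ (suc r) C (just e ∷ σ)  = ∑± C λ { (c , C') → if does (e Fin.≟ c) then γ r C' σ else 0ℤ }

  -- This is the pseudomanifold property: a face with one row empty lies in two facets of opposite
  -- sign. By `∑±-swap` the columns used by `σ` are taken out first; in the end two columns remain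
  -- and contribute `1 - 1`.
  ∑±-γ : ∀ r C σ → length C ≡ 2 + r → ∑± C (λ { (c , C') → γ r C' σ }) ≡ 0ℤ
  ∑±-γ zero    (_ ∷ _ ∷ []) []            l = refl
  ∑±-γ (suc r) C            (nothing ∷ σ) l = vanish (linear-∑± C) (λ _ → refl)
  ∑±-γ (suc r) C            (just e ∷ σ)  l =
    trans (∑±-swap C (λ c d C'' → if does (e Fin.≟ d) then γ r C'' σ else 0ℤ))
      (cong -_ (∑±-0 C λ {c} {C'} p → inner (does (e Fin.≟ c)) C'
        (ℕₚ.suc-injective (trans (sym (Pick-length p)) l))))
    where
    inner : ∀ b C' → length C' ≡ 2 + r → ∑± C' (λ { (d , C'') → if b then γ r C'' σ else 0ℤ }) ≡ 0ℤ
    inner true  C' l' = ∑±-γ r C' σ l'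
    inner false C' l' = vanish (linear-∑± C') (λ _ → refl)

  ∑-delta : ∀ {n} (c : Fin n) x → ∑ n (λ e → if does (e Fin.≟ c) then x else 0ℤ) ≡ x
  ∑-delta {suc n} zero    x = trans (cong (x +ℤ_) (∑-ε n (λ _ → refl))) (ℤₚ.+-identityʳ x)
  ∑-delta {suc n} (suc c) x = trans (ℤₚ.+-identityˡ _)
    (trans (∑-cong n (λ e → cong (λ b → if b then x else 0ℤ)
    (≟-cong {h = suc} Finₚ.suc-injective e c))) (∑-delta c x))

  D-∑± : ∀ {r} {A : Set} (C : List A) (F : A × List A → Chain r n) σ →
    D (λ τ → ∑± C (λ x → F x τ)) σ ≡ ∑± C (λ x → D (F x) σ)
  D-∑± []      F σ = vanish (linear-D σ) (λ _ → refl)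
  D-∑± (c ∷ C) F σ = trans (plus (linear-D σ) (F (c , C)) _) (cong (D (F (c , C)) σ +ℤ_)
    (trans (negate (linear-D σ) _) (cong -_ (D-∑± C (λ { (d , C') → F (d , c ∷ C') }) σ))))

  D-γ : ∀ r C σ → length C ≡ suc r → D (γ r C) σ ≡ 0ℤ
  D-γ zero    C []            l = refl
  D-γ (suc r) C (nothing ∷ σ) l = trans (cong₂ _+ℤ_
    (trans (sym (total (linear-∑± C) n λ { e (c , C') → if does (e Fin.≟ c) then γ r C' σ else 0ℤ
      }))
      (trans (congruent (linear-∑± C) λ { (c , C') → ∑-delta c (γ r C' σ) }) (∑±-γ r C σ l)))
    (vanish (linear-D σ) (λ _ → refl))) refl
  D-γ (suc r) C (just e ∷ σ)  l = cong -_ (trans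
    (D-∑± C (λ { (c , C') τ → if does (e Fin.≟ c) then γ r C' τ else 0ℤ }) σ)
    (∑±-0 C λ {c} {C'} p → inner c C' (ℕₚ.suc-injective (trans (sym (Pick-length p)) l))))
    where
    inner : ∀ c C' → length C' ≡ suc r → D (λ τ → if does (e Fin.≟ c) then γ r C' τ else 0ℤ) σ ≡ 0ℤ
    inner c C' l' with does (e Fin.≟ c)
    ... | true  = D-γ r C' σ l'
    ... | false = vanish (linear-D σ) (λ _ → refl)

  γ-support : ∀ r C → Unique C → ∀ σ → γ r C σ ≢ 0ℤ →
    NoRep σ × size σ ≡ r × (∀ e → colUsed e σ ≡ true → e ∈ C)
  γ-support zero    C u []            nz = tt , refl , λ _ ()
  γ-support (suc r) C u (nothing ∷ σ) nz = contradiction refl nz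
  γ-support (suc r) C u (just e ∷ σ)  nz with ∑±-nonzero C nz
  ... | c , C' , p , nz' with e Fin.≟ c
  ...   | no _     = contradiction refl nz'
  ...   | yes refl =
    let (e∉C' , u') = Pick-Unique p u
        (r' , s , mem) = γ-support r C' u' σ nz'
    in (Boolₚ.¬-not (λ t → All.lookup e∉C' (mem e t) refl) , r') , cong suc s , λ d t → used d t mem
    where
    used : ∀ d → does (d Fin.≟ e) ∨ colUsed d σ ≡ true → (∀ e → colUsed e σ ≡ true → e ∈ C') → d ∈ C
    used d t mem with d Fin.≟ e
    ... | yes refl = Pick-head p
    ... | no _     = Pick-∈ p (mem d t)

-- The fundamental cycles of the 0-spheres M_{1,2} and M_{2,1}.
S₁₂ : Chain 1 2
S₁₂ (nothing ∷ [])         = 0ℤ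
S₁₂ (just zero ∷ [])       = 1ℤ
S₁₂ (just (suc zero) ∷ []) = - 1ℤ

S₂₁ : Chain 2 1
S₂₁ (just zero ∷ nothing ∷ []) = 1ℤ
S₂₁ (nothing ∷ just zero ∷ []) = - 1ℤ
S₂₁ _                          = 0ℤ

unit : Chain 0 n
unit [] = 1ℤ

D-S₁₂ : ∀ σ → D S₁₂ σ ≡ 0ℤ
D-S₁₂ (nothing ∷ [])         = refl
D-S₁₂ (just zero ∷ [])       = refl
D-S₁₂ (just (suc zero) ∷ []) = refl

D-S₂₁ : ∀ σ → D S₂₁ σ ≡ 0ℤ
D-S₂₁ (nothing ∷ nothing ∷ [])     = refl
D-S₂₁ (nothing ∷ just zero ∷ [])   = refl
D-S₂₁ (just zero ∷ nothing ∷ [])   = refl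
D-S₂₁ (just zero ∷ just zero ∷ []) = refl

S₁₂-pure : Pure 1 S₁₂
S₁₂-pure (nothing ∷ [])         nz = contradiction refl nz
S₁₂-pure (just zero ∷ [])       nz = (refl , tt) , refl
S₁₂-pure (just (suc zero) ∷ []) nz = (refl , tt) , refl

S₂₁-pure : Pure 1 S₂₁
S₂₁-pure (nothing ∷ nothing ∷ [])     nz = contradiction refl nz
S₂₁-pure (nothing ∷ just zero ∷ [])   nz = (refl , tt) , refl
S₂₁-pure (just zero ∷ nothing ∷ [])   nz = (refl , tt) , refl
S₂₁-pure (just zero ∷ just zero ∷ []) nz = contradiction refl nz

unit-pure : Pure 0 (unit {n})
unit-pure [] nz = tt , refl

D-unit : ∀ σ → D (unit {n}) σ ≡ 0ℤ
D-unit [] = refl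

join-cycle : (A : Chain m₁ n₁) (B : Chain m₂ n₂) → (∀ σ → D A σ ≡ 0ℤ) → (∀ σ → D B σ ≡ 0ℤ) →
  ∀ σ → D (join A B) σ ≡ 0ℤ
join-cycle A B hA hB σ = trans (D-join A B σ)
  (cong₂ _+ℤ_ (vanish (linear-joinˡ B σ) hA) (vanish (linear-joinʳ (alt A) σ) hB))

-- These follow the recursion of `spheres`, with `α` copies of `S₁₂` and `β` of `S₂₁`, so that the
-- joins typecheck without transport; the closed forms `rows≡` and `cols≡` enter only at the end.
rows cols : ℕ → ℕ → ℕ
rows zero    zero    = 0
rows zero    (suc β) = 2 + rows zero β
rows (suc α) β       = 1 + rows α β
cols zero    zero    = 0
cols zero    (suc β) = 1 + cols zero β
cols (suc α) β       = 2 + cols α β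

spheres : ∀ α β → Chain (rows α β) (cols α β)
spheres zero    zero    = unit
spheres zero    (suc β) = join S₂₁ (spheres zero β)
spheres (suc α) β       = join S₁₂ (spheres α β)

D-spheres : ∀ α β σ → D (spheres α β) σ ≡ 0ℤ
D-spheres zero    zero    = D-unit
D-spheres zero    (suc β) = join-cycle S₂₁ (spheres zero β) D-S₂₁ (D-spheres zero β)
D-spheres (suc α) β       = join-cycle S₁₂ (spheres α β) D-S₁₂ (D-spheres α β)

spheres-pure : ∀ α β → Pure (α + β) (spheres α β)
spheres-pure zero    zero    = unit-pure
spheres-pure zero    (suc β) = join-pure S₂₁ (spheres zero β) S₂₁-pure (spheres-pure zero β)
spheres-pure (suc α) β       = join-pure S₁₂ (spheres α β) S₁₂-pure (spheres-pure α β)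

-- The last column stays empty; it is needed for 3 T₅₅ to bound.
T₅₅ : Chain 5 5
T₅₅ = join S₁₂ (join S₂₁ (join S₂₁ (unit {1})))

T₅₅-pure : Pure 3 T₅₅
T₅₅-pure = join-pure S₁₂ (join S₂₁ (join S₂₁ unit)) S₁₂-pure
  (join-pure S₂₁ (join S₂₁ unit) S₂₁-pure (join-pure S₂₁ unit S₂₁-pure unit-pure))

D-T₅₅ : ∀ σ → D T₅₅ σ ≡ 0ℤ
D-T₅₅ = join-cycle S₁₂ (join S₂₁ (join S₂₁ unit)) D-S₁₂
  (join-cycle S₂₁ (join S₂₁ unit) D-S₂₁ (join-cycle S₂₁ unit D-S₂₁ D-unit))

-- Chains on M_{m,n} as sparse trees, so that the boundary of an explicit chain can be computed.
data Trie (n : ℕ) : ℕ → Set where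
  ∅    : ∀ {m} → Trie n m
  leaf : ℤ → Trie n 0
  node : ∀ {m} → Trie n m → Vec (Trie n m) n → Trie n (suc m)

⟦_⟧ : Trie n m → Chain m n
⟦ ∅ ⟧         σ             = 0ℤ
⟦ leaf a ⟧    []            = a
⟦ node t ts ⟧ (nothing ∷ σ) = ⟦ t ⟧ σ
⟦ node t ts ⟧ (just j ∷ σ)  = ⟦ lookup ts j ⟧ σ

infixl 6 _+ᵗ_
mutual
  _+ᵗ_ : Trie n m → Trie n m → Trie n m
  ∅         +ᵗ u         = u
  t         +ᵗ ∅         = t
  leaf a    +ᵗ leaf b    = leaf (a +ℤ b)
  node t ts +ᵗ node u us = node (t +ᵗ u) (ts +ᵗˢ us)

  _+ᵗˢ_ : ∀ {k} → Vec (Trie n m) k → Vec (Trie n m) k → Vec (Trie n m) k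
  []       +ᵗˢ []       = []
  (t ∷ ts) +ᵗˢ (u ∷ us) = (t +ᵗ u) ∷ (ts +ᵗˢ us)

mutual
  -ᵗ_ : Trie n m → Trie n m
  -ᵗ ∅         = ∅
  -ᵗ leaf a    = leaf (- a)
  -ᵗ node t ts = node (-ᵗ t) (-ᵗˢ ts)

  -ᵗˢ_ : ∀ {k} → Vec (Trie n m) k → Vec (Trie n m) k
  -ᵗˢ []       = []
  -ᵗˢ (t ∷ ts) = (-ᵗ t) ∷ (-ᵗˢ ts)

sumᵗ : ∀ {k} → Vec (Trie n m) k → Trie n m → Trie n m
sumᵗ []       u = u
sumᵗ (t ∷ ts) u = t +ᵗ sumᵗ ts u

mutual
  Dᵗ : Trie n m → Trie n m
  Dᵗ ∅           = ∅
  Dᵗ (leaf a)    = ∅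
  Dᵗ (node t ts) = node (sumᵗ ts (Dᵗ t)) (Dᵗˢ ts)

  Dᵗˢ : ∀ {k} → Vec (Trie n m) k → Vec (Trie n m) k
  Dᵗˢ []       = []
  Dᵗˢ (t ∷ ts) = (-ᵗ Dᵗ t) ∷ Dᵗˢ ts

mutual
  ⟦+ᵗ⟧ : ∀ (t u : Trie n m) σ → ⟦ t +ᵗ u ⟧ σ ≡ ⟦ t ⟧ σ +ℤ ⟦ u ⟧ σ
  ⟦+ᵗ⟧ ∅           u           σ             = sym (ℤₚ.+-identityˡ _)
  ⟦+ᵗ⟧ (leaf _)    ∅           σ             = sym (ℤₚ.+-identityʳ _)
  ⟦+ᵗ⟧ (node _ _)  ∅           σ             = sym (ℤₚ.+-identityʳ _)
  ⟦+ᵗ⟧ (leaf _)    (leaf _)    []            = refl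
  ⟦+ᵗ⟧ (node t ts) (node u us) (nothing ∷ σ) = ⟦+ᵗ⟧ t u σ
  ⟦+ᵗ⟧ (node t ts) (node u us) (just j ∷ σ)  = ⟦+ᵗˢ⟧ ts us j σ

  ⟦+ᵗˢ⟧ : ∀ {k} (ts us : Vec (Trie n m) k) j σ →
    ⟦ lookup (ts +ᵗˢ us) j ⟧ σ ≡ ⟦ lookup ts j ⟧ σ +ℤ ⟦ lookup us j ⟧ σ
  ⟦+ᵗˢ⟧ (t ∷ ts) (u ∷ us) zero    σ = ⟦+ᵗ⟧ t u σ
  ⟦+ᵗˢ⟧ (t ∷ ts) (u ∷ us) (suc j) σ = ⟦+ᵗˢ⟧ ts us j σ

mutual
  ⟦-ᵗ⟧ : ∀ (t : Trie n m) σ → ⟦ -ᵗ t ⟧ σ ≡ - ⟦ t ⟧ σ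
  ⟦-ᵗ⟧ ∅           σ             = refl
  ⟦-ᵗ⟧ (leaf _)    []            = refl
  ⟦-ᵗ⟧ (node t ts) (nothing ∷ σ) = ⟦-ᵗ⟧ t σ
  ⟦-ᵗ⟧ (node t ts) (just j ∷ σ)  = ⟦-ᵗˢ⟧ ts j σ

  ⟦-ᵗˢ⟧ : ∀ {k} (ts : Vec (Trie n m) k) j σ → ⟦ lookup (-ᵗˢ ts) j ⟧ σ ≡ - ⟦ lookup ts j ⟧ σ
  ⟦-ᵗˢ⟧ (t ∷ ts) zero    σ = ⟦-ᵗ⟧ t σ
  ⟦-ᵗˢ⟧ (t ∷ ts) (suc j) σ = ⟦-ᵗˢ⟧ ts j σ

⟦sumᵗ⟧ : ∀ {k} (ts : Vec (Trie n m) k) u σ →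
  ⟦ sumᵗ ts u ⟧ σ ≡ ∑ k (λ j → ⟦ lookup ts j ⟧ σ) +ℤ ⟦ u ⟧ σ
⟦sumᵗ⟧ []       u σ = sym (ℤₚ.+-identityˡ _)
⟦sumᵗ⟧ (t ∷ ts) u σ = trans (⟦+ᵗ⟧ t _ σ) (trans (cong (⟦ t ⟧ σ +ℤ_) (⟦sumᵗ⟧ ts u σ))
  (sym (ℤₚ.+-assoc (⟦ t ⟧ σ) _ _)))

mutual
  ⟦Dᵗ⟧ : ∀ (t : Trie n m) σ → ⟦ Dᵗ t ⟧ σ ≡ D ⟦ t ⟧ σ
  ⟦Dᵗ⟧ ∅           σ             = sym (vanish (linear-D σ) (λ _ → refl))
  ⟦Dᵗ⟧ (leaf _)    []            = refl
  ⟦Dᵗ⟧ (node t ts) (nothing ∷ σ) =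
    trans (⟦sumᵗ⟧ ts (Dᵗ t) σ) (cong (∑ _ (λ j → ⟦ lookup ts j ⟧ σ) +ℤ_) (⟦Dᵗ⟧ t σ))
  ⟦Dᵗ⟧ (node t ts) (just j ∷ σ)  = ⟦Dᵗˢ⟧ ts j σ

  ⟦Dᵗˢ⟧ : ∀ {k} (ts : Vec (Trie n m) k) j σ → ⟦ lookup (Dᵗˢ ts) j ⟧ σ ≡ - D ⟦ lookup ts j ⟧ σ
  ⟦Dᵗˢ⟧ (t ∷ ts) zero    σ = trans (⟦-ᵗ⟧ (Dᵗ t) σ) (cong -_ (⟦Dᵗ⟧ t σ))
  ⟦Dᵗˢ⟧ (t ∷ ts) (suc j) σ = ⟦Dᵗˢ⟧ ts j σ

all-faces? : ∀ {m n} {P : Face m n → Set} → (∀ σ → Dec (P σ)) → Dec (∀ σ → P σ)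
all-faces? {zero}  P? = map′ (λ { p [] → p }) (λ f → f []) (P? [])
all-faces? {suc m} P? = map′ (λ { (p , q) (nothing ∷ σ) → p σ ; (p , q) (just j ∷ σ) → q j σ })
  (λ f → (λ σ → f (nothing ∷ σ)) , λ j σ → f (just j ∷ σ))
  (all-faces? (λ σ → P? (nothing ∷ σ)) ×-dec Finₚ.all? (λ j → all-faces? (λ σ → P? (just j ∷ σ))))

-- The comparison descends along the trie and enumerates faces only below an empty node, where `c`
-- has to vanish.
agrees? : ∀ (t : Trie n m) (c : Chain m n) → Dec (∀ σ → ⟦ t ⟧ σ ≡ c σ)
agrees? ∅           c = all-faces? (λ σ → 0ℤ ℤ.≟ c σ)
agrees? (leaf a)    c = map′ (λ { p [] → p }) (λ f → f []) (a ℤ.≟ c [])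
agrees? {n} (node {m} t ts) c = map′ (λ { (p , q) (nothing ∷ σ) → p σ ; (p , q) (just j ∷ σ) →
  q j σ })
  (λ f → (λ σ → f (nothing ∷ σ)) , λ j σ → f (just j ∷ σ))
  (agrees? t (c ∘ (nothing ∷_)) ×-dec children? ts (λ j → c ∘ (just j ∷_)))
  where
  children? : ∀ {k} (ts : Vec (Trie n m) k) (c : Fin k → Chain m n) →
    Dec (∀ j σ → ⟦ lookup ts j ⟧ σ ≡ c j σ)
  children? []       c = yes λ ()
  children? (t ∷ ts) c = map′ (λ { (p , q) zero → p ; (p , q) (suc j) → q j }) (λ f → f zero ,
    f ∘ suc)
    (agrees? t (c zero) ×-dec children? ts (c ∘ suc))

supported? : ∀ (t : Trie n m) {P : Face m n → Set} → (∀ σ → Dec (P σ)) → Dec (∀ σ → ⟦ t ⟧ σ ≢ 0ℤ →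
  P σ)
supported? ∅           P? = yes λ σ nz → contradiction refl nz
supported? (leaf a)    P? with a ℤ.≟ 0ℤ | P? []
... | yes z | _     = yes λ { [] nz → contradiction z nz }
... | no nz | yes p = yes λ { [] _ → p }
... | no nz | no ¬p = no λ f → ¬p (f [] nz)
supported? {n} (node {m} t ts) P? = map′ (λ { (p , q) (nothing ∷ σ) → p σ ; (p , q) (just j ∷ σ) →
  q j σ })
  (λ f → (λ σ → f (nothing ∷ σ)) , λ j σ → f (just j ∷ σ))
  (supported? t (P? ∘ (nothing ∷_)) ×-dec children? ts (λ j → P? ∘ (just j ∷_)))
  where
  children? : ∀ {k} (ts : Vec (Trie n m) k) {P : Fin k → Face m n → Set} → (∀ j σ → Dec (P j σ)) →
    Dec (∀ j σ → ⟦ lookup ts j ⟧ σ ≢ 0ℤ → P j σ)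
  children? []       P? = yes λ ()
  children? (t ∷ ts) P? = map′ (λ { (p , q) zero → p ; (p , q) (suc j) → q j }) (λ f → f zero ,
    f ∘ suc)
    (supported? t (P? zero) ×-dec children? ts (P? ∘ suc))

single : Face m n → ℤ → Trie n m
single []            a = leaf a
single (nothing ∷ σ) a = node (single σ a) (Vec.replicate _ ∅)
single (just j ∷ σ)  a = node ∅ (Vec.replicate _ ∅ [ j ]≔ single σ a)

digit : ℕ → Maybe (Fin 5)
digit 1 = just zero
digit 2 = just (suc zero)
digit 3 = just (suc (suc zero))
digit 4 = just (suc (suc (suc zero)))
digit 5 = just (suc (suc (suc (suc zero))))
digit _ = nothing

face : ∀ m → ℕ → Face m 5
face zero    x = []
face (suc m) x = digit (x % 10) ∷ face m (x / 10)

-- An integral solution of D w = 3 T₅₅, found by computer. The face 45102 has row 0 in column 1 (last digit 2),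
-- row 1 empty, row 2 in column 0, and so on: the digits from the right are the columns plus one.
table : List (ℤ × List ℕ)
table =
  (1ℤ , 01245 ∷ 02154 ∷ 02345 ∷ 02451 ∷ 03124 ∷ 03145 ∷ 03241 ∷ 03421 ∷ 04152 ∷ 04351 ∷ 05134 ∷ 05342 ∷
     05431 ∷ 12054 ∷ 12450 ∷ 13024 ∷ 13420 ∷ 15034 ∷ 15430 ∷ 23041 ∷ 23140 ∷ 24051 ∷ 24150 ∷ 25031 ∷
     25130 ∷ 40352 ∷ 41032 ∷ 41230 ∷ 41305 ∷ 42051 ∷ 42105 ∷ 42150 ∷ 42301 ∷ 43021 ∷ 43120 ∷ 43205 ∷
     45102 ∷ 45301 ∷ 50142 ∷ 50231 ∷ 50341 ∷ 51240 ∷ 51302 ∷ 52031 ∷ 52130 ∷ 52340 ∷ []) ∷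
  (- 1ℤ , 01345 ∷ 02134 ∷ 02145 ∷ 02431 ∷ 03154 ∷ 03245 ∷ 03451 ∷ 04132 ∷ 04352 ∷ 05124 ∷ 05142 ∷ 05341 ∷
     05421 ∷ 12034 ∷ 12430 ∷ 13054 ∷ 13450 ∷ 15024 ∷ 15420 ∷ 23051 ∷ 23150 ∷ 24031 ∷ 24130 ∷ 25041 ∷
     25140 ∷ 40152 ∷ 40231 ∷ 40351 ∷ 41205 ∷ 41302 ∷ 42305 ∷ 43105 ∷ 43201 ∷ 45021 ∷ 45120 ∷ 45302 ∷
     50132 ∷ 50241 ∷ 50342 ∷ 51032 ∷ 51230 ∷ 51340 ∷ 52140 ∷ 52301 ∷ []) ∷
  (- ℤ.+ 2 , 42031 ∷ 42130 ∷ 54031 ∷ 54302 ∷ []) ∷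
  (ℤ.+ 2 , 40132 ∷ 54032 ∷ 54301 ∷ []) ∷ []

w₅₅ᵗ : Trie 5 5
w₅₅ᵗ = List.foldr (λ { (a , xs) t → List.foldr (λ x t → single (face 5 x) a +ᵗ t) t xs }) ∅ table

w₅₅ : Chain 5 5
w₅₅ = ⟦ w₅₅ᵗ ⟧

D-w₅₅ : ∀ σ → D w₅₅ σ ≡ ℤ.+ 3 *ℤ T₅₅ σ
D-w₅₅ σ = trans (sym (⟦Dᵗ⟧ w₅₅ᵗ σ)) (toWitness {a? = agrees? (Dᵗ w₅₅ᵗ) (λ σ → ℤ.+ 3 *ℤ T₅₅ σ)} tt σ)

w₅₅-pure : Pure 4 w₅₅
w₅₅-pure = toWitness {a? = supported? w₅₅ᵗ (λ σ → noRep? σ ×-dec (size σ ℕ.≟ 4))} tt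

-- The pairing of cochains with chains

mod₃ℕ : ℕ → 𝔽₃
mod₃ℕ zero    = 𝟎
mod₃ℕ (suc k) = 𝟏 ⊕ mod₃ℕ k

mod₃ : ℤ → 𝔽₃
mod₃ (ℤ.+ k)    = mod₃ℕ k
mod₃ ℤ.-[1+ k ] = ⊖ mod₃ℕ (suc k)

mod₃ℕ-+ : ∀ j k → mod₃ℕ (j + k) ≡ mod₃ℕ j ⊕ mod₃ℕ k
mod₃ℕ-+ zero    k = refl
mod₃ℕ-+ (suc j) k = trans (cong (𝟏 ⊕_) (mod₃ℕ-+ j k)) (sym (⊕-assoc 𝟏 (mod₃ℕ j) (mod₃ℕ k)))

mod₃-⊖ : ∀ j k → mod₃ (j ℤ.⊖ k) ≡ mod₃ℕ j ⊝ mod₃ℕ k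
mod₃-⊖ zero    zero    = refl
mod₃-⊖ zero    (suc k) = refl
mod₃-⊖ (suc j) zero    = by₁ {λ x → x} {λ x → x ⊕ 𝟎} tt (mod₃ℕ (suc j))
mod₃-⊖ (suc j) (suc k) = trans (cong mod₃ (ℤₚ.[1+m]⊖[1+n]≡m⊖n j k)) (trans (mod₃-⊖ j k)
  (by₂ {λ x y → x ⊝ y} {λ x y → 𝟏 ⊕ x ⊝ (𝟏 ⊕ y)} tt (mod₃ℕ j) (mod₃ℕ k)))

mod₃-+ : ∀ x y → mod₃ (x +ℤ y) ≡ mod₃ x ⊕ mod₃ y
mod₃-+ (ℤ.+ j)    (ℤ.+ k)    = mod₃ℕ-+ j k
mod₃-+ (ℤ.+ j)    ℤ.-[1+ k ] = mod₃-⊖ j (suc k)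
mod₃-+ ℤ.-[1+ j ] (ℤ.+ k)    = trans (mod₃-⊖ k (suc j)) (by₂ {λ x y → x ⊝ y} {λ x y → ⊖ y ⊕ x} tt
  (mod₃ℕ k) (mod₃ℕ (suc j)))
mod₃-+ ℤ.-[1+ j ] ℤ.-[1+ k ] = trans (cong (λ x → ⊖ (𝟏 ⊕ (𝟏 ⊕ x))) (mod₃ℕ-+ j k))
  (by₂ {λ x y → ⊖ (𝟏 ⊕ (𝟏 ⊕ (x ⊕ y)))} {λ x y → ⊖ (𝟏 ⊕ x) ⊕ ⊖ (𝟏 ⊕ y)} tt (mod₃ℕ j) (mod₃ℕ k))

mod₃-neg : ∀ x → mod₃ (- x) ≡ ⊖ mod₃ x
mod₃-neg (ℤ.+ zero)  = refl
mod₃-neg (ℤ.+ suc k) = refl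
mod₃-neg ℤ.-[1+ k ]  = sym (⊖-involutive (mod₃ℕ (suc k)))

mod₃-* : ∀ x y → mod₃ (x *ℤ y) ≡ mod₃ x ⊗ mod₃ y
mod₃-* (ℤ.+ j)    y = pos j
  where
  pos : ∀ j → mod₃ (ℤ.+ j *ℤ y) ≡ mod₃ℕ j ⊗ mod₃ y
  pos zero    = refl
  pos (suc j) = trans (cong mod₃ (ℤₚ.suc-* (ℤ.+ j) y)) (trans (mod₃-+ y (ℤ.+ j *ℤ y))
    (trans (cong (mod₃ y ⊕_) (pos j))
    (by₂ {λ x y → y ⊕ x ⊗ y} {λ x y → (𝟏 ⊕ x) ⊗ y} tt (mod₃ℕ j) (mod₃ y))))
mod₃-* ℤ.-[1+ j ] y = trans (cong mod₃ (sym (ℤₚ.neg-distribˡ-* (ℤ.+ suc j) y)))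
  (trans (mod₃-neg (ℤ.+ suc j *ℤ y)) (trans (cong ⊖_ (mod₃-* (ℤ.+ suc j) y))
    (by₂ {λ x y → ⊖ (x ⊗ y)} {λ x y → ⊖ x ⊗ y} tt (mod₃ℕ (suc j)) (mod₃ y))))

mod₃-∑ : ∀ k f → mod₃ (∑ k f) ≡ ∑₃ k (mod₃ ∘ f)
mod₃-∑ zero    f = refl
mod₃-∑ (suc k) f = trans (mod₃-+ (f zero) _) (cong (mod₃ (f zero) ⊕_) (mod₃-∑ k (f ∘ suc)))

Σ-face : (Face m n → 𝔽₃) → 𝔽₃
Σ-face {zero}      φ = φ []
Σ-face {suc m} {n} φ = Σ-face (φ ∘ (nothing ∷_)) ⊕ ∑₃ n (λ j → Σ-face (φ ∘ (just j ∷_)))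

Σ-face-cong : {φ ψ : Face m n → 𝔽₃} → (∀ σ → φ σ ≡ ψ σ) → Σ-face φ ≡ Σ-face ψ
Σ-face-cong {zero}      h = h []
Σ-face-cong {suc m} {n} h = cong₂ _⊕_ (Σ-face-cong (h ∘ (nothing ∷_))) (∑₃-cong n λ j →
  Σ-face-cong (h ∘ (just j ∷_)))

Σ-face-⊕ : ∀ (φ ψ : Face m n → 𝔽₃) → Σ-face (λ σ → φ σ ⊕ ψ σ) ≡ Σ-face φ ⊕ Σ-face ψ
Σ-face-⊕ {zero}      φ ψ = refl
Σ-face-⊕ {suc m} {n} φ ψ = trans (cong₂ _⊕_ (Σ-face-⊕ (φ ∘ (nothing ∷_)) (ψ ∘ (nothing ∷_)))
    (trans (∑₃-cong n λ j → Σ-face-⊕ (φ ∘ (just j ∷_)) (ψ ∘ (just j ∷_)))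
      (∑₃-⊕ n (λ j → Σ-face (φ ∘ (just j ∷_))) (λ j → Σ-face (ψ ∘ (just j ∷_))))))
  (⊕-interchange (Σ-face (φ ∘ (nothing ∷_))) _ _ _)

Σ-face-⊗ : ∀ s (φ : Face m n → 𝔽₃) → Σ-face (λ σ → s ⊗ φ σ) ≡ s ⊗ Σ-face φ
Σ-face-⊗ {zero}      s φ = refl
Σ-face-⊗ {suc m} {n} s φ = trans (cong₂ _⊕_ (Σ-face-⊗ s (φ ∘ (nothing ∷_)))
    (trans (∑₃-cong n λ j → Σ-face-⊗ s (φ ∘ (just j ∷_)))
      (sym (∑₃-hom n (s ⊗_) (⊗-zeroʳ s) (⊗-distribˡ s) _))))
  (sym (⊗-distribˡ s (Σ-face (φ ∘ (nothing ∷_))) _))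

Σ-face-𝟎 : {φ : Face m n → 𝔽₃} → (∀ σ → φ σ ≡ 𝟎) → Σ-face φ ≡ 𝟎
Σ-face-𝟎 {φ = φ} h = trans (Σ-face-cong h) (Σ-face-⊗ 𝟎 φ)

Σ-face-∑₃ : ∀ k (φ : Fin k → Face m n → 𝔽₃) → Σ-face (λ σ → ∑₃ k (λ j → φ j σ)) ≡
  ∑₃ k (λ j → Σ-face (φ j))
Σ-face-∑₃ {m} {n} zero    φ = Σ-face-𝟎 {m} {n} (λ _ → refl)
Σ-face-∑₃ (suc k) φ = trans (Σ-face-⊕ (φ zero) _) (cong (Σ-face (φ zero) ⊕_)
  (Σ-face-∑₃ k (φ ∘ suc)))

edges : Vec ℕ m → Vec ℕ n → Face m n → List Edge
edges []      κ []            = []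
edges (r ∷ ρ) κ (nothing ∷ σ) = edges ρ κ σ
edges (r ∷ ρ) κ (just j ∷ σ)  = (r , lookup κ j) ∷ edges ρ κ σ

-- Labelling rows and columns by vertices of the complete graph lets one cochain be evaluated on
-- chessboard complexes of any shape.
pair : Vec ℕ m → Vec ℕ n → Cochain → Chain m n → 𝔽₃
pair ρ κ f c = Σ-face (λ σ → mod₃ (c σ) ⊗ f (edges ρ κ σ))

-- `D` and `δ` are adjoint over all partial maps. In the induction on rows, the sum over columns in
-- `D` matches the term `f σ` of `δ`, and the sign of `D` on an occupied row matches the minus sign
-- in `δ`.
pair-D : ∀ (ρ : Vec ℕ m) (κ : Vec ℕ n) f c → pair ρ κ f (D c) ≡ pair ρ κ (δ f) c
pair-D []      κ f c = sym (⊗-zeroʳ (mod₃ (c [])))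
pair-D {suc m} {n} (r ∷ ρ) κ f c = begin
  Σ-face (λ σ → mod₃ (∑ n (λ j → cⱼ j σ) +ℤ D c₀ σ) ⊗ f (es σ)) ⊕
  ∑₃ n (λ j → Σ-face (λ σ → mod₃ (- D (cⱼ j) σ) ⊗ fⱼ j (es σ)))
    ≡⟨ cong₂ _⊕_ (trans (Σ-face-cong {m} {n} λ σ → expand σ) (trans (Σ-face-⊕ {m} {n} _ _)
      (cong₂ _⊕_ (Σ-face-∑₃ {m} {n} n _) (pair-D ρ κ f c₀))))
         (∑₃-cong n λ j → trans (Σ-face-cong {m} {n} λ σ →
           trans (cong (_⊗ fⱼ j (es σ)) (mod₃-neg (D (cⱼ j) σ))) (⊖-⊗ (mod₃ (D (cⱼ j) σ))
           (fⱼ j (es σ))))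
           (trans (Σ-face-⊗ {m} {n} 𝟐 _) (cong ⊖_ (pair-D ρ κ (fⱼ j) (cⱼ j))))) ⟩
  (∑₃ n (λ j → pair ρ κ f (cⱼ j)) ⊕ pair ρ κ (δ f) c₀) ⊕ ∑₃ n (λ j → ⊖ pair ρ κ (δ (fⱼ j)) (cⱼ j))
    ≡⟨ by₃ {λ x y z → (x ⊕ y) ⊕ z} {λ x y z → y ⊕ (x ⊕ z)} tt (∑₃ n (λ j → pair ρ κ f (cⱼ j)))
      (pair ρ κ (δ f) c₀) _ ⟩
  pair ρ κ (δ f) c₀ ⊕ (∑₃ n (λ j → pair ρ κ f (cⱼ j)) ⊕ ∑₃ n (λ j → ⊖ pair ρ κ (δ (fⱼ j)) (cⱼ j)))
    ≡⟨ cong (pair ρ κ (δ f) c₀ ⊕_) (trans (sym (∑₃-⊕ n (λ j → pair ρ κ f (cⱼ j)) _))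
      (∑₃-cong n λ j →
         trans (cong (pair ρ κ f (cⱼ j) ⊕_) (sym (Σ-face-⊗ {m} {n} 𝟐 _)))
           (trans (sym (Σ-face-⊕ {m} {n} _ _))
           (Σ-face-cong {m} {n} λ σ → sym (⊗-distribˡ-⊝ (mod₃ (cⱼ j σ)) (f (es σ))
             (δ (fⱼ j) (es σ))))))) ⟩
  pair ρ κ (δ f) c₀ ⊕ ∑₃ n (λ j → Σ-face (λ σ → mod₃ (cⱼ j σ) ⊗ (f (es σ) ⊝ δ (fⱼ j) (es σ)))) ∎
  where
  open ≡-Reasoning
  es = edges ρ κ
  c₀ = c ∘ (nothing ∷_)
  cⱼ = λ j → c ∘ (just j ∷_)
  fⱼ = λ j → ι (r , lookup κ j) f
  ⊖-⊗ : ∀ x y → ⊖ x ⊗ y ≡ 𝟐 ⊗ (x ⊗ y)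
  ⊖-⊗ = by₂ tt
  ⊗-comm : ∀ x y → x ⊗ y ≡ y ⊗ x
  ⊗-comm = by₂ tt
  expand : ∀ σ → mod₃ (∑ n (λ j → cⱼ j σ) +ℤ D c₀ σ) ⊗ f (es σ) ≡
    ∑₃ n (λ j → mod₃ (cⱼ j σ) ⊗ f (es σ)) ⊕ mod₃ (D c₀ σ) ⊗ f (es σ)
  expand σ = begin
    mod₃ (∑ n (λ j → cⱼ j σ) +ℤ D c₀ σ) ⊗ f (es σ)
      ≡⟨ cong (_⊗ f (es σ)) (trans (mod₃-+ (∑ n (λ j → cⱼ j σ)) _) (cong (_⊕ mod₃ (D c₀ σ))
        (mod₃-∑ n _))) ⟩
    (∑₃ n (λ j → mod₃ (cⱼ j σ)) ⊕ mod₃ (D c₀ σ)) ⊗ f (es σ)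
      ≡⟨ by₃ {λ x y z → (x ⊕ y) ⊗ z} {λ x y z → z ⊗ x ⊕ y ⊗ z} tt (∑₃ n (λ j → mod₃ (cⱼ j σ)))
        (mod₃ (D c₀ σ)) (f (es σ)) ⟩
    f (es σ) ⊗ ∑₃ n (λ j → mod₃ (cⱼ j σ)) ⊕ mod₃ (D c₀ σ) ⊗ f (es σ)
      ≡⟨ cong (_⊕ mod₃ (D c₀ σ) ⊗ f (es σ)) (trans (∑₃-hom n (f (es σ) ⊗_) (⊗-zeroʳ (f (es σ)))
        (⊗-distribˡ (f (es σ))) _)
           (∑₃-cong n λ j → ⊗-comm (f (es σ)) (mod₃ (cⱼ j σ)))) ⟩
    ∑₃ n (λ j → mod₃ (cⱼ j σ) ⊗ f (es σ)) ⊕ mod₃ (D c₀ σ) ⊗ f (es σ) ∎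

pair-right : ∀ {n₁} (ρ : Vec ℕ m) (κ₁ : Vec ℕ n₁) (κ₂ : Vec ℕ n₂) f (B : Chain m n₂) →
  pair ρ (κ₁ ++ κ₂) f (right n₁ B) ≡ pair ρ κ₂ f B
pair-right []      κ₁ κ₂ f B = refl
pair-right {suc m} {n₂} {n₁} (r ∷ ρ) κ₁ κ₂ f B = cong₂ _⊕_ (pair-right ρ κ₁ κ₂ f (B ∘ (nothing ∷_)))
  (trans (∑₃-split n₁ n₂ _) (trans (cong₂ _⊕_ (∑₃-ε n₁ left0) (∑₃-cong n₂ right1)) refl))
  where
  left0 : ∀ j → pair ρ (κ₁ ++ κ₂) (ι (r , lookup (κ₁ ++ κ₂) (j ↑ˡ n₂)) f) (λ σ →
    right n₁ B (just (j ↑ˡ n₂) ∷ σ)) ≡ 𝟎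
  left0 j rewrite Finₚ.splitAt-↑ˡ n₁ j n₂ = Σ-face-𝟎 {m} {n₁ + n₂} (λ _ → refl)
  right1 : ∀ k → pair ρ (κ₁ ++ κ₂) (ι (r , lookup (κ₁ ++ κ₂) (n₁ ↑ʳ k)) f) (λ σ →
    right n₁ B (just (n₁ ↑ʳ k) ∷ σ)) ≡
    pair ρ κ₂ (ι (r , lookup κ₂ k) f) (B ∘ (just k ∷_))
  right1 k rewrite Finₚ.splitAt-↑ʳ n₁ n₂ k | Vecₚ.lookup-++ʳ κ₁ κ₂ k =
    pair-right ρ κ₁ κ₂ (ι (r , lookup κ₂ k) f) (B ∘ (just k ∷_))

-- The edges of the first factor precede those of the second in the list, so the sum over
-- block-diagonal faces is an iterated sum.
pair-join : ∀ (ρ₁ : Vec ℕ m₁) (κ₁ : Vec ℕ n₁) (ρ₂ : Vec ℕ m₂) (κ₂ : Vec ℕ n₂) f A B →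
  pair (ρ₁ ++ ρ₂) (κ₁ ++ κ₂) f (join A B) ≡ pair ρ₁ κ₁ (λ τ → pair ρ₂ κ₂ (λ τ' → f (τ List.++ τ'))
    B) A
pair-join {zero} {n₁} {m₂} {n₂} [] κ₁ ρ₂ κ₂ f A B = trans (Σ-face-cong {m₂} {n₁ + n₂} λ σ →
  trans (cong (_⊗ f (edges ρ₂ (κ₁ ++ κ₂) σ)) (mod₃-* (A []) (right n₁ B σ))) (⊗-assoc (mod₃ (A []))
  (mod₃ (right n₁ B σ)) (f (edges ρ₂ (κ₁ ++ κ₂) σ))))
  (trans (Σ-face-⊗ {m₂} {n₁ + n₂} (mod₃ (A [])) (λ σ → mod₃ (right n₁ B σ) ⊗ f (edges ρ₂ (κ₁ ++ κ₂)
    σ))) (cong (mod₃ (A []) ⊗_) (pair-right ρ₂ κ₁ κ₂ f B)))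
  where
  ⊗-assoc : ∀ x y z → (x ⊗ y) ⊗ z ≡ x ⊗ (y ⊗ z)
  ⊗-assoc = by₃ tt
pair-join {suc m₁} {n₁} {m₂} {n₂} (r ∷ ρ₁) κ₁ ρ₂ κ₂ f A B =
  cong₂ _⊕_ (pair-join ρ₁ κ₁ ρ₂ κ₂ f (A ∘ (nothing ∷_)) B)
  (trans (∑₃-split n₁ n₂ _) (trans (cong₂ _⊕_ (∑₃-cong n₁ left1) (∑₃-ε n₂ right0))
    (by₁ {λ x → x ⊕ 𝟎} {λ x → x} tt _)))
  where
  right0 : ∀ k → pair (ρ₁ ++ ρ₂) (κ₁ ++ κ₂) (ι (r , lookup (κ₁ ++ κ₂) (n₁ ↑ʳ k)) f) (λ σ →
    join A B (just (n₁ ↑ʳ k) ∷ σ)) ≡ 𝟎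
  right0 k rewrite Finₚ.splitAt-↑ʳ n₁ n₂ k = Σ-face-𝟎 {m₁ + m₂} {n₁ + n₂} (λ _ → refl)
  left1 : ∀ k → pair (ρ₁ ++ ρ₂) (κ₁ ++ κ₂) (ι (r , lookup (κ₁ ++ κ₂) (k ↑ˡ n₂)) f) (λ σ →
    join A B (just (k ↑ˡ n₂) ∷ σ)) ≡
    pair ρ₁ κ₁ (λ τ → pair ρ₂ κ₂ (λ τ' → f ((r , lookup κ₁ k) ∷ (τ List.++ τ'))) B)
      (A ∘ (just k ∷_))
  left1 k rewrite Finₚ.splitAt-↑ˡ n₁ k n₂ | Vecₚ.lookup-++ˡ κ₁ κ₂ k =
    pair-join ρ₁ κ₁ ρ₂ κ₂ (ι (r , lookup κ₁ k) f) (A ∘ (just k ∷_)) B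

-- Rows and columns as vertices of the complete graph

record Labelled (P : ℕ → Set) (ρ : Vec ℕ m) (κ : Vec ℕ n) : Set where
  field
    rowP   : ∀ i → P (lookup ρ i)
    colP   : ∀ j → P (lookup κ j)
    rowInj : ∀ i i' → lookup ρ i ≡ lookup ρ i' → i ≡ i'
    colInj : ∀ j j' → lookup κ j ≡ lookup κ j' → j ≡ j'
    apart  : ∀ i j → lookup ρ i ≢ lookup κ j

open Labelled

Labelled-mono : ∀ {ρ : Vec ℕ m} {κ : Vec ℕ n} → P ⊆ Q → Labelled P ρ κ → Labelled Q ρ κ
Labelled-mono i L = record { rowP = λ j → i _ (rowP L j) ; colP = λ j → i _ (colP L j)
  ; rowInj = rowInj L ; colInj = colInj L ; apart = apart L }

-- Membership in `P` is asked only of the columns in use, because passing to the next row removes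
-- the current row and column from `P`.
edges-match : ∀ {P} (ρ : Vec ℕ m) (κ : Vec ℕ n) σ → (∀ i → P (lookup ρ i)) →
  (∀ i i' → lookup ρ i ≡ lookup ρ i' → i ≡ i') → (∀ j j' → lookup κ j ≡ lookup κ j' → j ≡ j') →
  (∀ i j → lookup ρ i ≢ lookup κ j) → (∀ j → colUsed j σ ≡ true → P (lookup κ j)) → NoRep σ →
  Match P (edges ρ κ σ)
edges-match []      κ []            rp ri ci ap cp nr = tt
edges-match (r ∷ ρ) κ (nothing ∷ σ) rp ri ci ap cp nr =
  edges-match ρ κ σ (rp ∘ suc) (λ i i' e → Finₚ.suc-injective (ri (suc i) (suc i') e)) ci (ap ∘ suc)
    cp nr
edges-match (r ∷ ρ) κ (just j ∷ σ)  rp ri ci ap cp (u , nr) = rp zero , cp j used , ap zero j ,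
  edges-match ρ κ σ (λ i → (rp (suc i) , λ e → Finₚ.0≢1+n (sym (ri (suc i) zero e))) , ap (suc i) j)
    (λ i i' e → Finₚ.suc-injective (ri (suc i) (suc i') e)) ci (ap ∘ suc)
    (λ j' t → (cp j' (trans (cong (does (j' Fin.≟ j) ∨_) t) (Boolₚ.∨-zeroʳ _)) ,
      ≢-sym (ap zero j')) ,
      λ e → contradiction (trans (sym u) (subst (λ j → colUsed j σ ≡ true) (ci j' j e) t)) λ ())
    nr
  where
  used : does (j Fin.≟ j) ∨ colUsed j σ ≡ true
  used with j Fin.≟ j
  ... | yes _ = refl
  ... | no ¬p = contradiction refl ¬p

labelled-match : ∀ {ρ : Vec ℕ m} {κ : Vec ℕ n} → Labelled P ρ κ → ∀ σ → NoRep σ →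
  Match P (edges ρ κ σ)
labelled-match {ρ = ρ} {κ} L σ = edges-match ρ κ σ (rowP L) (rowInj L) (colInj L) (apart L) (λ j _ →
  colP L j)

data Side (m₁ : ℕ) {m₂ : ℕ} : Fin (m₁ + m₂) → Set where
  onˡ : ∀ i → Side m₁ (i ↑ˡ m₂)
  onʳ : ∀ i → Side m₁ (m₁ ↑ʳ i)

side : ∀ m₁ {m₂} (i : Fin (m₁ + m₂)) → Side m₁ i
side zero     i       = onʳ i
side (suc m₁) zero    = onˡ zero
side (suc m₁) (suc i) with side m₁ i
... | onˡ j = onˡ (suc j)
... | onʳ j = onʳ j

module _ {A : Set} (xs : Vec A m₁) (ys : Vec A m₂) where

  lookup-all : ∀ {P : A → Set} → (∀ i → P (lookup xs i)) → (∀ i → P (lookup ys i)) → ∀ i →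
    P (lookup (xs ++ ys) i)
  lookup-all {P} p q i with side m₁ i
  ... | onˡ j = subst P (sym (Vecₚ.lookup-++ˡ xs ys j)) (p j)
  ... | onʳ j = subst P (sym (Vecₚ.lookup-++ʳ xs ys j)) (q j)

  lookup-inj : (∀ i i' → lookup xs i ≡ lookup xs i' → i ≡ i') → (∀ i i' → lookup ys i ≡
    lookup ys i' → i ≡ i') →
    (∀ i i' → lookup xs i ≢ lookup ys i') → ∀ i i' → lookup (xs ++ ys) i ≡ lookup (xs ++ ys) i' →
      i ≡ i'
  lookup-inj p q a i i' e with side m₁ i | side m₁ i'
  ... | onˡ j | onˡ j' = cong (_↑ˡ m₂) (p j j' (trans (sym (Vecₚ.lookup-++ˡ xs ys j))
    (trans e (Vecₚ.lookup-++ˡ xs ys j'))))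
  ... | onˡ j | onʳ j' = contradiction (trans (sym (Vecₚ.lookup-++ˡ xs ys j))
    (trans e (Vecₚ.lookup-++ʳ xs ys j'))) (a j j')
  ... | onʳ j | onˡ j' = contradiction (trans (sym (Vecₚ.lookup-++ˡ xs ys j'))
    (trans (sym e) (Vecₚ.lookup-++ʳ xs ys j))) (a j' j)
  ... | onʳ j | onʳ j' = cong (m₁ ↑ʳ_) (q j j' (trans (sym (Vecₚ.lookup-++ʳ xs ys j))
    (trans e (Vecₚ.lookup-++ʳ xs ys j'))))

Labelled-++ : ∀ {ρ₁ : Vec ℕ m₁} {κ₁ : Vec ℕ n₁} {ρ₂ : Vec ℕ m₂} {κ₂ : Vec ℕ n₂} →
  (∀ x → P x → Q x → ⊥) →
  Labelled P ρ₁ κ₁ → Labelled Q ρ₂ κ₂ → Labelled (λ x → P x ⊎ Q x) (ρ₁ ++ ρ₂) (κ₁ ++ κ₂)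
Labelled-++ {P = P} {Q = Q} {ρ₁} {κ₁} {ρ₂} {κ₂} dis L M = record
  { rowP = lookup-all ρ₁ ρ₂ {P = λ x → P x ⊎ Q x} (inj₁ ∘ rowP L) (inj₂ ∘ rowP M)
  ; colP = lookup-all κ₁ κ₂ {P = λ x → P x ⊎ Q x} (inj₁ ∘ colP L) (inj₂ ∘ colP M)
  ; rowInj = lookup-inj ρ₁ ρ₂ (rowInj L) (rowInj M) (λ i i' → separate (rowP L i) (rowP M i'))
  ; colInj = lookup-inj κ₁ κ₂ (colInj L) (colInj M) (λ i i' → separate (colP L i) (colP M i'))
  ; apart = λ i j → lookup-all ρ₁ ρ₂ {P = λ x → x ≢ lookup (κ₁ ++ κ₂) j}
      (λ i → lookup-all κ₁ κ₂ {P = λ y → lookup ρ₁ i ≢ y} (apart L i) (λ j → separate (rowP L i)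
        (colP M j)) j)
      (λ i → lookup-all κ₁ κ₂ {P = λ y → lookup ρ₂ i ≢ y} (λ j →
        ≢-sym (separate (colP L j) (rowP M i))) (apart M i) j) i }
  where
  separate : ∀ {x y} → P x → Q y → x ≢ y
  separate p q refl = dis _ p q

module Labels (K : ℕ) where
  open Block (tower K) public using (β; β-injective; φ⁺-inner; Match-inner)

  -- The three vertices of a 0-sphere form one block of the tower. They are distributed so that the
  -- coefficients of its two edges in `φ⁺-inner` differ by one: `𝟐 - 𝟏` for `S₁₂` and `𝟏 - 𝟎` for
  -- `S₂₁`.
  ρ₁₂ : Vec ℕ 1
  ρ₁₂ = top K ∷ []
  κ₁₂ : Vec ℕ 2
  κ₁₂ = 1 + top K ∷ 2 + top K ∷ []
  ρ₂₁ : Vec ℕ 2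
  ρ₂₁ = top K ∷ 1 + top K ∷ []
  κ₂₁ : Vec ℕ 1
  κ₂₁ = 2 + top K ∷ []

  Between : ℕ → Set
  Between x = top K ≤ x × x < top (suc K)

  between : ∀ i → Between (β i)
  between 𝟎 = ℕₚ.≤-refl , ℕₚ.m<n⇒m<1+n (ℕₚ.m<n⇒m<1+n (ℕₚ.n<1+n _))
  between 𝟏 = ℕₚ.n≤1+n _ , ℕₚ.m<n⇒m<1+n (ℕₚ.n<1+n _)
  between 𝟐 = ℕₚ.≤-trans (ℕₚ.n≤1+n _) (ℕₚ.n≤1+n _) , ℕₚ.n<1+n _

  labelled₁₂ : Labelled Between ρ₁₂ κ₁₂
  labelled₁₂ = record
    { rowP = λ { zero → between 𝟎 } ; colP = λ { zero → between 𝟏 ; (suc zero) → between 𝟐 }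
    ; rowInj = λ { zero zero _ → refl }
    ; colInj = λ { zero zero _ → refl ; zero (suc zero) e → contradiction e (β-injective 𝟏 𝟐 λ ())
                 ; (suc zero) zero e → contradiction e (β-injective 𝟐 𝟏 λ ()) ; (suc zero)
                   (suc zero) _ → refl }
    ; apart = λ { zero zero → β-injective 𝟎 𝟏 λ () ; zero (suc zero) → β-injective 𝟎 𝟐 λ () } }

  labelled₂₁ : Labelled Between ρ₂₁ κ₂₁
  labelled₂₁ = record
    { rowP = λ { zero → between 𝟎 ; (suc zero) → between 𝟏 } ; colP = λ { zero → between 𝟐 }
    ; rowInj = λ { zero zero _ → refl ; zero (suc zero) e → contradiction e (β-injective 𝟎 𝟏 λ ())
                 ; (suc zero) zero e → contradiction e (β-injective 𝟏 𝟎 λ ()) ; (suc zero)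
                   (suc zero) _ → refl }
    ; colInj = λ { zero zero _ → refl }
    ; apart = λ { zero zero → β-injective 𝟎 𝟐 λ () ; (suc zero) zero → β-injective 𝟏 𝟐 λ () } }

open Tower
open Labels using (Between; labelled₁₂; labelled₂₁; ρ₁₂; κ₁₂; ρ₂₁; κ₂₁)

tail-pair : Vec ℕ m → Vec ℕ n → Chain m n → Cochain → Cochain
tail-pair ρ κ B f τ = pair ρ κ (λ τ' → f (τ List.++ τ')) B

Fits : ℕ → Vec ℕ m → Vec ℕ n → Chain m n → List Edge → Set
Fits K ρ κ B τ = ∀ σ → B σ ≢ 0ℤ → Match (S K) (τ List.++ edges ρ κ σ)

Fits-[] : ∀ {K} {ρ : Vec ℕ m} {κ : Vec ℕ n} {B} → Labelled (S K) ρ κ → Pure d B → Fits K ρ κ B []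
Fits-[] L pB σ nz = labelled-match L σ (proj₁ (pB σ nz))

module _ (K : ℕ) {ρ : Vec ℕ m} {κ : Vec ℕ n} {B : Chain m n} where
  open Labels K

  X : ℕ → List Edge → 𝔽₃
  X K = tail-pair ρ κ B (φ (tower K))

  Fits-∷ : ∀ i j τ → i ≢ j → Fits K ρ κ B τ → Fits (suc K) ρ κ B ((β i , β j) ∷ τ)
  Fits-∷ i j τ n F σ nz = Match-inner i j _ n (F σ nz)

  -- An edge within the top block splits off by `φ⁺-inner`, which lowers the tower by one level.
  -- `Fits` makes that formula available on the support of `B`; elsewhere the coefficient is zero.
  X-∷ : ∀ i j τ → i ≢ j → Fits K ρ κ B τ → X (suc K) ((β i , β j) ∷ τ) ≡ ⊖ (i ⊕ j) ⊗ X K τ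
  X-∷ i j τ n F = trans (Σ-face-cong {m} {_} pointwise) (Σ-face-⊗ {m} {_} (⊖ (i ⊕ j)) _)
    where
    ⊗-comm : ∀ x s y → x ⊗ (s ⊗ y) ≡ s ⊗ (x ⊗ y)
    ⊗-comm = by₃ tt
    pointwise : ∀ σ → mod₃ (B σ) ⊗ φ (tower (suc K)) ((β i , β j) ∷ τ List.++ edges ρ κ σ) ≡
      ⊖ (i ⊕ j) ⊗ (mod₃ (B σ) ⊗ φ (tower K) (τ List.++ edges ρ κ σ))
    pointwise σ with B σ ℤ.≟ 0ℤ
    ... | yes z rewrite z = sym (⊗-zeroʳ (⊖ (i ⊕ j)))
    ... | no nz = trans (cong (mod₃ (B σ) ⊗_) (φ⁺-inner i j _ n (F σ nz))) (⊗-comm (mod₃ (B σ))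
      (⊖ (i ⊕ j)) (φ (tower K) (τ List.++ edges ρ κ σ)))

pair-S₁₂ : ∀ r c c' F → pair (r ∷ []) (c ∷ c' ∷ []) F S₁₂ ≡ F ((r , c) ∷ []) ⊝ F ((r , c') ∷ [])
pair-S₁₂ r c c' F = by₂ {λ x y → 𝟎 ⊕ (x ⊕ (⊖ y ⊕ 𝟎))} {λ x y → x ⊝ y} tt (F ((r , c) ∷ []))
  (F ((r , c') ∷ []))

pair-S₂₁ : ∀ r r' c F → pair (r ∷ r' ∷ []) (c ∷ []) F S₂₁ ≡ F ((r , c) ∷ []) ⊝ F ((r' , c) ∷ [])
pair-S₂₁ r r' c F = by₂ {λ x y → (⊖ y ⊕ 𝟎) ⊕ ((x ⊕ 𝟎) ⊕ 𝟎)} {λ x y → x ⊝ y} tt (F ((r , c) ∷ []))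
  (F ((r' , c) ∷ []))

step₁₂ : ∀ K {ρ : Vec ℕ m} {κ : Vec ℕ n} {B} → Fits K ρ κ B [] →
  pair (ρ₁₂ K ++ ρ) (κ₁₂ K ++ κ) (φ (tower (suc K))) (join S₁₂ B) ≡ pair ρ κ (φ (tower K)) B
step₁₂ K {ρ} {κ} {B} F = trans (pair-join (ρ₁₂ K) (κ₁₂ K) ρ κ (φ (tower (suc K))) S₁₂ B)
  (trans (pair-S₁₂ (top K) (1 + top K) (2 + top K) (tail-pair ρ κ B (φ (tower (suc K)))))
    (trans (cong₂ _⊝_ (X-∷ K {ρ} {κ} {B} 𝟎 𝟏 [] (λ ()) F) (X-∷ K {ρ} {κ} {B} 𝟎 𝟐 [] (λ ()) F))
    (by₁ {λ x → 𝟐 ⊗ x ⊝ 𝟏 ⊗ x} {λ x → x} tt _)))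

step₂₁ : ∀ K {ρ : Vec ℕ m} {κ : Vec ℕ n} {B} → Fits K ρ κ B [] →
  pair (ρ₂₁ K ++ ρ) (κ₂₁ K ++ κ) (φ (tower (suc K))) (join S₂₁ B) ≡ pair ρ κ (φ (tower K)) B
step₂₁ K {ρ} {κ} {B} F = trans (pair-join (ρ₂₁ K) (κ₂₁ K) ρ κ (φ (tower (suc K))) S₂₁ B)
  (trans (pair-S₂₁ (top K) (1 + top K) (2 + top K) (tail-pair ρ κ B (φ (tower (suc K)))))
    (trans (cong₂ _⊝_ (X-∷ K {ρ} {κ} {B} 𝟎 𝟐 [] (λ ()) F) (X-∷ K {ρ} {κ} {B} 𝟏 𝟐 [] (λ ()) F))
    (by₁ {λ x → 𝟏 ⊗ x ⊝ 𝟎 ⊗ x} {λ x → x} tt _)))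

top-pos : ∀ K → 0 < top K
top-pos zero    = s≤s z≤n
top-pos (suc K) = s≤s z≤n

top-mono : ∀ K → top K ≤ top (suc K)
top-mono K = ℕₚ.m≤n+m (top K) 3

-- Vertex `0`, the only one of `S 0`, is reserved for the spare column of `T₅₅`.
Range : ℕ → ℕ → Set
Range K x = 0 < x × x < top K

Range-extend : ∀ K → (λ x → Between K x ⊎ Range K x) ⊆ Range (suc K)
Range-extend K x (inj₁ (p , q)) = ℕₚ.<-≤-trans (top-pos K) p , q
Range-extend K x (inj₂ (p , q)) = p , ℕₚ.<-≤-trans q (top-mono K)

Range-disjoint : ∀ K x → Between K x → Range K x → ⊥
Range-disjoint K x (p , _) (_ , q) = ℕₚ.<⇒≱ q p

-- The i-th block of three vertices is {top i, top i + 1, top i + 2}; each 0-sphere occupies one block.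
sρ : ∀ α β → Vec ℕ (rows α β)
sρ zero    zero    = []
sρ zero    (suc β) = ρ₂₁ β ++ sρ zero β
sρ (suc α) β       = ρ₁₂ (α + β) ++ sρ α β

sκ : ∀ α β → Vec ℕ (cols α β)
sκ zero    zero    = []
sκ zero    (suc β) = κ₂₁ β ++ sκ zero β
sκ (suc α) β       = κ₁₂ (α + β) ++ sκ α β

spheres-labelled : ∀ α β → Labelled (Range (α + β)) (sρ α β) (sκ α β)
spheres-labelled zero zero = record
  { rowP = λ () ; colP = λ () ; rowInj = λ () ; colInj = λ () ; apart = λ () }
spheres-labelled zero (suc β) = Labelled-mono (Range-extend β) (Labelled-++ (Range-disjoint β)
  (labelled₂₁ β) (spheres-labelled zero β))
spheres-labelled (suc α) β = Labelled-mono (Range-extend (α + β))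
  (Labelled-++ (Range-disjoint (α + β)) (labelled₁₂ (α + β)) (spheres-labelled α β))

spheres-fit : ∀ α β → Fits (α + β) (sρ α β) (sκ α β) (spheres α β) []
spheres-fit α β = Fits-[] {K = α + β} {ρ = sρ α β} {κ = sκ α β} (Labelled-mono (λ _ → proj₂)
  (spheres-labelled α β)) (spheres-pure α β)

pair-spheres : ∀ α β → pair (sρ α β) (sκ α β) (φ (tower (α + β))) (spheres α β) ≡ 𝟏
pair-spheres zero    zero    = refl
pair-spheres zero    (suc β) = trans (step₂₁ β {sρ zero β} {sκ zero β} (spheres-fit zero β))
  (pair-spheres zero β)
pair-spheres (suc α) β       = trans (step₁₂ (α + β) {sρ α β} {sκ α β} (spheres-fit α β))
  (pair-spheres α β)

-- The factors of `T₅₅` take three blocks above the `K` blocks of the other 0-spheres. The spare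
-- column is vertex `0`, which brings the total to `3 (3 + K) + 1`, all vertices of the tower at
-- level `3 + K`.
Tρ : ℕ → Vec ℕ 5
Tρ K = ρ₁₂ (2 + K) ++ (ρ₂₁ (1 + K) ++ (ρ₂₁ K ++ []))

Tκ : ℕ → Vec ℕ 5
Tκ K = κ₁₂ (2 + K) ++ (κ₂₁ (1 + K) ++ (κ₂₁ K ++ (0 ∷ [])))

module _ (K : ℕ) where

  Upper : ℕ → ℕ → Set
  Upper L x = x ≡ 0 ⊎ (top K ≤ x × x < top L)

  T-labelled : Labelled (Upper (3 + K)) (Tρ K) (Tκ K)
  T-labelled = Labelled-mono (extend (2 + K) 2≤) (Labelled-++ (disjoint (2 + K))
    (labelled₁₂ (2 + K))
    (Labelled-mono (extend (1 + K) 1≤) (Labelled-++ (disjoint (1 + K)) (labelled₂₁ (1 + K))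
    (Labelled-mono (extend K ℕₚ.≤-refl) (Labelled-++ (disjoint K) (labelled₂₁ K) base)))))
    where
    1≤ : top K ≤ top (1 + K)
    1≤ = top-mono K
    2≤ : top K ≤ top (2 + K)
    2≤ = ℕₚ.≤-trans 1≤ (top-mono (suc K))
    extend : ∀ L → top K ≤ top L → (λ x → Between L x ⊎ Upper L x) ⊆ Upper (suc L)
    extend L l x (inj₁ (p , q))        = inj₂ (ℕₚ.≤-trans l p , q)
    extend L l x (inj₂ (inj₁ e))       = inj₁ e
    extend L l x (inj₂ (inj₂ (p , q))) = inj₂ (p , ℕₚ.<-≤-trans q (top-mono L))
    disjoint : ∀ L x → Between L x → Upper L x → ⊥
    disjoint L x (p , _) (inj₁ refl)    = ℕₚ.<⇒≱ (top-pos L) p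
    disjoint L x (p , _) (inj₂ (_ , q)) = ℕₚ.<⇒≱ q p
    base : Labelled (Upper K) [] (0 ∷ [])
    base = record { rowP = λ () ; colP = λ { zero → inj₁ refl } ; rowInj = λ ()
                  ; colInj = λ { zero zero _ → refl } ; apart = λ () }

  module _ {ρ : Vec ℕ m} {κ : Vec ℕ n} {B : Chain m n} where

    T-join-labelled : Labelled (Range K) ρ κ → Labelled (S (3 + K)) (Tρ K ++ ρ) (Tκ K ++ κ)
    T-join-labelled L = Labelled-mono (λ { _ (inj₁ (inj₁ refl)) → top-pos (3 + K) ; _
      (inj₁ (inj₂ (_ , q))) → q
        ; _ (inj₂ (_ , q)) → ℕₚ.<-≤-trans q (ℕₚ.m≤n+m (top K) 9) })
      (Labelled-++ (λ { _ (inj₁ refl) () ; _ (inj₂ (p , _)) (_ , q) → ℕₚ.<⇒≱ q p }) T-labelled L)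

    -- The join with `B` is outside the joins that form `T₅₅`, so `B` is kept in the tail while the
    -- three 0-spheres are peeled off by `pair-join`; each contributes one.
    pair-T₅₅ : Fits K ρ κ B [] →
      pair (Tρ K ++ ρ) (Tκ K ++ κ) (φ (tower (3 + K))) (join T₅₅ B) ≡ pair ρ κ (φ (tower K)) B
    pair-T₅₅ F = begin
      pair (Tρ K ++ ρ) (Tκ K ++ κ) (φ (tower (3 + K))) (join T₅₅ B)
        ≡⟨ pair-join (Tρ K) (Tκ K) ρ κ (φ (tower (3 + K))) T₅₅ B ⟩
      pair (Tρ K) (Tκ K) Y T₅₅
        ≡⟨ pair-join (ρ₁₂ (2 + K)) (κ₁₂ (2 + K)) (ρ₂₁ (1 + K) ++ (ρ₂₁ K ++ []))
          (κ₂₁ (1 + K) ++ (κ₂₁ K ++ (0 ∷ [])))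
             Y S₁₂ (join S₂₁ (join S₂₁ unit)) ⟩
      pair (ρ₁₂ (2 + K)) (κ₁₂ (2 + K)) G S₁₂
        ≡⟨ pair-S₁₂ (top (2 + K)) (1 + top (2 + K)) (2 + top (2 + K)) G ⟩
      G (e₁ 𝟎 𝟏 ∷ []) ⊝ G (e₁ 𝟎 𝟐 ∷ [])
        ≡⟨ cong₂ _⊝_ (two 𝟎 𝟏 λ ()) (two 𝟎 𝟐 λ ()) ⟩
      𝟐 ⊗ val ⊝ 𝟏 ⊗ val
        ≡⟨ by₁ {λ x → 𝟐 ⊗ x ⊝ 𝟏 ⊗ x} {λ x → x} tt val ⟩
      val ∎
      where
      open ≡-Reasoning
      Y : Cochain
      Y = tail-pair ρ κ B (φ (tower (3 + K)))
      val : 𝔽₃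
      val = tail-pair ρ κ B (φ (tower K)) []
      e₁ e₂ e₃ : 𝔽₃ → 𝔽₃ → Edge
      e₁ i j = Labels.β (2 + K) i , Labels.β (2 + K) j
      e₂ i j = Labels.β (1 + K) i , Labels.β (1 + K) j
      e₃ i j = Labels.β K i , Labels.β K j
      G : Cochain
      G τ = pair (ρ₂₁ (1 + K) ++ (ρ₂₁ K ++ [])) (κ₂₁ (1 + K) ++ (κ₂₁ K ++ (0 ∷ [])))
        (λ τ' → Y (τ List.++ τ')) (join S₂₁ (join S₂₁ unit))
      H : Edge → Cochain
      H e τ = pair (ρ₂₁ K ++ []) (κ₂₁ K ++ (0 ∷ [])) (λ τ' → Y (e ∷ τ List.++ τ')) (join S₂₁ unit)
      I : Edge → Edge → Cochain
      I e e' τ = pair [] (0 ∷ []) (λ τ' → Y (e ∷ e' ∷ τ List.++ τ')) unit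
      three : ∀ i j k l p q → i ≢ j → k ≢ l → p ≢ q →
        Y (e₁ i j ∷ e₂ k l ∷ e₃ p q ∷ []) ≡ ⊖ (i ⊕ j) ⊗ (⊖ (k ⊕ l) ⊗ (⊖ (p ⊕ q) ⊗ val))
      three i j k l p q ij kl pq =
        trans (X-∷ (2 + K) {ρ} {κ} {B} i j _ ij F₂) (cong (⊖ (i ⊕ j) ⊗_)
          (trans (X-∷ (1 + K) {ρ} {κ} {B} k l _ kl F₁) (cong (⊖ (k ⊕ l) ⊗_) (X-∷ K {ρ} {κ} {B} p q
            [] pq F))))
        where
        F₁ = Fits-∷ K {ρ} {κ} {B} p q [] pq F
        F₂ = Fits-∷ (1 + K) {ρ} {κ} {B} k l (e₃ p q ∷ []) kl F₁
      one : ∀ i j k l → i ≢ j → k ≢ l → H (e₁ i j) (e₂ k l ∷ []) ≡ ⊖ (i ⊕ j) ⊗ (⊖ (k ⊕ l) ⊗ val)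
      one i j k l ij kl = trans (pair-join (ρ₂₁ K) (κ₂₁ K) [] (0 ∷ []) (λ τ →
        Y (e₁ i j ∷ e₂ k l ∷ τ)) S₂₁ unit)
        (trans (pair-S₂₁ (top K) (1 + top K) (2 + top K) (I (e₁ i j) (e₂ k l)))
          (trans (cong₂ _⊝_ (three i j k l 𝟎 𝟐 ij kl λ ()) (three i j k l 𝟏 𝟐 ij kl λ ()))
          (by₃ {λ s t x → s ⊗ (t ⊗ (𝟏 ⊗ x)) ⊝ s ⊗ (t ⊗ (𝟎 ⊗ x))} {λ s t x → s ⊗ (t ⊗ x)} tt
            (⊖ (i ⊕ j)) (⊖ (k ⊕ l)) val)))
      two : ∀ i j → i ≢ j → G (e₁ i j ∷ []) ≡ ⊖ (i ⊕ j) ⊗ val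
      two i j ij = trans (pair-join (ρ₂₁ (1 + K)) (κ₂₁ (1 + K)) (ρ₂₁ K ++ []) (κ₂₁ K ++ (0 ∷ []))
        (λ τ → Y (e₁ i j ∷ τ)) S₂₁ (join S₂₁ unit))
        (trans (pair-S₂₁ (top (1 + K)) (1 + top (1 + K)) (2 + top (1 + K)) (H (e₁ i j)))
          (trans (cong₂ _⊝_ (one i j 𝟎 𝟐 ij λ ()) (one i j 𝟏 𝟐 ij λ ()))
          (by₂ {λ s x → s ⊗ (𝟏 ⊗ x) ⊝ s ⊗ (𝟎 ⊗ x)} {λ s x → s ⊗ x} tt (⊖ (i ⊕ j)) val)))

-- Evaluation of the cocycle on γ

module _ {A : Set} where

  ∑±₃ : List A → (A × List A → 𝔽₃) → 𝔽₃
  ∑±₃ []      F = 𝟎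
  ∑±₃ (c ∷ C) F = F (c , C) ⊝ ∑±₃ C (λ { (d , C') → F (d , c ∷ C') })

  ∑±₃-𝟎 : ∀ C {F} → (∀ {c C'} → Pick C c C' → F (c , C') ≡ 𝟎) → ∑±₃ C F ≡ 𝟎
  ∑±₃-𝟎 []      h = refl
  ∑±₃-𝟎 (c ∷ C) h = cong₂ _⊝_ (h here) (∑±₃-𝟎 C (λ p → h (there p)))

∑₃-single : ∀ {n} (c : Fin n) {g : Fin n → 𝔽₃} → (∀ j → j ≢ c → g j ≡ 𝟎) → ∑₃ n g ≡ g c
∑₃-single {suc n} zero    {g} h = trans (cong (g zero ⊕_) (∑₃-ε n λ j → h (suc j) λ ()))
  (by₁ {λ x → x ⊕ 𝟎} {λ x → x} tt (g zero))
∑₃-single {suc n} (suc c) {g} h = trans (cong (_⊕ ∑₃ n (g ∘ suc)) (h zero λ ()))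
  (∑₃-single c λ j n → h (suc j) (n ∘ Finₚ.suc-injective))

module _ {r n : ℕ} (g : Fin n → Face r n → 𝔽₃) where

  Σ-face-∑± : ∀ C (H : Fin n × List (Fin n) → Chain r n) →
    ∑₃ n (λ j → Σ-face (λ σ → mod₃ (∑± C (λ { (c , C') → if does (j Fin.≟ c) then H (c , C') σ else
      0ℤ })) ⊗ g j σ)) ≡
    ∑±₃ C (λ { (c , C') → Σ-face (λ σ → mod₃ (H (c , C') σ) ⊗ g c σ) })
  Σ-face-∑± []      H = ∑₃-ε n λ j → Σ-face-𝟎 {r} {n} (λ _ → refl)
  Σ-face-∑± (c ∷ C) H = begin
    ∑₃ n (λ j → Σ-face (λ σ → mod₃ (first j σ +ℤ - rest j σ) ⊗ g j σ))
      ≡⟨ ∑₃-cong n (λ j → trans (Σ-face-cong {r} {n} (λ σ → expand (first j σ) (rest j σ) (g j σ)))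
           (trans (Σ-face-⊕ {r} {n} (λ σ → mod₃ (first j σ) ⊗ g j σ) _)
             (cong (Σ-face (λ σ → mod₃ (first j σ) ⊗ g j σ) ⊕_) (Σ-face-⊗ {r} {n} 𝟐 _)))) ⟩
    ∑₃ n (λ j → Σ-face (λ σ → mod₃ (first j σ) ⊗ g j σ) ⊝ Σ-face (λ σ → mod₃ (rest j σ) ⊗ g j σ))
      ≡⟨ ∑₃-⊕ n (λ j → Σ-face (λ σ → mod₃ (first j σ) ⊗ g j σ)) _ ⟩
    ∑₃ n (λ j → Σ-face (λ σ → mod₃ (first j σ) ⊗ g j σ)) ⊕ ∑₃ n (λ j →
      ⊖ Σ-face (λ σ → mod₃ (rest j σ) ⊗ g j σ))
      ≡⟨ cong₂ _⊕_ (trans (∑₃-single c off) (Σ-face-cong {r} {n} on))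
           (trans (sym (∑₃-hom n ⊖_ refl (by₂ tt) (λ j → Σ-face (λ σ → mod₃ (rest j σ) ⊗ g j σ))))
             (cong ⊖_ (Σ-face-∑± C (λ { (d , C') → H (d , c ∷ C') })))) ⟩
    _ ∎
    where
    open ≡-Reasoning
    first rest : Fin n → Face r n → ℤ
    first j σ = if does (j Fin.≟ c) then H (c , C) σ else 0ℤ
    rest j σ = ∑± C (λ { (d , C') → if does (j Fin.≟ d) then H (d , c ∷ C') σ else 0ℤ })
    expand : ∀ x y z → mod₃ (x +ℤ - y) ⊗ z ≡ mod₃ x ⊗ z ⊕ 𝟐 ⊗ (mod₃ y ⊗ z)
    expand x y z = trans (cong (_⊗ z) (trans (mod₃-+ x (- y)) (cong (mod₃ x ⊕_) (mod₃-neg y))))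
      (by₃ {λ x y z → (x ⊕ ⊖ y) ⊗ z} {λ x y z → x ⊗ z ⊕ 𝟐 ⊗ (y ⊗ z)} tt (mod₃ x) (mod₃ y) z)
    off : ∀ j → j ≢ c → Σ-face (λ σ → mod₃ (first j σ) ⊗ g j σ) ≡ 𝟎
    off j n≢ with j Fin.≟ c
    ... | yes e = contradiction e n≢
    ... | no _  = Σ-face-𝟎 {r} {n} (λ _ → refl)
    on : ∀ σ → mod₃ (first c σ) ⊗ g c σ ≡ mod₃ (H (c , C) σ) ⊗ g c σ
    on σ with c Fin.≟ c
    ... | yes _ = refl
    ... | no ¬p = contradiction refl ¬p

pair-γ : ∀ k r (ρ : Vec ℕ k) (κ : Vec ℕ n) f C →
  pair (r ∷ ρ) κ f (γ (suc k) C) ≡ ∑±₃ C (λ { (c , C') → pair ρ κ (ι (r , lookup κ c) f) (γ k C') })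
pair-γ {n} k r ρ κ f C = cong₂ _⊕_ (Σ-face-𝟎 {k} {n} (λ _ → refl))
  (Σ-face-∑± (λ j σ → f ((r , lookup κ j) ∷ edges ρ κ σ)) C (λ { (c , C') → γ k C' }))

lim : ℕ → ℕ → ℕ
lim K zero    = top K
lim K (suc k) = 2 + lim K k

-- φ of the face without k prescribed edges, if it contains them; these split off the first k rows of γ.
Ψ : ℕ → ℕ → Cochain
Ψ K zero    = φ (tower K)
Ψ K (suc k) = ext (lim K k) 𝟘 (λ w → pick w (suc (lim K k)) (Ψ K k) 𝟘)

Ψ-hit : ∀ K k τ → Ψ K (suc k) ((lim K k , suc (lim K k)) ∷ τ) ≡ Ψ K k τ
Ψ-hit K k τ = trans (ext-hit (lim K k) _ _ (suc (lim K k)) τ) (cong-app (pick-≡ (suc (lim K k)) _ _)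
  τ)

Ψ-other : ∀ K k w τ → w ≢ suc (lim K k) → Ψ K (suc k) ((lim K k , w) ∷ τ) ≡ 𝟎
Ψ-other K k w τ n = trans (ext-hit (lim K k) _ _ w τ) (cong-app (pick-≢ w (suc (lim K k)) _ _ n) τ)

-- A coboundary term of `Ψ` can be nonzero only on a face containing the prescribed edge, and on the
-- link of that edge the condition is the one for the previous `Ψ`.
Ψ-primitive : ∀ K k → Primitive (_< lim K k) 0 (suc (k + K)) (Ψ K k) 𝟘
Ψ-primitive K zero    = φ-alt (tower K) , λ σ m l → sym (φ-coc (tower K) σ m l)
Ψ-primitive K (suc k) = primitive-ext (ℕₚ.m<n⇒m<1+n (ℕₚ.n<1+n _)) Alt-𝟘 (primitive-𝟘 λ _ _ _ → refl)
  λ w _ _ _ → primitive-pick w (suc (lim K k))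
    (λ { refl → let (A , pr) = Ψ-primitive K k ; below = λ { _ ((p , a) , b) → ℕₚ.≤∧≢⇒< (ℕₚ.≤-pred (ℕₚ.≤∧≢⇒< (ℕₚ.≤-pred p) b)) a } in
      Alt-mono below A , λ σ m l → pr σ (Match-mono below m) (ℕₚ.suc-injective l) })
    (λ _ → primitive-𝟘 λ _ _ _ → refl)

γρ : ∀ K k → Vec ℕ (suc k)
γρ K zero    = top K ∷ []
γρ K (suc k) = lim (suc K) k ∷ γρ K k

γκ : ∀ K k → Vec ℕ (2 + k)
γκ K zero    = 1 + top K ∷ 2 + top K ∷ []
γκ K (suc k) = suc (lim (suc K) k) ∷ γκ K k

lim-≥ : ∀ K k → top K ≤ lim K k
lim-≥ K zero    = ℕₚ.≤-refl
lim-≥ K (suc k) = ℕₚ.≤-trans (lim-≥ K k) (ℕₚ.m≤n+m _ 2)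

γ-labelled : ∀ K k → Labelled (λ x → top K ≤ x × x < lim (suc K) k) (γρ K k) (γκ K k)
γ-labelled K zero    = labelled₁₂ K
γ-labelled K (suc k) = Labelled-mono
  (λ { _ (inj₁ (inj₁ refl)) → l , ℕₚ.m<n⇒m<1+n (ℕₚ.n<1+n _)
     ; _ (inj₁ (inj₂ refl)) → ℕₚ.m≤n⇒m≤1+n l , ℕₚ.n<1+n _
     ; _ (inj₂ (p , q)) → p , ℕₚ.m<n⇒m<1+n (ℕₚ.m<n⇒m<1+n q) })
  (Labelled-++ (λ { _ (inj₁ refl) (_ , q) → ℕₚ.<-irrefl refl q ; _ (inj₂ refl) (_ , q) →
    ℕₚ.<⇒≱ q (ℕₚ.n≤1+n _) })
    single-labelled (γ-labelled K k))
  where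
  l : top K ≤ lim (suc K) k
  l = ℕₚ.≤-trans (top-mono K) (lim-≥ (suc K) k)
  single-labelled : Labelled (λ x → x ≡ lim (suc K) k ⊎ x ≡ suc (lim (suc K) k))
    (lim (suc K) k ∷ []) (suc (lim (suc K) k) ∷ [])
  single-labelled = record { rowP = λ { zero → inj₁ refl } ; colP = λ { zero → inj₂ refl }
    ; rowInj = λ { zero zero _ → refl } ; colInj = λ { zero zero _ → refl }
    ; apart = λ { zero zero e → ℕₚ.1+n≢n (sym e) } }

module _ (K : ℕ) {ρ : Vec ℕ m} {κ′ : Vec ℕ n} {B : Chain m n} (F : Fits K ρ κ′ B []) where

  Y : ℕ → Cochain
  Y k = tail-pair ρ κ′ B (Ψ (suc K) k)

  -- Of the Laplace expansion, `Ψ` keeps the term in which the first row meets its partner column,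
  -- the head of `C`. After `k` rows two columns are left and form a 0-sphere as in `step₁₂`. The
  -- list `C` varies because taking out a column leaves the labelling `κ` as it is.
  pair-Ψ-γ : ∀ {n} k (κ : Vec ℕ n) C → List.map (lookup κ) C ≡ Vec.toList (γκ K k) →
    pair (γρ K k) κ (Y k) (γ (suc k) C) ≡ pair ρ κ′ (φ (tower K)) B
  pair-Ψ-γ zero κ (c ∷ c' ∷ []) eq = trans (pair-γ 0 (top K) [] κ (Y 0) (c ∷ c' ∷ []))
    (trans (cong₂ (λ v v' → Y 0 ((top K , v) ∷ []) ⊝ (Y 0 ((top K , v') ∷ []) ⊝ 𝟎))
        (Listₚ.∷-injectiveˡ eq) (Listₚ.∷-injectiveˡ (Listₚ.∷-injectiveʳ eq)))
      (trans (cong₂ (λ x y → x ⊝ (y ⊝ 𝟎)) (X-∷ K {ρ} {κ′} {B} 𝟎 𝟏 [] (λ ()) F) (X-∷ K {ρ} {κ′} {B} 𝟎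
        𝟐 [] (λ ()) F))
        (by₁ {λ x → 𝟐 ⊗ x ⊝ (𝟏 ⊗ x ⊝ 𝟎)} {λ x → x} tt (tail-pair ρ κ′ B (φ (tower K)) []))))
  pair-Ψ-γ {n'} (suc k) κ (c ∷ C) eq = trans (pair-γ (suc k) (lim (suc K) k) (γρ K k) κ (Y (suc k))
    (c ∷ C))
    (trans (cong₂ _⊝_ leading (∑±₃-𝟎 C λ {d} {C'} p → other d (c ∷ C')
      (proj₁ (Pick-All p bounded))))
      (by₁ {λ x → x ⊝ 𝟎} {λ x → x} tt _))
    where
    G : Fin n' × List (Fin n') → 𝔽₃
    G (d , C') = pair (γρ K k) κ (ι (lim (suc K) k , lookup κ d) (Y (suc k))) (γ (suc k) C')
    leading : G (c , C) ≡ pair ρ κ′ (φ (tower K)) B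
    leading = trans (Σ-face-cong {suc k} {n'} λ σ → cong (mod₃ (γ (suc k) C σ) ⊗_)
        (trans (cong (λ v → Y (suc k) ((lim (suc K) k , v) ∷ edges (γρ K k) κ σ))
          (Listₚ.∷-injectiveˡ eq))
          (Σ-face-cong {m} {n} λ τ → cong (mod₃ (B τ) ⊗_)
            (Ψ-hit (suc K) k (edges (γρ K k) κ σ List.++ edges ρ κ′ τ)))))
      (pair-Ψ-γ k κ C (Listₚ.∷-injectiveʳ eq))
    bounded : All (λ d → lookup κ d < lim (suc K) k) C
    bounded = Allₚ.map⁻ (subst (All (_< lim (suc K) k)) (sym (Listₚ.∷-injectiveʳ eq))
      (all-below (γκ K k) (proj₂ ∘ colP (γ-labelled K k))))
      where
      all-below : ∀ {l} (v : Vec ℕ l) → (∀ i → lookup v i < lim (suc K) k) → All (_< lim (suc K) k)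
        (Vec.toList v)
      all-below []      h = []
      all-below (x ∷ v) h = h zero ∷ all-below v (h ∘ suc)
    other : ∀ d C' → lookup κ d < lim (suc K) k → G (d , C') ≡ 𝟎
    other d C' lt = Σ-face-𝟎 {suc k} {n'} λ σ → trans (cong (mod₃ (γ (suc k) C' σ) ⊗_)
        (Σ-face-𝟎 {m} {n} λ τ → trans (cong (mod₃ (B τ) ⊗_) (Ψ-other (suc K) k (lookup κ d)
          (edges (γρ K k) κ σ List.++ edges ρ κ′ τ) (ℕₚ.<⇒≢ (ℕₚ.m<n⇒m<1+n lt))))
          (⊗-zeroʳ (mod₃ (B τ)))))
      (⊗-zeroʳ (mod₃ (γ (suc k) C' σ)))

-- The element of order three

map-lookup-allFin : ∀ {n} (κ : Vec ℕ n) → List.map (lookup κ) (allFin n) ≡ Vec.toList κ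
map-lookup-allFin {n} κ = trans (Listₚ.map-tabulate id (lookup κ)) (go κ)
  where
  go : ∀ {n} (κ : Vec ℕ n) → tabulate (lookup κ) ≡ Vec.toList κ
  go []      = refl
  go (x ∷ κ) = cong (x ∷_) (go κ)

edges-length : ∀ (ρ : Vec ℕ m) (κ : Vec ℕ n) σ → length (edges ρ κ σ) ≡ size σ
edges-length []      κ []            = refl
edges-length (r ∷ ρ) κ (nothing ∷ σ) = edges-length ρ κ σ
edges-length (r ∷ ρ) κ (just j ∷ σ)  = cong suc (edges-length ρ κ σ)

sign-square : ∀ k → signℤ k *ℤ signℤ k ≡ 1ℤ
sign-square zero    = refl
sign-square (suc k) = trans (lemma (signℤ k)) (sign-square k)
  where
  lemma : ∀ x → - x *ℤ - x ≡ x *ℤ x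
  lemma = ℤ-Solver.solve-∀

isCycle : ∀ d (z : Chain m n) → (∀ σ → ∂ z σ ≡ 0ℤ) → IsCycle d z
isCycle zero    z h σ _ _ = h σ
isCycle (suc d) z h σ _   = h σ

module _ (k α β : ℕ) where

  R : Chain (rows α β) (cols α β)
  R = spheres α β

  B : Chain (5 + rows α β) (5 + cols α β)
  B = join T₅₅ R

  Γ : Chain (suc k) (2 + k)
  Γ = γ (suc k) (allFin (2 + k))

  Z : Chain (suc k + (5 + rows α β)) (2 + k + (5 + cols α β))
  Z = join Γ B

  K : ℕ
  K = 3 + (α + β)

  B-pure : Pure K B
  B-pure = join-pure T₅₅ R T₅₅-pure (spheres-pure α β)

  Γ-pure : Pure (suc k) Γ
  Γ-pure σ nz = let (r , s , _) = γ-support (suc k) (allFin (2 + k)) (Uniqueₚ.allFin⁺ (2 + k)) σ nz in r , s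

  Z-pure : Pure (suc k + K) Z
  Z-pure = join-pure Γ B Γ-pure B-pure

  D-Γ : ∀ σ → D Γ σ ≡ 0ℤ
  D-Γ σ = D-γ (suc k) (allFin (2 + k)) σ (Listₚ.length-tabulate id)

  Z-cycle : ∀ σ → ∂ Z σ ≡ 0ℤ
  Z-cycle σ = trans (∂≡D Z Z-pure σ) (join-cycle Γ B D-Γ (join-cycle T₅₅ R D-T₅₅ (D-spheres α β)) σ)

  sgn : ℤ
  sgn = signℤ (suc k)

  alt-Γ : ∀ σ → alt Γ σ ≡ sgn *ℤ Γ σ
  alt-Γ σ with Γ σ ℤ.≟ 0ℤ
  ... | yes z = trans (cong (signℤ (size σ) *ℤ_) z) (trans (ℤₚ.*-zeroʳ (signℤ (size σ)))
    (sym (trans (cong (sgn *ℤ_) z) (ℤₚ.*-zeroʳ sgn))))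
  ... | no nz = cong (λ l → signℤ l *ℤ Γ σ) (proj₂ (Γ-pure σ nz))

  W₀ : Chain (suc k + (5 + rows α β)) (2 + k + (5 + cols α β))
  W₀ = join Γ (join w₅₅ R)

  -- `D` passes `Γ` with the sign `sgn`, which this factor cancels.
  W : Chain (suc k + (5 + rows α β)) (2 + k + (5 + cols α β))
  W σ = sgn *ℤ W₀ σ

  W-pure : Pure (suc k + (4 + (α + β))) W
  W-pure σ nz = join-pure Γ (join w₅₅ R) Γ-pure (join-pure w₅₅ R w₅₅-pure (spheres-pure α β)) σ
    (λ z → nz (trans (cong (sgn *ℤ_) z) (ℤₚ.*-zeroʳ sgn)))

  D-W : ∀ σ → D W σ ≡ ℤ.+ 3 *ℤ Z σ
  D-W σ = begin
    D W σ                                      ≡⟨ scaled (linear-D σ) sgn W₀ ⟩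
    sgn *ℤ D W₀ σ                                 ≡⟨ cong (sgn *ℤ_) (D-join Γ (join w₅₅ R) σ) ⟩
    sgn *ℤ (join (D Γ) (join w₅₅ R) σ +ℤ join (alt Γ) (D (join w₅₅ R)) σ)
      ≡⟨ cong (sgn *ℤ_) (cong₂ _+ℤ_ (vanish (linear-joinˡ (join w₅₅ R) σ) D-Γ)
           (trans (congruent (linear-joinˡ (D (join w₅₅ R)) σ) alt-Γ)
             (scaled (linear-joinˡ (D (join w₅₅ R)) σ) sgn Γ))) ⟩
    sgn *ℤ (0ℤ +ℤ sgn *ℤ join Γ (D (join w₅₅ R)) σ)
      ≡⟨ cong (λ x → sgn *ℤ (0ℤ +ℤ sgn *ℤ x)) (trans (congruent (linear-joinʳ Γ σ) D-wR)
        (scaled (linear-joinʳ Γ σ) (ℤ.+ 3) B)) ⟩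
    sgn *ℤ (0ℤ +ℤ sgn *ℤ (ℤ.+ 3 *ℤ Z σ))               ≡⟨ regroup sgn (ℤ.+ 3 *ℤ Z σ) ⟩
    sgn *ℤ sgn *ℤ (ℤ.+ 3 *ℤ Z σ)                      ≡⟨ cong (_*ℤ (ℤ.+ 3 *ℤ Z σ))
      (sign-square (suc k)) ⟩
    1ℤ *ℤ (ℤ.+ 3 *ℤ Z σ)                         ≡⟨ ℤₚ.*-identityˡ _ ⟩
    ℤ.+ 3 *ℤ Z σ                                ∎
    where
    open ≡-Reasoning
    regroup : ∀ t x → t *ℤ (0ℤ +ℤ t *ℤ x) ≡ t *ℤ t *ℤ x
    regroup = ℤ-Solver.solve-∀
    D-wR : ∀ σ → D (join w₅₅ R) σ ≡ ℤ.+ 3 *ℤ B σ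
    D-wR σ = begin
      D (join w₅₅ R) σ                                ≡⟨ D-join w₅₅ R σ ⟩
      join (D w₅₅) R σ +ℤ join (alt w₅₅) (D R) σ       ≡⟨ cong₂ _+ℤ_
        (trans (congruent (linear-joinˡ R σ) D-w₅₅) (scaled (linear-joinˡ R σ) (ℤ.+ 3) T₅₅))
                                                           (vanish (linear-joinʳ (alt w₅₅) σ)
                                                             (D-spheres α β)) ⟩
      ℤ.+ 3 *ℤ B σ +ℤ 0ℤ                                ≡⟨ ℤₚ.+-identityʳ _ ⟩
      ℤ.+ 3 *ℤ B σ                                     ∎

  Bρ : Vec ℕ (5 + rows α β)
  Bρ = Tρ (α + β) ++ sρ α β
  Bκ : Vec ℕ (5 + cols α β)
  Bκ = Tκ (α + β) ++ sκ α β

  B-labelled : Labelled (S K) Bρ Bκ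
  B-labelled = T-join-labelled (α + β) {B = R} (spheres-labelled α β)

  Zρ : Vec ℕ (suc k + (5 + rows α β))
  Zρ = γρ K k ++ Bρ
  Zκ : Vec ℕ (2 + k + (5 + cols α β))
  Zκ = γκ K k ++ Bκ

  Z-labelled : Labelled (_< lim (suc K) k) Zρ Zκ
  Z-labelled = Labelled-mono (λ { _ (inj₁ (_ , q)) → q
      ; _ (inj₂ q) → ℕₚ.<-≤-trans q (ℕₚ.≤-trans (top-mono K) (lim-≥ (suc K) k)) })
    (Labelled-++ (λ { _ (p , _) q → ℕₚ.<⇒≱ q p }) (γ-labelled K k) B-labelled)

  pair-Z : pair Zρ Zκ (Ψ (suc K) k) Z ≡ 𝟏
  pair-Z = begin
    pair Zρ Zκ (Ψ (suc K) k) Z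
      ≡⟨ pair-join (γρ K k) (γκ K k) Bρ Bκ (Ψ (suc K) k) Γ B ⟩
    pair (γρ K k) (γκ K k) (tail-pair Bρ Bκ B (Ψ (suc K) k)) Γ
      ≡⟨ pair-Ψ-γ K {ρ = Bρ} {κ′ = Bκ} {B = B} (Fits-[] {K = K} {ρ = Bρ} {κ = Bκ} B-labelled B-pure)
        k (γκ K k) (allFin (2 + k)) (map-lookup-allFin (γκ K k)) ⟩
    pair Bρ Bκ (φ (tower K)) B
      ≡⟨ pair-T₅₅ (α + β) {ρ = sρ α β} {κ = sκ α β} {B = R} (spheres-fit α β) ⟩
    pair (sρ α β) (sκ α β) (φ (tower (α + β))) R
      ≡⟨ pair-spheres α β ⟩
    𝟏 ∎
    where open ≡-Reasoning

  -- If `Z` were `D w'`, then by `pair-D` the value `𝟏` of `pair-Z` would be a pairing of `w'` with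
  -- the coboundary of the cocycle `Ψ (suc K) k`, hence zero.
  Z-nonboundary : ¬ IsBoundary (k + K) Z
  Z-nonboundary (w , h) = contradiction (trans (sym pair-Z) pair-Z≡𝟎) λ ()
    where
    w' : Chain (suc k + (5 + rows α β)) (2 + k + (5 + cols α β))
    w' = cut (suc (suc k + K)) w
    D-w' : ∀ σ → D w' σ ≡ Z σ
    D-w' = D-cut (suc k + K) w Z Z-pure λ σ r l → h σ (NoRep⇒IsMatching σ r , l)
    pair-Z≡𝟎 : pair Zρ Zκ (Ψ (suc K) k) Z ≡ 𝟎
    pair-Z≡𝟎 = trans (Σ-face-cong {suc k + (5 + rows α β)} {2 + k + (5 + cols α β)} λ σ →
        cong (λ x → mod₃ x ⊗ Ψ (suc K) k (edges Zρ Zκ σ)) (sym (D-w' σ)))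
      (trans (pair-D Zρ Zκ (Ψ (suc K) k) w')
        (Σ-face-𝟎 {suc k + (5 + rows α β)} {2 + k + (5 + cols α β)} zero-term))
      where
      zero-term : ∀ σ → mod₃ (w' σ) ⊗ δ (Ψ (suc K) k) (edges Zρ Zκ σ) ≡ 𝟎
      zero-term σ with w' σ ℤ.≟ 0ℤ
      ... | yes z rewrite z = refl
      ... | no nz = let (r , l) = cut-pure (suc (suc k + K)) w σ nz in
        trans (cong (mod₃ (w' σ) ⊗_) (sym (proj₂ (Ψ-primitive (suc K) k) (edges Zρ Zκ σ)
          (labelled-match Z-labelled σ r) (trans (edges-length Zρ Zκ σ)
            (trans l (cong suc (sym (ℕₚ.+-suc k K))))))))
          (⊗-zeroʳ (mod₃ (w' σ)))

  order-3 : HasElementOfOrder3 (suc k + (5 + rows α β)) (2 + k + (5 + cols α β)) (k + K)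
  order-3 = Z , isCycle (k + K) Z Z-cycle , Z-nonboundary , W , λ σ _ → trans (∂≡D W W-pure σ)
    (D-W σ)

rows≡ : ∀ α β → rows α β ≡ α + 2 * β
rows≡ zero    zero    = refl
rows≡ zero    (suc β) = trans (cong (2 +_) (rows≡ zero β)) (sym (ℕₚ.*-suc 2 β))
rows≡ (suc α) β       = cong suc (rows≡ α β)

cols≡ : ∀ α β → cols α β ≡ 2 * α + β
cols≡ zero    zero    = refl
cols≡ zero    (suc β) = cong suc (cols≡ zero β)
cols≡ (suc α) β       = trans (cong (2 +_) (cols≡ α β)) (cong (_+ β) (sym (ℕₚ.*-suc 2 α)))

⌈/3⌉-≤ : ∀ x d → ⌈ x /3⌉ ≤ d → x ≤ 3 * d
⌈/3⌉-≤ x d h = ℕₚ.+-cancelʳ-≤ 2 x (3 * d) (begin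
  x + 2                           ≡⟨ DivMod.m≡m%n+[m/n]*n (x + 2) 3 ⟩
  (x + 2) % 3 + (x + 2) / 3 * 3   ≤⟨ ℕₚ.+-mono-≤ (ℕₚ.≤-pred (DivMod.m%n<n (x + 2) 3))
    (ℕₚ.*-monoˡ-≤ 3 h) ⟩
  2 + d * 3                       ≡⟨ lemma d ⟩
  3 * d + 2                       ∎)
  where
  open ℕₚ.≤-Reasoning
  lemma : ∀ d → 2 + d * 3 ≡ 3 * d + 2
  lemma = ℕ-Solver.solve-∀

-- The sizes `(k + 1, k + 2)`, `(5, 5)`, `(1, 2)` and `(2, 1)` of the factors add up, and so do
-- their numbers of edges `k + 1`, 3, 1 and 1, the sum of which is `d + 1`.
order-3-at : ∀ k α β {m n d} → m ≡ 6 + k + α + 2 * β → n ≡ 7 + k + 2 * α + β → d ≡ 3 + k + α + β →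
  HasElementOfOrder3 m n d
order-3-at k α β refl refl refl = subst₂ (λ (m , n) d → HasElementOfOrder3 m n d)
  (cong₂ _,_ (trans (cong (λ r → suc k + (5 + r)) (rows≡ α β)) (rowsum k α β))
             (trans (cong (λ r → 2 + k + (5 + r)) (cols≡ α β)) (colsum k α β)))
  (degree k α β) (order-3 k α β)
  where
  rowsum : ∀ k α β → suc k + (5 + (α + 2 * β)) ≡ 6 + k + α + 2 * β
  rowsum = ℕ-Solver.solve-∀
  colsum : ∀ k α β → 2 + k + (5 + (2 * α + β)) ≡ 7 + k + 2 * α + β
  colsum = ℕ-Solver.solve-∀
  degree : ∀ k α β → k + (3 + (α + β)) ≡ 3 + k + α + β
  degree = ℕ-Solver.solve-∀

-- For `s = m + n` the difference `d - e` is `3d + 4 - m - n`, the parameter `k`. Truncation in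
-- `s ∸ 4` is harmless, since `s ≤ 4 + (s ∸ 4)` in any case.
excess : ∀ s d e → s ≡ 2 * d + 4 + e → ⌈ s ∸ 4 /3⌉ ≤ d → e ≤ d
excess s d e eq h = ℕₚ.+-cancelˡ-≤ (2 * d + 4) e d (begin
  2 * d + 4 + e   ≡⟨ eq ⟨
  s               ≤⟨ ℕₚ.m≤n+m∸n s 4 ⟩
  4 + (s ∸ 4)     ≤⟨ ℕₚ.+-monoʳ-≤ 4 (⌈/3⌉-≤ (s ∸ 4) d h) ⟩
  4 + 3 * d       ≡⟨ lemma d ⟩
  2 * d + 4 + d   ∎)
  where
  open ℕₚ.≤-Reasoning
  lemma : ∀ d → 4 + 3 * d ≡ 2 * d + 4 + d
  lemma = ℕ-Solver.solve-∀

above-diagonal : ∀ {m n d} → m + 1 ≤ n → ⌈ m + n ∸ 4 /3⌉ ≤ d → d + 3 ≤ m → HasElementOfOrder3 m n d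
above-diagonal {m} {n} {d} m<n h d≤ with ℕₚ.m≤n⇒∃[o]m+o≡n d≤ | ℕₚ.m≤n⇒∃[o]m+o≡n m<n
... | β , refl | a , refl
  with ℕₚ.m≤n⇒∃[o]m+o≡n (excess _ d (3 + 2 * β + a) (sides d β a) h)
  where
  sides : ∀ d β a → d + 3 + β + (d + 3 + β + 1 + a) ≡ 2 * d + 4 + (3 + 2 * β + a)
  sides = ℕ-Solver.solve-∀
-- Here `a` is `n - m - 1` and `β` is `m - 3 - d`, so there are `a + β` copies of `S₁₂` and `β` of
-- `S₂₁`.
... | k , refl = order-3-at k (a + β) β (row k a β) (col k a β) (dim k a β)
  where
  row : ∀ k a β → 3 + 2 * β + a + k + 3 + β ≡ 6 + k + (a + β) + 2 * β
  row = ℕ-Solver.solve-∀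
  col : ∀ k a β → 3 + 2 * β + a + k + 3 + β + 1 + a ≡ 7 + k + 2 * (a + β) + β
  col = ℕ-Solver.solve-∀
  dim : ∀ k a β → 3 + 2 * β + a + k ≡ 3 + k + (a + β) + β
  dim = ℕ-Solver.solve-∀

on-diagonal : ∀ {m d} → ⌈ 2 * m ∸ 4 /3⌉ ≤ d → d + 4 ≤ m → HasElementOfOrder3 m m d
on-diagonal {m} {d} h d≤ with ℕₚ.m≤n⇒∃[o]m+o≡n d≤
... | β , refl with ℕₚ.m≤n⇒∃[o]m+o≡n (excess _ d (4 + 2 * β) (sides d β) h)
  where
  sides : ∀ d β → 2 * (d + 4 + β) ≡ 2 * d + 4 + (4 + 2 * β)
  sides = ℕ-Solver.solve-∀
-- Here `β` is `m - 4 - d`, and one more `S₂₁` than `S₁₂` balances the extra column of `γ`.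
... | k , refl = order-3-at k β (suc β) (row k β) (col k β) (dim k β)
  where
  row : ∀ k β → 4 + 2 * β + k + 4 + β ≡ 6 + k + β + 2 * suc β
  row = ℕ-Solver.solve-∀
  col : ∀ k β → 4 + 2 * β + k + 4 + β ≡ 7 + k + 2 * β + suc β
  col = ℕ-Solver.solve-∀
  dim : ∀ k β → 4 + 2 * β + k ≡ 3 + k + β + suc β
  dim = ℕ-Solver.solve-∀

theorem4p4 : ∀ (m n d : ℕ) → 1 ≤ m → m ≤ n →
    ((m + 1 ≤ n) → (n + 5 ≤ 2 * m) → ⌈ m + n ∸ 4 /3⌉ ≤ d → d + 3 ≤ m → HasElementOfOrder3 m n d)
    × (⌈ 2 * m ∸ 4 /3⌉ ≤ d → d + 4 ≤ m → HasElementOfOrder3 m m d)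
theorem4p4 m n d _ _ = (λ m<n _ → above-diagonal m<n) , on-diagonal
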